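{- Let $q_1,q_2>1$ be integers and let $\chi_1,\chi_2$ be primitive Dirichlet characters modulo $q_1$ and $q_2$ respectively such that $\chi_1\chi_2(-1)=1$. Put $\psi=\chi_1\overline{\chi_2}$, a Dirichlet character modulo $q_1q_2$. For all $h,k,n\in\mathbb{Z}$ with $q_1q_2\mid k$ and $n,k>0$, $$\sum_{\substack{ad=n\\ (a,q_1q_2)=1}}\psi(a)\sum_{b \bmod d}S_{\chi_1,\chi_2}(ah+bk,\,dk)=\rho_{\chi_1,\chi_2}(n)\,S_{\chi_1,\chi_2}(h,k),$$ where $a,d$ run over positive integers with $ad=n$, and $$\rho_{\chi_1,\chi_2}(n)=\sum_{d\mid n}\chi_1\!\left(\frac nd\right)\overline{\chi_2}(d)\,d .$$
   Context: $B_1(x)=0$ if $x\in\mathbb{Z}$ and $B_1(x)=x-\lfloor x\rfloor-\tfrac12$ otherwise. For $h\in\mathbb{Z}$ and a positive integer $k$ divisible by $q_1q_2$ (no coprimality of $h$ and $k$ is required), the newform Dedekind sum is $$S_{\chi_1,\chi_2}(h,k)=\sum_{j \bmod k}\ \sum_{n \bmod q_1}\overline{\chi_2}(j)\,\overline{\chi_1}(n)\,B_1\!\left(\tfrac{j}{k}\right)B_1\!\left(\tfrac{n}{q_1}+\tfrac{hj}{k}\right).$$ -}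

module Defs where

open import Algebra.Bundles using (CommutativeMonoid)
import Algebra.Properties.CommutativeSemigroup as CommutativeSemigroupProperties
import Algebra.Properties.Group as GroupProperties
import Algebra.Properties.Ring as RingProperties
open import Data.Bool.Base using (if_then_else_)
open import Data.Integer.Base as ℤ using (ℤ; +_)
open import Data.Nat.Base as ℕ using (ℕ; zero; suc; NonZero)
import Data.Nat.DivMod as ℕ
import Data.Nat.Properties as ℕ
open import Data.Nat.Coprimality using (Coprime)
open import Data.Nat.Divisibility using (_∣_; _∣?_)
open import Data.Product.Base using (∃-syntax; _×_; _,_)
open import Data.Rational.Base as ℚ using (ℚ; 0ℚ; 1ℚ; ½; _/_; ∣_∣)
import Data.Rational.Properties as ℚ
open import Relation.Binary.PropositionalEquality
  using (_≡_; sym; cong; cong₂; subst; module ≡-Reasoning)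
open import Relation.Nullary using (¬_; does)

-- Real numbers: Cauchy sequences of rationals, up to null sequences.

Cauchy : (ℕ → ℚ) → Set
Cauchy x = ∀ ε → 0ℚ ℚ.< ε →
  ∃[ N ] (∀ m n → N ℕ.≤ m → N ℕ.≤ n → ∣ x m ℚ.- x n ∣ ℚ.< ε)

record ℝ : Set where
  constructor mkℝ
  field
    seq    : ℕ → ℚ
    cauchy : Cauchy seq

open ℝ public

infix 4 _≈ᵣ_

_≈ᵣ_ : ℝ → ℝ → Set
x ≈ᵣ y = ∀ ε → 0ℚ ℚ.< ε →
  ∃[ N ] (∀ n → N ℕ.≤ n → ∣ seq x n ℚ.- seq y n ∣ ℚ.< ε)

open CommutativeSemigroupProperties
  (CommutativeMonoid.commutativeSemigroup ℚ.+-0-commutativeMonoid)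
  using (interchange)
open GroupProperties ℚ.+-0-group using (//-rightDividesˡ)
open RingProperties ℚ.+-*-ring using (x[y-z]≈xy-xz)

half-pos : ∀ {ε} → 0ℚ ℚ.< ε → 0ℚ ℚ.< ε ℚ.* ½
half-pos {ε} 0<ε =
  subst (ℚ._< ε ℚ.* ½) (ℚ.*-zeroˡ ½) (ℚ.*-monoˡ-<-pos ½ 0<ε)

halves : ∀ ε → ε ℚ.* ½ ℚ.+ ε ℚ.* ½ ≡ ε
halves ε = begin
  ε ℚ.* ½ ℚ.+ ε ℚ.* ½  ≡⟨ sym (ℚ.*-distribˡ-+ ε ½ ½) ⟩
  ε ℚ.* 1ℚ             ≡⟨ ℚ.*-identityʳ ε ⟩
  ε                    ∎
  where open ≡-Reasoning

const-cauchy : ∀ p → Cauchy (λ _ → p)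
const-cauchy p ε 0<ε = 0 , λ _ _ _ _ →
  subst (λ t → ∣ t ∣ ℚ.< ε) (sym (ℚ.+-inverseʳ p)) 0<ε

add-cauchy : ∀ {x y} → Cauchy x → Cauchy y → Cauchy (λ n → x n ℚ.+ y n)
add-cauchy {x} {y} cx cy ε 0<ε
  with cx (ε ℚ.* ½) (half-pos 0<ε) | cy (ε ℚ.* ½) (half-pos 0<ε)
... | M , hM | N , hN = M ℕ.⊔ N , λ m n le le′ → begin-strict
  ∣ (x m ℚ.+ y m) ℚ.- (x n ℚ.+ y n) ∣
    ≡⟨ cong ∣_∣ (swap (x m) (y m) (x n) (y n)) ⟩
  ∣ (x m ℚ.- x n) ℚ.+ (y m ℚ.- y n) ∣
    ≤⟨ ℚ.∣p+q∣≤∣p∣+∣q∣ (x m ℚ.- x n) (y m ℚ.- y n) ⟩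
  ∣ x m ℚ.- x n ∣ ℚ.+ ∣ y m ℚ.- y n ∣
    <⟨ ℚ.+-mono-< (hM m n (ℕ.m⊔n≤o⇒m≤o M N le) (ℕ.m⊔n≤o⇒m≤o M N le′))
                  (hN m n (ℕ.m⊔n≤o⇒n≤o M N le) (ℕ.m⊔n≤o⇒n≤o M N le′)) ⟩
  ε ℚ.* ½ ℚ.+ ε ℚ.* ½
    ≡⟨ halves ε ⟩
  ε ∎
  where
  open ℚ.≤-Reasoning
  swap : ∀ a b c d → (a ℚ.+ b) ℚ.- (c ℚ.+ d) ≡ (a ℚ.- c) ℚ.+ (b ℚ.- d)
  swap a b c d = begin-equality
    (a ℚ.+ b) ℚ.- (c ℚ.+ d)
      ≡⟨ cong ((a ℚ.+ b) ℚ.+_) (ℚ.neg-distrib-+ c d) ⟩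
    (a ℚ.+ b) ℚ.+ (ℚ.- c ℚ.+ ℚ.- d)
      ≡⟨ interchange a b (ℚ.- c) (ℚ.- d) ⟩
    (a ℚ.- c) ℚ.+ (b ℚ.- d) ∎

neg-cauchy : ∀ {x} → Cauchy x → Cauchy (λ n → ℚ.- x n)
neg-cauchy {x} cx ε 0<ε with cx ε 0<ε
... | N , hN = N , λ m n le le′ →
  subst (ℚ._< ε) (sym (abs-swap (x m) (x n))) (hN m n le le′)
  where
  open ≡-Reasoning
  abs-swap : ∀ a b → ∣ ℚ.- a ℚ.- ℚ.- b ∣ ≡ ∣ a ℚ.- b ∣
  abs-swap a b = begin
    ∣ ℚ.- a ℚ.- ℚ.- b ∣  ≡⟨ cong ∣_∣ (sym (ℚ.neg-distrib-+ a (ℚ.- b))) ⟩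
    ∣ ℚ.- (a ℚ.- b) ∣    ≡⟨ ℚ.∣-p∣≡∣p∣ (a ℚ.- b) ⟩
    ∣ a ℚ.- b ∣          ∎

cauchy-bounded : ∀ {x} → Cauchy x →
  ∃[ B ] (0ℚ ℚ.< B × ∃[ N ] (∀ n → N ℕ.≤ n → ∣ x n ∣ ℚ.≤ B))
cauchy-bounded {x} cx with cx 1ℚ (ℚ.positive⁻¹ 1ℚ)
... | N , hN = 1ℚ ℚ.+ ∣ x N ∣
             , ℚ.+-mono-<-≤ (ℚ.positive⁻¹ 1ℚ) (ℚ.0≤∣p∣ (x N))
             , N , λ n le → begin
    ∣ x n ∣                          ≡⟨ cong ∣_∣ (split (x n) (x N)) ⟩
    ∣ (x n ℚ.- x N) ℚ.+ x N ∣        ≤⟨ ℚ.∣p+q∣≤∣p∣+∣q∣ (x n ℚ.- x N) (x N) ⟩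
    ∣ x n ℚ.- x N ∣ ℚ.+ ∣ x N ∣      ≤⟨ ℚ.+-monoˡ-≤ ∣ x N ∣ (ℚ.<⇒≤ (hN n N le ℕ.≤-refl)) ⟩
    1ℚ ℚ.+ ∣ x N ∣                   ∎
  where
  open ℚ.≤-Reasoning
  split : ∀ a b → a ≡ (a ℚ.- b) ℚ.+ b
  split a b = sym (//-rightDividesˡ b a)

mul-diff : ∀ a b c d →
  a ℚ.* b ℚ.- c ℚ.* d ≡ a ℚ.* (b ℚ.- d) ℚ.+ d ℚ.* (a ℚ.- c)
mul-diff a b c d = sym (begin
  a ℚ.* (b ℚ.- d) ℚ.+ d ℚ.* (a ℚ.- c)
    ≡⟨ cong₂ ℚ._+_ (x[y-z]≈xy-xz a b d) (x[y-z]≈xy-xz d a c) ⟩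
  (a ℚ.* b ℚ.- a ℚ.* d) ℚ.+ (d ℚ.* a ℚ.- d ℚ.* c)
    ≡⟨ cong₂ (λ s t → (a ℚ.* b ℚ.- a ℚ.* d) ℚ.+ (s ℚ.- t))
             (ℚ.*-comm d a) (ℚ.*-comm d c) ⟩
  (a ℚ.* b ℚ.- a ℚ.* d) ℚ.+ (a ℚ.* d ℚ.- c ℚ.* d)
    ≡⟨ sym (ℚ.+-assoc (a ℚ.* b ℚ.- a ℚ.* d) (a ℚ.* d) (ℚ.- (c ℚ.* d))) ⟩
  (a ℚ.* b ℚ.- a ℚ.* d) ℚ.+ a ℚ.* d ℚ.- c ℚ.* d
    ≡⟨ cong (ℚ._- c ℚ.* d) (//-rightDividesˡ (a ℚ.* d) (a ℚ.* b)) ⟩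
  a ℚ.* b ℚ.- c ℚ.* d ∎)
  where open ≡-Reasoning

mul-bound : ∀ D δ p r → 0ℚ ℚ.< D → ∣ p ∣ ℚ.≤ D → ∣ r ∣ ℚ.< δ →
  ∣ p ℚ.* r ∣ ℚ.< D ℚ.* δ
mul-bound D δ p r 0<D p≤D r<δ = begin-strict
  ∣ p ℚ.* r ∣       ≡⟨ ℚ.∣p*q∣≡∣p∣*∣q∣ p r ⟩
  ∣ p ∣ ℚ.* ∣ r ∣   ≤⟨ ℚ.*-monoʳ-≤-nonNeg ∣ r ∣ {{ℚ.∣-∣-nonNeg r}} p≤D ⟩
  D ℚ.* ∣ r ∣       <⟨ ℚ.*-monoʳ-<-pos D {{ℚ.positive 0<D}} r<δ ⟩
  D ℚ.* δ           ∎
  where open ℚ.≤-Reasoning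

mul-diff-bound : ∀ A B δ a b c d → 0ℚ ℚ.< A → 0ℚ ℚ.< B →
  ∣ a ∣ ℚ.≤ A → ∣ d ∣ ℚ.≤ B → ∣ b ℚ.- d ∣ ℚ.< δ → ∣ a ℚ.- c ∣ ℚ.< δ →
  ∣ a ℚ.* b ℚ.- c ℚ.* d ∣ ℚ.< (A ℚ.+ B) ℚ.* δ
mul-diff-bound A B δ a b c d 0<A 0<B a≤A d≤B bd<δ ac<δ = begin-strict
  ∣ a ℚ.* b ℚ.- c ℚ.* d ∣
    ≡⟨ cong ∣_∣ (mul-diff a b c d) ⟩
  ∣ a ℚ.* (b ℚ.- d) ℚ.+ d ℚ.* (a ℚ.- c) ∣
    ≤⟨ ℚ.∣p+q∣≤∣p∣+∣q∣ (a ℚ.* (b ℚ.- d)) (d ℚ.* (a ℚ.- c)) ⟩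
  ∣ a ℚ.* (b ℚ.- d) ∣ ℚ.+ ∣ d ℚ.* (a ℚ.- c) ∣
    <⟨ ℚ.+-mono-< (mul-bound A δ a (b ℚ.- d) 0<A a≤A bd<δ)
                  (mul-bound B δ d (a ℚ.- c) 0<B d≤B ac<δ) ⟩
  A ℚ.* δ ℚ.+ B ℚ.* δ
    ≡⟨ sym (ℚ.*-distribʳ-+ δ A B) ⟩
  (A ℚ.+ B) ℚ.* δ ∎
  where open ℚ.≤-Reasoning

divide-pos : ∀ C ε → 0ℚ ℚ.< C → 0ℚ ℚ.< ε →
  ∃[ δ ] (0ℚ ℚ.< δ × C ℚ.* δ ≡ ε)
divide-pos C ε 0<C 0<ε = ε ℚ.* C⁻¹ , 0<δ , total
  where
  instance
    C⁺ : ℚ.Positive C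
    C⁺ = ℚ.positive 0<C
    C≢0 : ℚ.NonZero C
    C≢0 = ℚ.pos⇒nonZero C
  C⁻¹ : ℚ
  C⁻¹ = ℚ.1/ C
  0<δ : 0ℚ ℚ.< ε ℚ.* C⁻¹
  0<δ = subst (ℚ._< ε ℚ.* C⁻¹) (ℚ.*-zeroˡ C⁻¹)
    (ℚ.*-monoˡ-<-pos C⁻¹ {{ℚ.1/pos⇒pos C}} 0<ε)
  open ≡-Reasoning
  total : C ℚ.* (ε ℚ.* C⁻¹) ≡ ε
  total = begin
    C ℚ.* (ε ℚ.* C⁻¹)   ≡⟨ ℚ.*-comm C (ε ℚ.* C⁻¹) ⟩
    (ε ℚ.* C⁻¹) ℚ.* C   ≡⟨ ℚ.*-assoc ε C⁻¹ C ⟩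
    ε ℚ.* (C⁻¹ ℚ.* C)   ≡⟨ cong (ε ℚ.*_) (ℚ.*-inverseˡ C) ⟩
    ε ℚ.* 1ℚ            ≡⟨ ℚ.*-identityʳ ε ⟩
    ε                   ∎

⊔⁴ : ∀ a b c d {o} → (a ℕ.⊔ b) ℕ.⊔ (c ℕ.⊔ d) ℕ.≤ o →
  a ℕ.≤ o × b ℕ.≤ o × c ℕ.≤ o × d ℕ.≤ o
⊔⁴ a b c d le = ℕ.m⊔n≤o⇒m≤o a b p , ℕ.m⊔n≤o⇒n≤o a b p
              , ℕ.m⊔n≤o⇒m≤o c d q , ℕ.m⊔n≤o⇒n≤o c d q
  where
  p = ℕ.m⊔n≤o⇒m≤o (a ℕ.⊔ b) (c ℕ.⊔ d) le
  q = ℕ.m⊔n≤o⇒n≤o (a ℕ.⊔ b) (c ℕ.⊔ d) le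

mul-cauchy : ∀ {x y} → Cauchy x → Cauchy y → Cauchy (λ n → x n ℚ.* y n)
mul-cauchy {x} {y} cx cy ε 0<ε =
  let (A , 0<A , K , hA) = cauchy-bounded {x} cx
      (B , 0<B , L , hB) = cauchy-bounded {y} cy
      (δ , 0<δ , total)  = divide-pos (A ℚ.+ B) ε (ℚ.+-mono-< 0<A 0<B) 0<ε
      (M , hx) = cx δ 0<δ
      (N , hy) = cy δ 0<δ
  in (K ℕ.⊔ L) ℕ.⊔ (M ℕ.⊔ N) , λ m n le le′ →
    let (a , _ , c  , d ) = ⊔⁴ K L M N le
        (_ , b , c′ , d′) = ⊔⁴ K L M N le′
    in subst (∣ x m ℚ.* y m ℚ.- x n ℚ.* y n ∣ ℚ.<_) total
         (mul-diff-bound A B δ (x m) (y m) (x n) (y n) 0<A 0<B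
           (hA m a) (hB n b) (hy m n d d′) (hx m n c c′))

infixl 6 _+ᵣ_
infixl 7 _*ᵣ_

fromℚᵣ : ℚ → ℝ
fromℚᵣ p = mkℝ (λ _ → p) (const-cauchy p)

_+ᵣ_ : ℝ → ℝ → ℝ
x +ᵣ y = mkℝ (λ n → seq x n ℚ.+ seq y n)
  (add-cauchy {seq x} {seq y} (cauchy x) (cauchy y))

-ᵣ_ : ℝ → ℝ
-ᵣ x = mkℝ (λ n → ℚ.- seq x n) (neg-cauchy {seq x} (cauchy x))

_*ᵣ_ : ℝ → ℝ → ℝ
x *ᵣ y = mkℝ (λ n → seq x n ℚ.* seq y n)
  (mul-cauchy {seq x} {seq y} (cauchy x) (cauchy y))

record ℂ : Set where
  constructor _+i_
  field
    re : ℝ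
    im : ℝ

open ℂ public

infix  4 _≈_
infixl 6 _+_
infixl 7 _*_

_≈_ : ℂ → ℂ → Set
z ≈ w = re z ≈ᵣ re w × im z ≈ᵣ im w

fromℚ : ℚ → ℂ
fromℚ p = fromℚᵣ p +i fromℚᵣ 0ℚ

0ℂ : ℂ
0ℂ = fromℚ 0ℚ

1ℂ : ℂ
1ℂ = fromℚ 1ℚ

_+_ : ℂ → ℂ → ℂ
z + w = (re z +ᵣ re w) +i (im z +ᵣ im w)

_*_ : ℂ → ℂ → ℂ
z * w = (re z *ᵣ re w +ᵣ (-ᵣ (im z *ᵣ im w))) +i (re z *ᵣ im w +ᵣ im z *ᵣ re w)

conj : ℂ → ℂ
conj z = re z +i (-ᵣ im z)

∑ : ℕ → (ℕ → ℂ) → ℂ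
∑ zero    f = 0ℂ
∑ (suc n) f = ∑ n f + f n

infix 5 ∑
syntax ∑ n (λ i → t) = ∑[ i < n ] t

-- Sum over the positive divisors d of n.  (The bound d ≤ n loses nothing, as
-- these sums are only used for n > 0.)
∑-divisors : (n : ℕ) → ((d : ℕ) → .{{NonZero d}} → ℂ) → ℂ
∑-divisors n f =
  ∑[ i < n ] (if does (suc i ∣? n) then f (suc i) else 0ℂ)

-- Sum over the pairs of positive integers (a , d) with a d = n, for n > 0.
∑-factorisations : (n : ℕ) → ((a d : ℕ) → .{{NonZero d}} → ℂ) → ℂ
∑-factorisations n f =
  ∑[ i < n ] ∑[ j < n ]
    (if does (suc i ℕ.* suc j ℕ.≟ n) then f (suc i) (suc j) else 0ℂ)

-- Characters are functions on all of ℤ, extended by zero.  That χ does not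
-- vanish on integers coprime to q follows from `one`, `mult` and `periodic`.
record DirichletCharacter (q : ℕ) : Set where
  infix 8 _⟨_⟩
  field
    _⟨_⟩     : ℤ → ℂ
    one      : _⟨_⟩ (+ 1) ≈ 1ℂ
    mult     : ∀ m n → _⟨_⟩ (m ℤ.* n) ≈ _⟨_⟩ m * _⟨_⟩ n
    periodic : ∀ n → _⟨_⟩ (n ℤ.+ + q) ≈ _⟨_⟩ n
    zeros    : ∀ n → ¬ Coprime ℤ.∣ n ∣ q → _⟨_⟩ n ≈ 0ℂ

open DirichletCharacter public using (_⟨_⟩)

InducedBy : ∀ {q d} → DirichletCharacter q → DirichletCharacter d → Set
InducedBy {q} χ χ′ = ∀ n → Coprime ℤ.∣ n ∣ q → χ ⟨ n ⟩ ≈ χ′ ⟨ n ⟩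

Primitive : ∀ {q} → DirichletCharacter q → Set
Primitive {q} χ = ∀ d → d ∣ q → d ℕ.< q →
  ¬ (∃[ χ′ ] InducedBy {q} {d} χ χ′)

-- The values of χ₁ χ̄₂.  Since χ₁ and χ₂ vanish off the integers coprime to
-- q₁ and q₂, the pointwise product is already the character modulo q₁ q₂.
ψ : ∀ {q₁ q₂} → DirichletCharacter q₁ → DirichletCharacter q₂ → ℤ → ℂ
ψ χ₁ χ₂ n = χ₁ ⟨ n ⟩ * conj (χ₂ ⟨ n ⟩)

-- Only values at rational arguments are needed.
B₁ : ℚ → ℚ
B₁ x = if does (x ℚ.≟ ℚ.floor x / 1) then 0ℚ else x ℚ.- ℚ.floor x / 1 ℚ.- ½

-- When q₁ q₂ ∣ k, the summand depends only on j mod k and n mod q₁, so the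
-- least nonnegative representatives are used.
dedekindSum : ∀ {q₁ q₂} .{{_ : NonZero q₁}} →
  DirichletCharacter q₁ → DirichletCharacter q₂ →
  (h : ℤ) (k : ℕ) .{{_ : NonZero k}} → ℂ
dedekindSum {q₁} χ₁ χ₂ h k =
  ∑[ j < k ] ∑[ n < q₁ ]
    conj (χ₂ ⟨ + j ⟩) * conj (χ₁ ⟨ + n ⟩)
      * fromℚ (B₁ (+ j / k))
      * fromℚ (B₁ (+ n / q₁ ℚ.+ (h ℤ.* + j) / k))

ρ : ∀ {q₁ q₂} → DirichletCharacter q₁ → DirichletCharacter q₂ → ℕ → ℂ
ρ χ₁ χ₂ n = ∑-divisors n λ d →
  χ₁ ⟨ + (n ℕ./ d) ⟩ * conj (χ₂ ⟨ + d ⟩) * fromℚ (+ d / 1)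

{-# OPTIONS --safe #-}

-- Write F (y) = Σ_n χ̄₁(n) B₁(n/q₁ + y) and S(h,k) = Σ_j χ̄₂(j) B₁(j/k) F(hj/k).
-- With g = gcd(j , d), the distribution relation Σ_{t mod c} B₁(x + t/c) = B₁(c x)
-- evaluates the sum over b, and primitivity of χ₁ gives
-- Σ_n χ̄₁(n) B₁(d n/q₁ + y) = χ₁(d) F(y) for every d (both sides vanish unless
-- (d , q₁) = 1).  Hence, with i = a j, the left-hand side becomes a sum over
-- i mod n k and a ∣ (i , n) of terms W(i , (i , n)/a), where
-- W(i , g) = χ̄₂(i) B₁(i/nk) g χ₁(n/g) F(h i/gk).
-- The involution a ↦ (i , n)/a replaces these by W(i , g) over g ∣ (i , n), and
-- for fixed g the sum over i folds back to g χ₁(n/g) χ̄₂(g) S(h,k).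
module Submission where

open import Defs
open import Algebra.Bundles using (AbelianGroup; CommutativeRing)
import Algebra.Properties.Group as GroupProperties
import Algebra.Solver.Ring.NaturalCoefficients.Default as NaturalCoefficients
open import Algebra.Structures using (IsCommutativeRing)
open import Data.Bool.Base using (if_then_else_)
open import Data.Empty using (⊥-elim)
open import Data.Integer.Base as ℤ using (ℤ; +_; -[1+_]; 0ℤ; 1ℤ)
import Data.Integer.DivMod as ℤ
open import Data.Integer.Divisibility.Signed as ℤ∣ using (∣ᵤ⇒∣; ∣⇒∣ᵤ)
import Data.Integer.GCD as ℤ using (gcd)
import Data.Integer.Properties as ℤ
import Data.Integer.Solver as ℤSolver
open import Data.List.Base using ([]; _∷_)
open import Data.List.Relation.Unary.All using (_∷_)
open import Data.Nat.Base as ℕ using (ℕ; zero; suc; NonZero)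
open import Data.Nat.Coprimality as Coprime
  using (Coprime; coprime?; coprime-divisor; coprime-Bézout)
open import Data.Nat.Divisibility as ℕ∣ using (_∣_; _∣?_; divides)
import Data.Nat.DivMod as ℕ
open import Data.Nat.GCD
  using (gcd; gcd[m,n]∣m; gcd[m,n]∣n; gcd[m,n]≢0; c*gcd[m,n]≡gcd[cm,cn]; module Bézout)
open import Data.Nat.Primality using (Prime; prime⇒irreducible; prime⇒nonTrivial; ¬prime[1])
open import Data.Nat.Primality.Factorisation using (factorise)
open import Data.Nat.Properties using (m*n≢0)
import Data.Nat.Properties as ℕ
open import Data.Product.Base using (∃-syntax; _×_; _,_; proj₁; proj₂)
open import Data.Rational.Base as ℚ using (ℚ; 0ℚ; 1ℚ; ½; _/_)
import Data.Rational.Properties as ℚ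
import Data.Rational.Solver as ℚSolver
import Data.Rational.Unnormalised.Base as ℚᵘ
import Data.Rational.Unnormalised.Properties as ℚᵘ
open import Data.Sum.Base using (_⊎_; inj₁; inj₂)
open import Data.Unit.Base using (tt)
open import Level using (0ℓ)
open import Relation.Binary.PropositionalEquality
  using (_≡_; _≢_; refl; sym; trans; cong; cong₂; subst; subst₂; module ≡-Reasoning)
import Relation.Binary.Reasoning.Setoid as SetoidReasoning
open import Relation.Nullary using (¬_; Dec; yes; no; does; contradiction)
open import Relation.Nullary.Decidable using (_×-dec_)

-- After the sum over `b`, the term attached to `a`, `d`, `j` depends only on `i = a j` and
-- `g = gcd j d`: with `n = a d` one has `χ₁(a) χ₁(d/g) = χ₁(n/g)` and `a (j/g) = i/g`. Moreover
-- `g = gcd i n / a`, so `a` is seen only through its complement in `gcd i n`; this is what makes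
-- the involution available.
--
-- Reals are Cauchy sequences, so equality is undecidable, while `Primitive` is a purely negative
-- statement. It can still produce an equation because equality is stable under double negation: to
-- prove that a twisted sum `G` vanishes, one may assume that it does not. A nonzero `G` can be
-- cancelled from `G = χ̄₁(r) G`, which makes `χ₁` trivial on the units `r` congruent to 1 modulo a
-- proper divisor of `q₁`, so that `χ₁` is induced from that divisor. The same cancellation shows
-- that `χ₁` has absolute value 1 at units, with no appeal to roots of unity. The proper divisor is
-- always taken of the form `q₁/p` with `p` prime, which makes lifting units back to modulus `q₁`
-- elementary.

module ℤS = ℤSolver.+-*-Solver
module ℚS = ℚSolver.+-*-Solver

-- Complex numbers up to equality

-- `x ≈ᵣ y` unfolds to `Null` of the difference of the two sequences, so equalities of reals reduce
-- to closure properties of null sequences.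
Null : (ℕ → ℚ) → Set
Null x = ∀ ε → 0ℚ ℚ.< ε → ∃[ N ] (∀ n → N ℕ.≤ n → ℚ.∣ x n ∣ ℚ.< ε)

null-cong : ∀ {x y} → (∀ n → x n ≡ y n) → Null x → Null y
null-cong x≡y null ε 0<ε with null ε 0<ε
... | N , small = N , λ n N≤n → subst (λ t → ℚ.∣ t ∣ ℚ.< ε) (x≡y n) (small n N≤n)

null-≤ : ∀ {x y} → (∀ n → ℚ.∣ x n ∣ ℚ.≤ ℚ.∣ y n ∣) → Null y → Null x
null-≤ x≤y null ε 0<ε with null ε 0<ε
... | N , small = N , λ n N≤n → ℚ.≤-<-trans (x≤y n) (small n N≤n)

null-0 : Null (λ _ → 0ℚ)
null-0 ε 0<ε = 0 , λ _ _ → 0<ε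

null-+ : ∀ {x y} → Null x → Null y → Null (λ n → x n ℚ.+ y n)
null-+ {x} {y} nx ny ε 0<ε
  with nx (ε ℚ.* ½) (half-pos 0<ε) | ny (ε ℚ.* ½) (half-pos 0<ε)
... | M , hM | N , hN = M ℕ.⊔ N , λ n le → begin-strict
  ℚ.∣ x n ℚ.+ y n ∣      ≤⟨ ℚ.∣p+q∣≤∣p∣+∣q∣ (x n) (y n) ⟩
  ℚ.∣ x n ∣ ℚ.+ ℚ.∣ y n ∣  <⟨ ℚ.+-mono-< (hM n (ℕ.m⊔n≤o⇒m≤o M N le)) (hN n (ℕ.m⊔n≤o⇒n≤o M N le)) ⟩
  ε ℚ.* ½ ℚ.+ ε ℚ.* ½  ≡⟨ halves ε ⟩
  ε                    ∎
  where open ℚ.≤-Reasoning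

null-neg : ∀ {x} → Null x → Null (λ n → ℚ.- x n)
null-neg {x} = null-≤ λ n → ℚ.≤-reflexive (ℚ.∣-p∣≡∣p∣ (x n))

null-*-cauchy : ∀ {x y} → Null x → Cauchy y → Null (λ n → y n ℚ.* x n)
null-*-cauchy {x} {y} nx cy ε 0<ε =
  let (B , 0<B , M , bound) = cauchy-bounded {y} cy
      (δ , 0<δ , Bδ≡ε)      = divide-pos B ε 0<B 0<ε
      (N , small)           = nx δ 0<δ
  in M ℕ.⊔ N , λ n le → subst (ℚ.∣ y n ℚ.* x n ∣ ℚ.<_) Bδ≡ε
       (mul-bound B δ (y n) (x n) 0<B (bound n (ℕ.m⊔n≤o⇒m≤o M N le))
         (small n (ℕ.m⊔n≤o⇒n≤o M N le)))

-- A constructive substitute for deciding whether the limit is 0. With `δ = ε/3` and a tail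
-- oscillating by less than `δ`, one decidable comparison of the rational `∣ x N ∣` with `2δ`
-- settles the tail: it stays below `3δ`, or it stays above `2δ - δ`.
cauchy-small-or-apart : ∀ {x} → Cauchy x → ∀ ε → 0ℚ ℚ.< ε →
  (∃[ N ] (∀ n → N ℕ.≤ n → ℚ.∣ x n ∣ ℚ.< ε)) ⊎
  (∃[ δ ] (0ℚ ℚ.< δ × ∃[ N ] (∀ n → N ℕ.≤ n → δ ℚ.< ℚ.∣ x n ∣)))
cauchy-small-or-apart {x} cx ε 0<ε
  with divide-pos (+ 3 ℚ./ 1) ε (ℚ.positive⁻¹ (+ 3 ℚ./ 1)) 0<ε
... | δ , 0<δ , 3δ≡ε with cx δ 0<δ
... | N , close with ℚ.∣ x N ∣ ℚ.<? (δ ℚ.+ δ)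
... | yes small = inj₁ (N , λ n N≤n → begin-strict
  ℚ.∣ x n ∣                          ≡⟨ cong ℚ.∣_∣ (solve 2 (λ a b → a := (a :- b) :+ b) refl (x n) (x N)) ⟩
  ℚ.∣ (x n ℚ.- x N) ℚ.+ x N ∣        ≤⟨ ℚ.∣p+q∣≤∣p∣+∣q∣ (x n ℚ.- x N) (x N) ⟩
  ℚ.∣ x n ℚ.- x N ∣ ℚ.+ ℚ.∣ x N ∣      <⟨ ℚ.+-mono-< (close n N N≤n ℕ.≤-refl) small ⟩
  δ ℚ.+ (δ ℚ.+ δ)                  ≡⟨ solve 1 (λ d → d :+ (d :+ d) := con (+ 3 ℚ./ 1) :* d) refl δ ⟩
  (+ 3 ℚ./ 1) ℚ.* δ                ≡⟨ 3δ≡ε ⟩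
  ε                                ∎)
  where open ℚ.≤-Reasoning
        open ℚS
... | no large = inj₂ (δ , 0<δ , N , λ n N≤n → begin-strict
  δ                                      ≡⟨ solve 1 (λ d → d := (:- d) :+ (d :+ d)) refl δ ⟩
  ℚ.- δ ℚ.+ (δ ℚ.+ δ)                    ≤⟨ ℚ.+-monoʳ-≤ (ℚ.- δ) (ℚ.≮⇒≥ large) ⟩
  ℚ.- δ ℚ.+ ℚ.∣ x N ∣                      ≡⟨ cong (λ t → ℚ.- δ ℚ.+ ℚ.∣ t ∣) (solve 2 (λ a b → b := (b :- a) :+ a) refl (x n) (x N)) ⟩
  ℚ.- δ ℚ.+ ℚ.∣ (x N ℚ.- x n) ℚ.+ x n ∣    ≤⟨ ℚ.+-monoʳ-≤ (ℚ.- δ) (ℚ.∣p+q∣≤∣p∣+∣q∣ (x N ℚ.- x n) (x n)) ⟩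
  ℚ.- δ ℚ.+ (ℚ.∣ x N ℚ.- x n ∣ ℚ.+ ℚ.∣ x n ∣) <⟨ ℚ.+-monoʳ-< (ℚ.- δ) (ℚ.+-monoˡ-< ℚ.∣ x n ∣ (close N n ℕ.≤-refl N≤n)) ⟩
  ℚ.- δ ℚ.+ (δ ℚ.+ ℚ.∣ x n ∣)              ≡⟨ solve 2 (λ d a → (:- d) :+ (d :+ a) := a) refl δ ℚ.∣ x n ∣ ⟩
  ℚ.∣ x n ∣                                ∎)
  where open ℚ.≤-Reasoning
        open ℚS

-- A tail bounded away from 0 refutes `Null x` outright, so for each `ε` the dichotomy leaves only
-- the small case.
null-stable : ∀ {x} → Cauchy x → ¬ ¬ Null x → Null x
null-stable {x} cx ¬¬null ε 0<ε with cauchy-small-or-apart {x} cx ε 0<ε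
... | inj₁ small = small
... | inj₂ (δ , 0<δ , N , apart) = contradiction not-null ¬¬null
  where
  not-null : ¬ Null x
  not-null null with null δ 0<δ
  ... | M , small = ℚ.<-asym (apart (M ℕ.⊔ N) (ℕ.m≤n⊔m M N)) (small (M ℕ.⊔ N) (ℕ.m≤m⊔n M N))

-- Cancellation from the mere negation `¬ Null x`, without a lower bound on `x`: if `y` stayed above
-- `δ`, then dividing the null product by `δ` would make `x` null.
null-domain : ∀ {x y} → Cauchy y → Null (λ n → x n ℚ.* y n) → ¬ Null x → Null y
null-domain {x} {y} cy nxy ¬nx ε 0<ε with cauchy-small-or-apart {y} cy ε 0<ε
... | inj₁ small = small
... | inj₂ (δ , 0<δ , N , apart) = contradiction nx ¬nx
  where
  nx : Null x
  nx η 0<η with nxy (η ℚ.* δ) (subst (ℚ._< η ℚ.* δ) (ℚ.*-zeroˡ δ) (ℚ.*-monoˡ-<-pos δ {{ℚ.positive 0<δ}} 0<η))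
  ... | M , small = M ℕ.⊔ N , λ n le →
    ℚ.*-cancelʳ-<-nonNeg δ {{ℚ.pos⇒nonNeg δ {{ℚ.positive 0<δ}}}} (begin-strict
      ℚ.∣ x n ∣ ℚ.* δ        ≤⟨ ℚ.*-monoˡ-≤-nonNeg ℚ.∣ x n ∣ {{ℚ.∣-∣-nonNeg (x n)}} (ℚ.<⇒≤ (apart n (ℕ.m⊔n≤o⇒n≤o M N le))) ⟩
      ℚ.∣ x n ∣ ℚ.* ℚ.∣ y n ∣  ≡⟨ ℚ.∣p*q∣≡∣p∣*∣q∣ (x n) (y n) ⟨
      ℚ.∣ x n ℚ.* y n ∣      <⟨ small n (ℕ.m⊔n≤o⇒m≤o M N le) ⟩
      η ℚ.* δ              ∎)
    where open ℚ.≤-Reasoning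

-- _≈_ unfolds to a statement about rational sequences, from which Agda cannot
-- recover the two complex numbers; the record makes them inferable.
infix 4 _≋_

record _≋_ (z w : ℂ) : Set where
  constructor wrap
  field unwrap : z ≈ w

open _≋_ public

-- The ring laws already hold term by term on representatives, so they become rational identities
-- for the solver; limits matter only for congruence and cancellation.
pointwise : ∀ {z w} → (∀ n → seq (re z) n ≡ seq (re w) n) →
  (∀ n → seq (im z) n ≡ seq (im w) n) → z ≋ w
pointwise {z} {w} res ims = wrap (null res , null ims)
  where
  null : ∀ {x y : ℕ → ℚ} → (∀ n → x n ≡ y n) → Null (λ n → x n ℚ.- y n)
  null {x} {y} eq = null-cong (λ n → sym (trans (cong (ℚ._- y n) (eq n)) (ℚ.+-inverseʳ (y n)))) null-0

infixl 6 _⊕_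
infixl 7 _⊗_

-- Opaque copies of the complex operations: left transparent, they unfold to
-- Cauchy sequences during unification.
opaque
  _⊕_ _⊗_ : ℂ → ℂ → ℂ
  _⊕_ = _+_
  _⊗_ = _*_

  ⊖_ : ℂ → ℂ
  ⊖ z = (-ᵣ re z) +i (-ᵣ im z)

  conjugate : ℂ → ℂ
  conjugate = conj

  rational : ℚ → ℂ
  rational = fromℚ

  sum : ℕ → (ℕ → ℂ) → ℂ
  sum = ∑

𝟘 𝟙 : ℂ
𝟘 = rational 0ℚ
𝟙 = rational 1ℚ

≋-refl : ∀ {z} → z ≋ z
≋-refl = pointwise (λ _ → refl) (λ _ → refl)

≋-sym : ∀ {z w} → z ≋ w → w ≋ z
≋-sym {z} {w} (wrap (r , i)) = wrap (flip (re z) (re w) r , flip (im z) (im w) i)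
  where
  open ℚS
  flip : ∀ x y → x ≈ᵣ y → y ≈ᵣ x
  flip x y p = null-cong
    (λ n → solve 2 (λ a b → :- (a :- b) := b :- a) refl (seq x n) (seq y n))
    (null-neg p)

≋-trans : ∀ {u v w} → u ≋ v → v ≋ w → u ≋ w
≋-trans {u} {v} {w} (wrap (r , i)) (wrap (r′ , i′)) =
  wrap (comp (re u) (re v) (re w) r r′ , comp (im u) (im v) (im w) i i′)
  where
  open ℚS
  comp : ∀ x y z → x ≈ᵣ y → y ≈ᵣ z → x ≈ᵣ z
  comp x y z p q = null-cong
    (λ n → solve 3 (λ a b c → (a :- b) :+ (b :- c) := a :- c) refl (seq x n) (seq y n) (seq z n))
    (null-+ p q)

+ᵣ-cong : ∀ x x′ y y′ → x ≈ᵣ x′ → y ≈ᵣ y′ → x +ᵣ y ≈ᵣ x′ +ᵣ y′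
+ᵣ-cong x x′ y y′ p q = null-cong
  (λ n → solve 4 (λ a a′ b b′ → (a :- a′) :+ (b :- b′) := (a :+ b) :- (a′ :+ b′)) refl
    (seq x n) (seq x′ n) (seq y n) (seq y′ n))
  (null-+ p q)
  where open ℚS

-ᵣ-cong : ∀ x x′ → x ≈ᵣ x′ → -ᵣ x ≈ᵣ -ᵣ x′
-ᵣ-cong x x′ p = null-cong
  (λ n → solve 2 (λ a b → :- (a :- b) := (:- a) :- (:- b)) refl (seq x n) (seq x′ n))
  (null-neg p)
  where open ℚS

*ᵣ-cong : ∀ x x′ y y′ → x ≈ᵣ x′ → y ≈ᵣ y′ → x *ᵣ y ≈ᵣ x′ *ᵣ y′
*ᵣ-cong x x′ y y′ p q = null-cong
  (λ n → solve 4 (λ a a′ b b′ → b :* (a :- a′) :+ a′ :* (b :- b′) := a :* b :- a′ :* b′) refl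
    (seq x n) (seq x′ n) (seq y n) (seq y′ n))
  (null-+ {λ n → seq y n ℚ.* (seq x n ℚ.- seq x′ n)} {λ n → seq x′ n ℚ.* (seq y n ℚ.- seq y′ n)}
    (null-*-cauchy {λ n → seq x n ℚ.- seq x′ n} {seq y} p (cauchy y))
    (null-*-cauchy {λ n → seq y n ℚ.- seq y′ n} {seq x′} q (cauchy x′)))
  where open ℚS

opaque
  unfolding _⊕_ _⊗_ ⊖_ conjugate rational sum

  ⊕-cong : ∀ {u v w z} → u ≋ v → w ≋ z → u ⊕ w ≋ v ⊕ z
  ⊕-cong {u} {v} {w} {z} (wrap (r , i)) (wrap (r′ , i′)) = wrap
    ( +ᵣ-cong (re u) (re v) (re w) (re z) r r′
    , +ᵣ-cong (im u) (im v) (im w) (im z) i i′)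

  ⊖-cong : ∀ {z w} → z ≋ w → ⊖ z ≋ ⊖ w
  ⊖-cong {z} {w} (wrap (r , i)) = wrap (-ᵣ-cong (re z) (re w) r , -ᵣ-cong (im z) (im w) i)

  conjugate-cong : ∀ {z w} → z ≋ w → conjugate z ≋ conjugate w
  conjugate-cong {z} {w} (wrap (r , i)) = wrap (r , -ᵣ-cong (im z) (im w) i)

  ⊗-cong : ∀ {u v w z} → u ≋ v → w ≋ z → u ⊗ w ≋ v ⊗ z
  ⊗-cong {u} {v} {w} {z} (wrap (r , i)) (wrap (r′ , i′)) = wrap
    ( +ᵣ-cong (re u *ᵣ re w) (re v *ᵣ re z) (-ᵣ (im u *ᵣ im w)) (-ᵣ (im v *ᵣ im z))
        (*ᵣ-cong (re u) (re v) (re w) (re z) r r′)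
        (-ᵣ-cong (im u *ᵣ im w) (im v *ᵣ im z)
          (*ᵣ-cong (im u) (im v) (im w) (im z) i i′))
    , +ᵣ-cong (re u *ᵣ im w) (re v *ᵣ im z) (im u *ᵣ re w) (im v *ᵣ re z)
        (*ᵣ-cong (re u) (re v) (im w) (im z) r i′)
        (*ᵣ-cong (im u) (im v) (re w) (re z) i r′))

  conjugate-⊗ : ∀ z w → conjugate (z ⊗ w) ≋ conjugate z ⊗ conjugate w
  conjugate-⊗ z w = pointwise
    (λ n → solve 4 (λ a b c d → a :* c :- b :* d := a :* c :- (:- b) :* (:- d)) refl
      (seq (re z) n) (seq (im z) n) (seq (re w) n) (seq (im w) n))
    (λ n → solve 4 (λ a b c d → :- (a :* d :+ b :* c) := a :* (:- d) :+ (:- b) :* c) refl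
      (seq (re z) n) (seq (im z) n) (seq (re w) n) (seq (im w) n))
    where open ℚS

  conjugate-involutive : ∀ z → conjugate (conjugate z) ≋ z
  conjugate-involutive z = pointwise (λ _ → refl) (λ n → solve 1 (λ a → :- (:- a) := a) refl (seq (im z) n))
    where open ℚS

  conjugate-⊕ : ∀ z w → conjugate (z ⊕ w) ≋ conjugate z ⊕ conjugate w
  conjugate-⊕ z w = pointwise (λ _ → refl)
    (λ n → solve 2 (λ a b → :- (a :+ b) := (:- a) :+ (:- b)) refl (seq (im z) n) (seq (im w) n))
    where open ℚS

  conjugate-rational : ∀ p → conjugate (rational p) ≋ rational p
  conjugate-rational p = pointwise (λ _ → refl) (λ _ → refl)

  rational-⊕ : ∀ p q → rational (p ℚ.+ q) ≋ rational p ⊕ rational q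
  rational-⊕ p q = pointwise (λ _ → refl) (λ _ → refl)

  sum-zero : ∀ f → sum 0 f ≋ 𝟘
  sum-zero f = ≋-refl

  sum-suc : ∀ n f → sum (suc n) f ≋ sum n f ⊕ f n
  sum-suc n f = ≋-refl

  ℂ-isCommutativeRing : IsCommutativeRing _≋_ _⊕_ _⊗_ ⊖_ 𝟘 𝟙
  ℂ-isCommutativeRing = record
    { isRing = record
      { +-isAbelianGroup = record
        { isGroup = record
          { isMonoid = record
            { isSemigroup = record
              { isMagma = record
                { isEquivalence = record { refl = ≋-refl ; sym = ≋-sym ; trans = ≋-trans }
                ; ∙-cong = ⊕-cong }
              ; assoc = λ u v w → pointwise
                  (λ n → ℚ.+-assoc (seq (re u) n) (seq (re v) n) (seq (re w) n))
                  (λ n → ℚ.+-assoc (seq (im u) n) (seq (im v) n) (seq (im w) n)) }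
            ; identity =
                (λ z → pointwise (λ n → ℚ.+-identityˡ (seq (re z) n)) (λ n → ℚ.+-identityˡ (seq (im z) n))) ,
                (λ z → pointwise (λ n → ℚ.+-identityʳ (seq (re z) n)) (λ n → ℚ.+-identityʳ (seq (im z) n))) }
          ; inverse =
              (λ z → pointwise (λ n → ℚ.+-inverseˡ (seq (re z) n)) (λ n → ℚ.+-inverseˡ (seq (im z) n))) ,
              (λ z → pointwise (λ n → ℚ.+-inverseʳ (seq (re z) n)) (λ n → ℚ.+-inverseʳ (seq (im z) n)))
          ; ⁻¹-cong = ⊖-cong }
        ; comm = λ z w → pointwise
            (λ n → ℚ.+-comm (seq (re z) n) (seq (re w) n))
            (λ n → ℚ.+-comm (seq (im z) n) (seq (im w) n)) }
      ; *-cong = ⊗-cong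
      ; *-assoc = λ u v w → pointwise
          (λ n → solve 6 (λ a b c d e f →
              (a :* c :- b :* d) :* e :- (a :* d :+ b :* c) :* f :=
              a :* (c :* e :- d :* f) :- b :* (c :* f :+ d :* e)) refl
            (seq (re u) n) (seq (im u) n) (seq (re v) n) (seq (im v) n) (seq (re w) n) (seq (im w) n))
          (λ n → solve 6 (λ a b c d e f →
              (a :* c :- b :* d) :* f :+ (a :* d :+ b :* c) :* e :=
              a :* (c :* f :+ d :* e) :+ b :* (c :* e :- d :* f)) refl
            (seq (re u) n) (seq (im u) n) (seq (re v) n) (seq (im v) n) (seq (re w) n) (seq (im w) n))
      ; *-identity = identityˡ , (λ z → ≋-trans (commutes z 𝟙) (identityˡ z))
      ; distrib = distribˡ , distribʳ }
    ; *-comm = commutes }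
    where
    open ℚS
    commutes : ∀ z w → z ⊗ w ≋ w ⊗ z
    commutes z w = pointwise
      (λ n → solve 4 (λ a b c d → a :* c :- b :* d := c :* a :- d :* b) refl
        (seq (re z) n) (seq (im z) n) (seq (re w) n) (seq (im w) n))
      (λ n → solve 4 (λ a b c d → a :* d :+ b :* c := c :* b :+ d :* a) refl
        (seq (re z) n) (seq (im z) n) (seq (re w) n) (seq (im w) n))
    identityˡ : ∀ z → 𝟙 ⊗ z ≋ z
    identityˡ z = pointwise
      (λ n → solve 2 (λ a b → con 1ℚ :* a :- con 0ℚ :* b := a) refl (seq (re z) n) (seq (im z) n))
      (λ n → solve 2 (λ a b → con 1ℚ :* b :+ con 0ℚ :* a := b) refl (seq (re z) n) (seq (im z) n))
    distribˡ : ∀ u v w → u ⊗ (v ⊕ w) ≋ u ⊗ v ⊕ u ⊗ w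
    distribˡ u v w = pointwise
      (λ n → solve 6 (λ a b c d e f →
          a :* (c :+ e) :- b :* (d :+ f) := (a :* c :- b :* d) :+ (a :* e :- b :* f)) refl
        (seq (re u) n) (seq (im u) n) (seq (re v) n) (seq (im v) n) (seq (re w) n) (seq (im w) n))
      (λ n → solve 6 (λ a b c d e f →
          a :* (d :+ f) :+ b :* (c :+ e) := (a :* d :+ b :* c) :+ (a :* f :+ b :* e)) refl
        (seq (re u) n) (seq (im u) n) (seq (re v) n) (seq (im v) n) (seq (re w) n) (seq (im w) n))
    distribʳ : ∀ u v w → (v ⊕ w) ⊗ u ≋ v ⊗ u ⊕ w ⊗ u
    distribʳ u v w = pointwise
      (λ n → solve 6 (λ a b c d e f →
          (c :+ e) :* a :- (d :+ f) :* b := (c :* a :- d :* b) :+ (e :* a :- f :* b)) refl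
        (seq (re u) n) (seq (im u) n) (seq (re v) n) (seq (im v) n) (seq (re w) n) (seq (im w) n))
      (λ n → solve 6 (λ a b c d e f →
          (c :+ e) :* b :+ (d :+ f) :* a := (c :* b :+ d :* a) :+ (e :* b :+ f :* a)) refl
        (seq (re u) n) (seq (im u) n) (seq (re v) n) (seq (im v) n) (seq (re w) n) (seq (im w) n))

ℂ-commutativeRing : CommutativeRing 0ℓ 0ℓ
ℂ-commutativeRing = record { isCommutativeRing = ℂ-isCommutativeRing }

-- This turns a contradiction with primitivity into an equation.
≋-stable : ∀ {z w} → ¬ ¬ z ≋ w → z ≋ w
≋-stable {z} {w} ¬¬z≋w = wrap
  ( null-stable (cauchy (re z +ᵣ (-ᵣ re w))) (λ ¬n → ¬¬z≋w λ p → ¬n (proj₁ (unwrap p)))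
  , null-stable (cauchy (im z +ᵣ (-ᵣ im w))) (λ ¬n → ¬¬z≋w λ p → ¬n (proj₂ (unwrap p))))

-- Finite sums

module C = CommutativeRing ℂ-commutativeRing
module CSolver = NaturalCoefficients C.commutativeSemiring
module ≋-Reasoning = SetoidReasoning C.setoid

≋-reflexive : ∀ {z w} → z ≡ w → z ≋ w
≋-reflexive refl = ≋-refl

when : ∀ {A : Set} → Dec A → ℂ → ℂ
when d z = if does d then z else 𝟘

when-yes : ∀ {A : Set} (d : Dec A) {z} → A → when d z ≋ z
when-yes (yes _) _ = ≋-refl
when-yes (no ¬a) a = contradiction a ¬a

when-no : ∀ {A : Set} (d : Dec A) {z} → ¬ A → when d z ≋ 𝟘
when-no (yes a) ¬a = contradiction a ¬a
when-no (no _)  _  = ≋-refl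

-- Taken with `d` and `e` equal, it rewrites a summand using the condition that guards it.
when-⇔ : ∀ {A B : Set} (d : Dec A) (e : Dec B) {z w} →
  (A → B) → (B → A) → (A → z ≋ w) → when d z ≋ when e w
when-⇔ (yes a) e f g z≋w = ≋-trans (z≋w a) (≋-sym (when-yes e (f a)))
when-⇔ (no ¬a) e f g z≋w = ≋-sym (when-no e (λ b → ¬a (g b)))

sum-cong : ∀ n {f g} → (∀ i → i ℕ.< n → f i ≋ g i) → sum n f ≋ sum n g
sum-cong zero {f} {g} _ = ≋-trans (sum-zero f) (≋-sym (sum-zero g))
sum-cong (suc n) {f} {g} f≋g = begin
  sum (suc n) f    ≈⟨ sum-suc n f ⟩
  sum n f ⊕ f n    ≈⟨ ⊕-cong (sum-cong n λ i i<n → f≋g i (ℕ.m<n⇒m<1+n i<n)) (f≋g n ℕ.≤-refl) ⟩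
  sum n g ⊕ g n    ≈⟨ sum-suc n g ⟨
  sum (suc n) g    ∎
  where open ≋-Reasoning

sum-𝟘 : ∀ n → sum n (λ _ → 𝟘) ≋ 𝟘
sum-𝟘 zero    = sum-zero (λ _ → 𝟘)
sum-𝟘 (suc n) = ≋-trans (sum-suc n (λ _ → 𝟘)) (≋-trans (C.+-identityʳ _) (sum-𝟘 n))

sum-⊕ : ∀ n f g → sum n (λ i → f i ⊕ g i) ≋ sum n f ⊕ sum n g
sum-⊕ zero f g = begin
  sum 0 (λ i → f i ⊕ g i)  ≈⟨ sum-zero (λ i → f i ⊕ g i) ⟩
  𝟘                        ≈⟨ C.+-identityˡ 𝟘 ⟨
  𝟘 ⊕ 𝟘                    ≈⟨ ⊕-cong (sum-zero f) (sum-zero g) ⟨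
  sum 0 f ⊕ sum 0 g        ∎
  where open ≋-Reasoning
sum-⊕ (suc n) f g = begin
  sum (suc n) (λ i → f i ⊕ g i)            ≈⟨ sum-suc n _ ⟩
  sum n (λ i → f i ⊕ g i) ⊕ (f n ⊕ g n)    ≈⟨ ⊕-cong (sum-⊕ n f g) ≋-refl ⟩
  (sum n f ⊕ sum n g) ⊕ (f n ⊕ g n)        ≈⟨ solve 4 (λ a b c d → (a :+ b) :+ (c :+ d) := (a :+ c) :+ (b :+ d)) ≋-refl (sum n f) (sum n g) (f n) (g n) ⟩
  (sum n f ⊕ f n) ⊕ (sum n g ⊕ g n)        ≈⟨ ⊕-cong (sum-suc n f) (sum-suc n g) ⟨
  sum (suc n) f ⊕ sum (suc n) g            ∎
  where open ≋-Reasoning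
        open CSolver

sum-⊗ˡ : ∀ n z f → z ⊗ sum n f ≋ sum n (λ i → z ⊗ f i)
sum-⊗ˡ zero z f = begin
  z ⊗ sum 0 f            ≈⟨ C.*-congˡ (sum-zero f) ⟩
  z ⊗ 𝟘                  ≈⟨ C.zeroʳ z ⟩
  𝟘                      ≈⟨ sum-zero (λ i → z ⊗ f i) ⟨
  sum 0 (λ i → z ⊗ f i)  ∎
  where open ≋-Reasoning
sum-⊗ˡ (suc n) z f = begin
  z ⊗ sum (suc n) f                ≈⟨ C.*-congˡ (sum-suc n f) ⟩
  z ⊗ (sum n f ⊕ f n)              ≈⟨ C.distribˡ z (sum n f) (f n) ⟩
  z ⊗ sum n f ⊕ z ⊗ f n            ≈⟨ C.+-congʳ (sum-⊗ˡ n z f) ⟩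
  sum n (λ i → z ⊗ f i) ⊕ z ⊗ f n  ≈⟨ sum-suc n (λ i → z ⊗ f i) ⟨
  sum (suc n) (λ i → z ⊗ f i)      ∎
  where open ≋-Reasoning

sum-⊗ʳ : ∀ n f z → sum n f ⊗ z ≋ sum n (λ i → f i ⊗ z)
sum-⊗ʳ n f z = begin
  sum n f ⊗ z            ≈⟨ C.*-comm (sum n f) z ⟩
  z ⊗ sum n f            ≈⟨ sum-⊗ˡ n z f ⟩
  sum n (λ i → z ⊗ f i)  ≈⟨ sum-cong n (λ i _ → C.*-comm z (f i)) ⟩
  sum n (λ i → f i ⊗ z)  ∎
  where open ≋-Reasoning

sum-swap : ∀ m n (f : ℕ → ℕ → ℂ) →
  sum m (λ i → sum n (f i)) ≋ sum n (λ j → sum m (λ i → f i j))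
sum-swap zero n f = begin
  sum 0 (λ i → sum n (f i))          ≈⟨ sum-zero _ ⟩
  𝟘                                  ≈⟨ sum-𝟘 n ⟨
  sum n (λ _ → 𝟘)                    ≈⟨ sum-cong n (λ j _ → sum-zero (λ i → f i j)) ⟨
  sum n (λ j → sum 0 (λ i → f i j))  ∎
  where open ≋-Reasoning
sum-swap (suc m) n f = begin
  sum (suc m) (λ i → sum n (f i))                 ≈⟨ sum-suc m _ ⟩
  sum m (λ i → sum n (f i)) ⊕ sum n (f m)         ≈⟨ C.+-congʳ (sum-swap m n f) ⟩
  sum n (λ j → sum m (λ i → f i j)) ⊕ sum n (f m) ≈⟨ sum-⊕ n _ (f m) ⟨
  sum n (λ j → sum m (λ i → f i j) ⊕ f m j)       ≈⟨ sum-cong n (λ j _ → sum-suc m (λ i → f i j)) ⟨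
  sum n (λ j → sum (suc m) (λ i → f i j))         ∎
  where open ≋-Reasoning

sum-split : ∀ m n f → sum (m ℕ.+ n) f ≋ sum m f ⊕ sum n (λ i → f (m ℕ.+ i))
sum-split m zero f = begin
  sum (m ℕ.+ 0) f                        ≡⟨ cong (λ t → sum t f) (ℕ.+-identityʳ m) ⟩
  sum m f                                ≈⟨ C.+-identityʳ (sum m f) ⟨
  sum m f ⊕ 𝟘                            ≈⟨ C.+-congˡ (sum-zero (λ i → f (m ℕ.+ i))) ⟨
  sum m f ⊕ sum 0 (λ i → f (m ℕ.+ i))    ∎
  where open ≋-Reasoning
sum-split m (suc n) f = begin
  sum (m ℕ.+ suc n) f                                    ≡⟨ cong (λ t → sum t f) (ℕ.+-suc m n) ⟩
  sum (suc (m ℕ.+ n)) f                                  ≈⟨ sum-suc (m ℕ.+ n) f ⟩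
  sum (m ℕ.+ n) f ⊕ f (m ℕ.+ n)                          ≈⟨ C.+-congʳ (sum-split m n f) ⟩
  (sum m f ⊕ sum n (λ i → f (m ℕ.+ i))) ⊕ f (m ℕ.+ n)    ≈⟨ C.+-assoc _ _ _ ⟩
  sum m f ⊕ (sum n (λ i → f (m ℕ.+ i)) ⊕ f (m ℕ.+ n))    ≈⟨ C.+-congˡ (sum-suc n (λ i → f (m ℕ.+ i))) ⟨
  sum m f ⊕ sum (suc n) (λ i → f (m ℕ.+ i))              ∎
  where open ≋-Reasoning

sum-blocks : ∀ m n f → sum (m ℕ.* n) f ≋ sum m (λ i → sum n (λ j → f (i ℕ.* n ℕ.+ j)))
sum-blocks zero n f = ≋-trans (sum-zero f) (≋-sym (sum-zero _))
sum-blocks (suc m) n f = begin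
  sum (n ℕ.+ m ℕ.* n) f                             ≡⟨ cong (λ t → sum t f) (ℕ.+-comm n (m ℕ.* n)) ⟩
  sum (m ℕ.* n ℕ.+ n) f                             ≈⟨ sum-split (m ℕ.* n) n f ⟩
  sum (m ℕ.* n) f ⊕ sum n (λ j → f (m ℕ.* n ℕ.+ j)) ≈⟨ C.+-congʳ (sum-blocks m n f) ⟩
  _                                                 ≈⟨ sum-suc m _ ⟨
  sum (suc m) (λ i → sum n (λ j → f (i ℕ.* n ℕ.+ j))) ∎
  where open ≋-Reasoning

conjugate-sum : ∀ n f → conjugate (sum n f) ≋ sum n (λ i → conjugate (f i))
conjugate-sum zero f = begin
  conjugate (sum 0 f)            ≈⟨ conjugate-cong (sum-zero f) ⟩
  conjugate 𝟘                    ≈⟨ conjugate-rational 0ℚ ⟩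
  𝟘                              ≈⟨ sum-zero (λ i → conjugate (f i)) ⟨
  sum 0 (λ i → conjugate (f i))  ∎
  where open ≋-Reasoning
conjugate-sum (suc n) f = begin
  conjugate (sum (suc n) f)                        ≈⟨ conjugate-cong (sum-suc n f) ⟩
  conjugate (sum n f ⊕ f n)                        ≈⟨ conjugate-⊕ (sum n f) (f n) ⟩
  conjugate (sum n f) ⊕ conjugate (f n)            ≈⟨ C.+-congʳ (conjugate-sum n f) ⟩
  sum n (λ i → conjugate (f i)) ⊕ conjugate (f n)  ≈⟨ sum-suc n (λ i → conjugate (f i)) ⟨
  sum (suc n) (λ i → conjugate (f i))              ∎
  where open ≋-Reasoning

sum-delta : ∀ n k (f : ℕ → ℂ) → k ℕ.< n → sum n (λ i → when (i ℕ.≟ k) (f i)) ≋ f k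
sum-delta (suc n) k f k<1+n with k ℕ.≟ n
... | yes refl = begin
  sum (suc n) (λ i → when (i ℕ.≟ n) (f i))              ≈⟨ sum-suc n _ ⟩
  sum n (λ i → when (i ℕ.≟ n) (f i)) ⊕ when (n ℕ.≟ n) (f n)
    ≈⟨ ⊕-cong (sum-cong n λ i i<n → when-no (i ℕ.≟ n) (ℕ.<⇒≢ i<n)) (when-yes (n ℕ.≟ n) refl) ⟩
  sum n (λ _ → 𝟘) ⊕ f n                                 ≈⟨ C.+-congʳ (sum-𝟘 n) ⟩
  𝟘 ⊕ f n                                               ≈⟨ C.+-identityˡ (f n) ⟩
  f n                                                   ∎
  where open ≋-Reasoning
... | no k≢n = begin
  sum (suc n) (λ i → when (i ℕ.≟ k) (f i))              ≈⟨ sum-suc n _ ⟩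
  sum n (λ i → when (i ℕ.≟ k) (f i)) ⊕ when (n ℕ.≟ k) (f n)
    ≈⟨ ⊕-cong (sum-delta n k f (ℕ.≤∧≢⇒< (ℕ.s≤s⁻¹ k<1+n) k≢n)) (when-no (n ℕ.≟ k) (λ n≡k → k≢n (sym n≡k))) ⟩
  f k ⊕ 𝟘                                               ≈⟨ C.+-identityʳ (f k) ⟩
  f k                                                   ∎
  where open ≋-Reasoning

-- Both sides are the double sum of g j over the pairs with j = to i,
-- equivalently i = from j.
sum-reindex : ∀ {P Q : ℕ → Set} (P? : ∀ i → Dec (P i)) (Q? : ∀ j → Dec (Q j))
  m n (to from : ℕ → ℕ) (g : ℕ → ℂ) →
  (∀ i → i ℕ.< m → P i → to i ℕ.< n × Q (to i) × from (to i) ≡ i) →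
  (∀ j → j ℕ.< n → Q j → from j ℕ.< m × P (from j) × to (from j) ≡ j) →
  sum m (λ i → when (P? i) (g (to i))) ≋ sum n (λ j → when (Q? j) (g j))
sum-reindex {P} {Q} P? Q? m n to from g to-ok from-ok = begin
  sum m (λ i → when (P? i) (g (to i)))
    ≈⟨ sum-cong m (λ i i<m → expand (P? i) n (to i) g (λ p → proj₁ (to-ok i i<m p))) ⟩
  sum m (λ i → sum n (λ j → when (P? i) (when (j ℕ.≟ to i) (g j))))
    ≈⟨ sum-cong m (λ i i<m → sum-cong n λ j j<n → match i j i<m j<n) ⟩
  sum m (λ i → sum n (λ j → when (Q? j) (when (i ℕ.≟ from j) (g j))))
    ≈⟨ sum-swap m n _ ⟩
  sum n (λ j → sum m (λ i → when (Q? j) (when (i ℕ.≟ from j) (g j))))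
    ≈⟨ sum-cong n (λ j j<n → expand (Q? j) m (from j) (λ _ → g j) (λ q → proj₁ (from-ok j j<n q))) ⟨
  sum n (λ j → when (Q? j) (g j))                           ∎
  where
  open ≋-Reasoning
  expand : ∀ {A : Set} (d : Dec A) l k (f : ℕ → ℂ) → (A → k ℕ.< l) →
    when d (f k) ≋ sum l (λ i → when d (when (i ℕ.≟ k) (f i)))
  expand (yes a) l k f k<l = ≋-sym (sum-delta l k f (k<l a))
  expand (no _)  l k f k<l = ≋-sym (sum-𝟘 l)
  match : ∀ i j → i ℕ.< m → j ℕ.< n →
    when (P? i) (when (j ℕ.≟ to i) (g j)) ≋ when (Q? j) (when (i ℕ.≟ from j) (g j))
  match i j i<m j<n with P? i | Q? j
  ... | no ¬p | no ¬q = ≋-refl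
  ... | no ¬p | yes q = ≋-sym (when-no (i ℕ.≟ from j)
    λ { refl → ¬p (proj₁ (proj₂ (from-ok j j<n q))) })
  ... | yes p | no ¬q = when-no (j ℕ.≟ to i)
    λ { refl → ¬q (proj₁ (proj₂ (to-ok i i<m p))) }
  ... | yes p | yes q = when-⇔ (j ℕ.≟ to i) (i ℕ.≟ from j)
    (λ { refl → sym (proj₂ (proj₂ (to-ok i i<m p))) })
    (λ { refl → sym (proj₂ (proj₂ (from-ok j j<n q))) })
    (λ _ → ≋-refl)

-- Congruences and periodic functions

-- The explicit quotient turns every congruence argument into a polynomial identity over ℤ for the
-- ring solver.
infix 4 _≡_mod_

record _≡_mod_ (x y : ℤ) (c : ℕ) : Set where
  constructor congruent
  field
    quotient : ℤ
    equality : x ≡ y ℤ.+ quotient ℤ.* + c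

mod-reflexive : ∀ {c x y} → x ≡ y → x ≡ y mod c
mod-reflexive {c} {x} {y} x≡y = congruent 0ℤ (trans x≡y (solve 2 (λ y c → y := y :+ con 0ℤ :* c) refl y (+ c)))
  where open ℤS

mod-sym : ∀ {c x y} → x ≡ y mod c → y ≡ x mod c
mod-sym {c} {x} {y} (congruent w eq) = congruent (ℤ.- w)
  (trans (solve 3 (λ y w c → y := (y :+ w :* c) :+ (:- w) :* c) refl y w (+ c))
    (cong (λ t → t ℤ.+ ℤ.- w ℤ.* + c) (sym eq)))
  where open ℤS

mod-trans : ∀ {c x y z} → x ≡ y mod c → y ≡ z mod c → x ≡ z mod c
mod-trans {c} {z = z} (congruent v refl) (congruent w refl) = congruent (v ℤ.+ w)
  (solve 4 (λ z v w c → (z :+ w :* c) :+ v :* c := z :+ (v :+ w) :* c) refl z v w (+ c))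
  where open ℤS

mod-+ : ∀ {c x y x′ y′} → x ≡ y mod c → x′ ≡ y′ mod c → x ℤ.+ x′ ≡ y ℤ.+ y′ mod c
mod-+ {c} {y = y} {y′ = y′} (congruent v refl) (congruent w refl) = congruent (v ℤ.+ w)
  (solve 5 (λ y y′ v w c → (y :+ v :* c) :+ (y′ :+ w :* c) := (y :+ y′) :+ (v :+ w) :* c) refl y y′ v w (+ c))
  where open ℤS

mod-* : ∀ {c x y x′ y′} → x ≡ y mod c → x′ ≡ y′ mod c → x ℤ.* x′ ≡ y ℤ.* y′ mod c
mod-* {c} {y = y} {y′ = y′} (congruent v refl) (congruent w refl) =
  congruent (v ℤ.* y′ ℤ.+ y ℤ.* w ℤ.+ v ℤ.* w ℤ.* + c)
  (solve 5 (λ y y′ v w c → (y :+ v :* c) :* (y′ :+ w :* c) := y :* y′ :+ (v :* y′ :+ y :* w :+ v :* w :* c) :* c) refl y y′ v w (+ c))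
  where open ℤS

mod-∣ : ∀ {c d x y} → d ∣ c → x ≡ y mod c → x ≡ y mod d
mod-∣ {d = d} {y = y} (divides q refl) (congruent w refl) = congruent (w ℤ.* + q)
  (cong (λ t → y ℤ.+ t) (trans (cong (w ℤ.*_) (ℤ.pos-* q d)) (sym (ℤ.*-assoc w (+ q) (+ d)))))

mod-%ℕ : ∀ x c .{{_ : NonZero c}} → + (x ℤ.%ℕ c) ≡ x mod c
mod-%ℕ x c = mod-sym (congruent (x ℤ./ℕ c) (ℤ.a≡a%ℕn+[a/ℕn]*n x c))

-- A positive quotient would force `a` to be at least `c`; a negative one becomes positive after
-- exchanging `a` and `b`.
residue-unique : ∀ {c a b} → a ℕ.< c → b ℕ.< c → + a ≡ + b mod c → a ≡ b
residue-unique {c} {a} {b} a<c b<c a≡b = go a≡b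
  where
  small : ∀ {a b} w → a ℕ.< c → + a ≡ + b ℤ.+ + w ℤ.* + c → a ≡ b
  small {a} {b} w a<c eq with ℤ.+-injective (trans eq (cong (λ t → + b ℤ.+ t) (sym (ℤ.pos-* w c))))
  small {a} {b} zero    a<c _ | a≡ = trans a≡ (ℕ.+-identityʳ b)
  small {a} {b} (suc w) a<c _ | a≡ = contradiction a<c (ℕ.≤⇒≯ (subst (c ℕ.≤_) (sym a≡)
    (ℕ.≤-trans (ℕ.m≤m+n c (w ℕ.* c)) (ℕ.m≤n+m _ b))))
  go : + a ≡ + b mod c → a ≡ b
  go (congruent (+ w) eq)            = small w a<c eq
  go a≡b@(congruent -[1+ w ] _)      = sym (small (suc w) b<c (_≡_mod_.equality (mod-sym a≡b)))

coprime-inverse : ∀ {m c} → Coprime m c → ∃[ u ] (+ m ℤ.* u ≡ 1ℤ mod c)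
coprime-inverse {m} {c} coprime with coprime-Bézout coprime
... | Bézout.+- x y eq = + x , congruent (+ y) (begin
  + m ℤ.* + x                ≡⟨ ℤ.*-comm (+ m) (+ x) ⟩
  + x ℤ.* + m                ≡⟨ ℤ.pos-* x m ⟨
  + (x ℕ.* m)                ≡⟨ cong +_ (sym eq) ⟩
  1ℤ ℤ.+ + (y ℕ.* c)         ≡⟨ cong (λ t → 1ℤ ℤ.+ t) (ℤ.pos-* y c) ⟩
  1ℤ ℤ.+ + y ℤ.* + c         ∎)
  where open ≡-Reasoning
-- Here `1 + x m = y c`, so the inverse is `- x`.
... | Bézout.-+ x y eq = ℤ.- + x , congruent (ℤ.- + y) (begin
  + m ℤ.* ℤ.- + x                          ≡⟨ solve 2 (λ m x → m :* (:- x) := con 1ℤ :+ (:- (con 1ℤ :+ x :* m))) refl (+ m) (+ x) ⟩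
  1ℤ ℤ.+ ℤ.- (1ℤ ℤ.+ + x ℤ.* + m)          ≡⟨ cong (λ t → 1ℤ ℤ.+ ℤ.- (1ℤ ℤ.+ t)) (ℤ.pos-* x m) ⟨
  1ℤ ℤ.+ ℤ.- + (1 ℕ.+ x ℕ.* m)             ≡⟨ cong (λ t → 1ℤ ℤ.+ ℤ.- + t) eq ⟩
  1ℤ ℤ.+ ℤ.- + (y ℕ.* c)                   ≡⟨ cong (λ t → 1ℤ ℤ.+ ℤ.- t) (ℤ.pos-* y c) ⟩
  1ℤ ℤ.+ ℤ.- (+ y ℤ.* + c)                 ≡⟨ cong (λ t → 1ℤ ℤ.+ t) (ℤ.neg-distribˡ-* (+ y) (+ c)) ⟩
  1ℤ ℤ.+ ℤ.- + y ℤ.* + c                   ∎)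
  where open ≡-Reasoning
        open ℤS

Periodic : ℕ → (ℤ → ℂ) → Set
Periodic c f = ∀ {x y} → x ≡ y mod c → f x ≋ f y

periodic-step : ∀ {c f} → (∀ x → f (x ℤ.+ + c) ≋ f x) → Periodic c f
periodic-step {c} {f} step {x} {y} x≡y = go x≡y
  where
  open ℤS
  up : ∀ y w → f (y ℤ.+ + w ℤ.* + c) ≋ f y
  up y zero    = ≋-reflexive (cong f (ℤ.+-identityʳ y))
  up y (suc w) = ≋-trans
    (≋-reflexive (cong f (solve 3 (λ y w c → y :+ (con 1ℤ :+ w) :* c := (y :+ w :* c) :+ c) refl y (+ w) (+ c))))
    (≋-trans (step _) (up y w))
  go : x ≡ y mod c → f x ≋ f y
  go (congruent (+ w) refl) = up y w
  go x≡y@(congruent -[1+ w ] _) =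
    ≋-sym (≋-trans (≋-reflexive (cong f (_≡_mod_.equality (mod-sym x≡y)))) (up x (suc w)))

-- The map `t ↦ m t + w` permutes the residues, with inverse `t ↦ u (t - w)` where `m u ≡ 1`. The
-- case `w = 0` serves for multiplicative substitutions and `m = 1` for translations.
sum-affine : ∀ c .{{_ : NonZero c}} {f} → Periodic c f → ∀ m w → Coprime m c →
  sum c (λ t → f (+ m ℤ.* + t ℤ.+ w)) ≋ sum c (λ t → f (+ t))
sum-affine c {f} f-periodic m w coprime with coprime-inverse coprime
... | u , mu≡1 = begin
  sum c (λ t → f (+ m ℤ.* + t ℤ.+ w))
    ≈⟨ sum-cong c (λ t _ → f-periodic (mod-sym (mod-%ℕ (+ m ℤ.* + t ℤ.+ w) c))) ⟩
  sum c (λ t → f (+ to t))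
    ≈⟨ sum-reindex (λ _ → yes tt) (λ _ → yes tt) c c to from (λ t → f (+ t))
         (λ t t<c _ → ℤ.n%ℕd<d (+ m ℤ.* + t ℤ.+ w) c , tt ,
            residue-unique (ℤ.n%ℕd<d (u ℤ.* (+ to t ℤ.+ ℤ.- w)) c) t<c (from-to t))
         (λ t t<c _ → ℤ.n%ℕd<d (u ℤ.* (+ t ℤ.+ ℤ.- w)) c , tt ,
            residue-unique (ℤ.n%ℕd<d (+ m ℤ.* + from t ℤ.+ w) c) t<c (to-from t)) ⟩
  sum c (λ t → f (+ t)) ∎
  where
  open ≋-Reasoning
  open ℤS
  to from : ℕ → ℕ
  to t   = (+ m ℤ.* + t ℤ.+ w) ℤ.%ℕ c
  from t = (u ℤ.* (+ t ℤ.+ ℤ.- w)) ℤ.%ℕ c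
  cancel : ∀ t → (+ m ℤ.* u) ℤ.* + t ≡ + t mod c
  cancel t = mod-trans (mod-* mu≡1 (mod-reflexive refl)) (mod-reflexive (ℤ.*-identityˡ (+ t)))
  from-to : ∀ t → + from (to t) ≡ + t mod c
  from-to t = mod-trans (mod-%ℕ (u ℤ.* (+ to t ℤ.+ ℤ.- w)) c)
    (mod-trans (mod-* (mod-reflexive {x = u} refl) (mod-+ (mod-%ℕ (+ m ℤ.* + t ℤ.+ w) c) (mod-reflexive {x = ℤ.- w} refl)))
    (mod-trans (mod-reflexive (solve 4 (λ m u t w → u :* (m :* t :+ w :+ (:- w)) := (m :* u) :* t) refl (+ m) u (+ t) w))
    (cancel t)))
  to-from : ∀ t → + to (from t) ≡ + t mod c
  to-from t = mod-trans (mod-%ℕ (+ m ℤ.* + from t ℤ.+ w) c)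
    (mod-trans (mod-+ (mod-* (mod-reflexive {x = + m} refl) (mod-%ℕ (u ℤ.* (+ t ℤ.+ ℤ.- w)) c)) (mod-reflexive {x = w} refl))
    (mod-trans (mod-reflexive (solve 4 (λ m u t w → m :* (u :* (t :+ (:- w))) :+ w := (m :* u) :* (t :+ (:- w)) :+ w) refl (+ m) u (+ t) w))
    (mod-trans (mod-+ (mod-* mu≡1 (mod-reflexive {x = + t ℤ.+ ℤ.- w} refl)) (mod-reflexive {x = w} refl))
    (mod-reflexive (solve 2 (λ t w → con 1ℤ :* (t :+ (:- w)) :+ w := t) refl (+ t) w)))))

-- Norms and cancellation

square-nonneg : ∀ p → 0ℚ ℚ.≤ p ℚ.* p
square-nonneg p with ℚ.≤-total 0ℚ p
... | inj₁ 0≤p = ℚ.nonNegative⁻¹ (p ℚ.* p)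
  {{ℚ.nonNeg*nonNeg⇒nonNeg p {{ℚ.nonNegative 0≤p}} p {{ℚ.nonNegative 0≤p}}}}
... | inj₂ p≤0 = ℚ.nonNegative⁻¹ (p ℚ.* p)
  {{ℚ.nonPos*nonPos⇒nonPos p {{ℚ.nonPositive p≤0}} p {{ℚ.nonPositive p≤0}}}}

≤-abs : ∀ {p q} → 0ℚ ℚ.≤ p → p ℚ.≤ q → ℚ.∣ p ∣ ℚ.≤ ℚ.∣ q ∣
≤-abs 0≤p p≤q = subst₂ ℚ._≤_ (sym (ℚ.0≤p⇒∣p∣≡p 0≤p)) (sym (ℚ.0≤p⇒∣p∣≡p (ℚ.≤-trans 0≤p p≤q))) p≤q

p≤p+q : ∀ p q → 0ℚ ℚ.≤ q → p ℚ.≤ p ℚ.+ q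
p≤p+q p q 0≤q = subst (ℚ._≤ p ℚ.+ q) (ℚ.+-identityʳ p) (ℚ.+-monoʳ-≤ p 0≤q)

p≤q+p : ∀ p q → 0ℚ ℚ.≤ q → p ℚ.≤ q ℚ.+ p
p≤q+p p q 0≤q = subst (p ℚ.≤_) (ℚ.+-comm p q) (p≤p+q p q 0≤q)

0≤p+q : ∀ {p q} → 0ℚ ℚ.≤ p → 0ℚ ℚ.≤ q → 0ℚ ℚ.≤ p ℚ.+ q
0≤p+q {p} {q} 0≤p 0≤q = ℚ.≤-trans 0≤p (p≤p+q p q 0≤q)

-- If `x` were not null, `null-domain` would cancel one factor and make it null; stability removes
-- the double negation.
null-square : ∀ {x} → Cauchy x → Null (λ n → x n ℚ.* x n) → Null x
null-square {x} cx null = null-stable {x} cx λ ¬null → ¬null (null-domain {x} {x} cx null ¬null)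

null-sum-of-squares : ∀ {x} (y : ℕ → ℚ) → Cauchy x → Null (λ n → x n ℚ.* x n ℚ.+ y n ℚ.* y n) → Null x
null-sum-of-squares {x} y cx null = null-square {x} cx (null-≤ 
  (λ n → ≤-abs (square-nonneg (x n)) (p≤p+q (x n ℚ.* x n) (y n ℚ.* y n) (square-nonneg (y n)))) null)

norm : ℂ → ℂ
norm z = z ⊗ conjugate z

opaque
  unfolding _⊕_ _⊗_ ⊖_ conjugate rational sum

  -- With z = x + iy and w = a + ib, multiplying z w − w ≋ 0 by the conjugate
  -- of w leaves (x − 1)(a² + b²) and y (a² + b²).
  ⊗-fixed : ∀ {z w} → z ⊗ w ≋ w → ¬ w ≋ 𝟘 → z ≋ 𝟙
  ⊗-fixed {z} {w} (wrap (r , i)) w≉0 = wrap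
    ( null-domain {N} {λ n → x n ℚ.- 1ℚ} (cauchy (re z +ᵣ (-ᵣ fromℚᵣ 1ℚ)))
        (null-cong (λ n → solve 4 (λ x y a b →
            a :* ((x :* a :- y :* b) :- a) :+ b :* ((x :* b :+ y :* a) :- b) :=
            (a :* a :+ b :* b) :* (x :- con 1ℚ)) refl (x n) (y n) (a n) (b n))
          (null-+ {λ n → a n ℚ.* (seq (re (z ⊗ w)) n ℚ.- a n)} {λ n → b n ℚ.* (seq (im (z ⊗ w)) n ℚ.- b n)}
            (null-*-cauchy {y = a} r (cauchy (re w)))
            (null-*-cauchy {y = b} i (cauchy (im w))))) ¬nullN
    , null-domain {N} {λ n → y n ℚ.- 0ℚ} (cauchy (im z +ᵣ (-ᵣ fromℚᵣ 0ℚ)))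
        (null-cong (λ n → solve 4 (λ x y a b →
            a :* ((x :* b :+ y :* a) :- b) :+ (:- (b :* ((x :* a :- y :* b) :- a))) :=
            (a :* a :+ b :* b) :* (y :- con 0ℚ)) refl (x n) (y n) (a n) (b n))
          (null-+ {λ n → a n ℚ.* (seq (im (z ⊗ w)) n ℚ.- b n)} {λ n → ℚ.- (b n ℚ.* (seq (re (z ⊗ w)) n ℚ.- a n))}
            (null-*-cauchy {y = a} i (cauchy (re w)))
            (null-neg {λ n → b n ℚ.* (seq (re (z ⊗ w)) n ℚ.- a n)}
              (null-*-cauchy {y = b} r (cauchy (im w)))))) ¬nullN )
    where
    open ℚS
    x y a b N : ℕ → ℚ
    x = seq (re z)
    y = seq (im z)
    a = seq (re w)
    b = seq (im w)
    N n = a n ℚ.* a n ℚ.+ b n ℚ.* b n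
    minus-0 : ∀ p → p ≡ p ℚ.- 0ℚ
    minus-0 p = solve 1 (λ p → p := p :- con 0ℚ) refl p
    ¬nullN : ¬ Null N
    ¬nullN null = w≉0 (wrap
      ( null-cong (λ n → minus-0 (a n)) (null-sum-of-squares {a} b (cauchy (re w)) null)
      , null-cong (λ n → minus-0 (b n)) (null-sum-of-squares {b} a (cauchy (im w))
          (null-cong (λ n → ℚ.+-comm (a n ℚ.* a n) (b n ℚ.* b n)) null))))

  private
    norm-nonneg : ∀ z n → 0ℚ ℚ.≤ seq (re (norm z)) n
    norm-nonneg z n = subst (0ℚ ℚ.≤_)
      (solve 2 (λ a b → a :* a :+ b :* b := a :* a :- b :* (:- b)) refl (seq (re z) n) (seq (im z) n))
      (0≤p+q {seq (re z) n ℚ.* seq (re z) n} {seq (im z) n ℚ.* seq (im z) n} (square-nonneg (seq (re z) n)) (square-nonneg (seq (im z) n)))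
      where open ℚS

    sum-norm-nonneg : ∀ m (f : ℕ → ℂ) n → 0ℚ ℚ.≤ seq (re (sum m (λ i → norm (f i)))) n
    sum-norm-nonneg zero    f n = ℚ.≤-refl
    sum-norm-nonneg (suc m) f n = 0≤p+q {seq (re (sum m (λ i → norm (f i)))) n} {seq (re (norm (f m))) n} (sum-norm-nonneg m f n) (norm-nonneg (f m) n)

    norm-≤-sum : ∀ m k (f : ℕ → ℂ) → k ℕ.< m → ∀ n →
      seq (re (norm (f k))) n ℚ.≤ seq (re (sum m (λ i → norm (f i)))) n
    norm-≤-sum (suc m) k f k<1+m n = go (ℕ.m≤n⇒m<n∨m≡n (ℕ.s≤s⁻¹ k<1+m))
      where
      go : k ℕ.< m ⊎ k ≡ m →
        seq (re (norm (f k))) n ℚ.≤ seq (re (sum (suc m) (λ i → norm (f i)))) n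
      go (inj₁ k<m)  = ℚ.≤-trans (norm-≤-sum m k f k<m n)
        (p≤p+q (seq (re (sum m (λ i → norm (f i)))) n) (seq (re (norm (f m))) n) (norm-nonneg (f m) n))
      go (inj₂ refl) = p≤q+p (seq (re (norm (f m))) n) (seq (re (sum m (λ i → norm (f i)))) n) (sum-norm-nonneg m f n)

    null-minus-0 : ∀ {x} → Null (λ n → x n ℚ.- 0ℚ) → Null x
    null-minus-0 {x} = null-cong (λ n → solve 1 (λ p → p :- con 0ℚ := p) refl (x n))
      where open ℚS

  𝟙≉𝟘 : ¬ 𝟙 ≋ 𝟘
  𝟙≉𝟘 (wrap (r , _)) with r 1ℚ (ℚ.positive⁻¹ 1ℚ)
  ... | N , small = ℚ.<-irrefl refl (small N ℕ.≤-refl)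

  -- Representatives of norms have nonnegative real part at every index, so a single norm is
  -- dominated termwise by the sum; its imaginary part is 0 term by term.
  sum-norm-zero : ∀ m k (f : ℕ → ℂ) → k ℕ.< m → sum m (λ i → norm (f i)) ≋ 𝟘 → norm (f k) ≋ 𝟘
  sum-norm-zero m k f k<m (wrap (r , _)) = wrap
    ( null-cong (λ n → solve 1 (λ p → p := p :- con 0ℚ) refl (seq (re (norm (f k))) n))
        (null-≤ (λ n → ≤-abs (norm-nonneg (f k) n) (norm-≤-sum m k f k<m n)) (null-minus-0 r))
    , null-cong (λ n → solve 2 (λ a b → con 0ℚ := (a :* (:- b) :+ b :* a) :- con 0ℚ) refl
        (seq (re (f k)) n) (seq (im (f k)) n)) null-0 )
    where open ℚS

norm-cong : ∀ {z w} → z ≋ w → norm z ≋ norm w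
norm-cong z≋w = ⊗-cong z≋w (conjugate-cong z≋w)

norm-⊗ : ∀ z w → norm (z ⊗ w) ≋ norm z ⊗ norm w
norm-⊗ z w = ≋-trans (C.*-congˡ (conjugate-⊗ z w))
  (solve 4 (λ a b c d → (a :* b) :* (c :* d) := (a :* c) :* (b :* d)) ≋-refl
    z w (conjugate z) (conjugate w))
  where open CSolver

norm-𝟙 : norm 𝟙 ≋ 𝟙
norm-𝟙 = ≋-trans (C.*-identityˡ _) (conjugate-rational 1ℚ)

-- Coprimality

coprime-mod : ∀ {c x y} → x ≡ y mod c → Coprime ℤ.∣ x ∣ c → Coprime ℤ.∣ y ∣ c
coprime-mod {c} {x} {y} (congruent w refl) coprime {e} (e∣y , e∣c) = coprime (∣⇒∣ᵤ {+ e} {x}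
  (ℤ∣.∣m∣n⇒∣m+n (∣ᵤ⇒∣ {+ e} {y} e∣y) (ℤ∣.∣n⇒∣m*n w (∣ᵤ⇒∣ {+ e} {+ c} e∣c))) , e∣c)

coprime-* : ∀ {a b c} → Coprime a c → Coprime b c → Coprime (a ℕ.* b) c
coprime-* {a} {b} ac bc {e} (e∣ab , e∣c) = bc
  (coprime-divisor {m = e} {n = a} (λ (f∣e , f∣a) → ac (f∣a , ℕ∣.∣-trans f∣e e∣c)) e∣ab , e∣c)

coprime-*ˡ : ∀ {a c} b → Coprime (a ℕ.* b) c → Coprime a c
coprime-*ˡ b abc (e∣a , e∣c) = abc (ℕ∣.∣m⇒∣m*n b e∣a , e∣c)

coprime-*ʳ : ∀ {b c} a → Coprime (a ℕ.* b) c → Coprime b c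
coprime-*ʳ a abc (e∣b , e∣c) = abc (ℕ∣.∣n⇒∣m*n a e∣b , e∣c)

coprime-∣ : ∀ {a c d} → d ∣ c → Coprime a c → Coprime a d
coprime-∣ d∣c ac (e∣a , e∣d) = ac (e∣a , ℕ∣.∣-trans e∣d d∣c)

coprime-abs-* : ∀ {c} x y → Coprime ℤ.∣ x ∣ c → Coprime ℤ.∣ y ∣ c → Coprime ℤ.∣ x ℤ.* y ∣ c
coprime-abs-* {c} x y xc yc = subst (λ t → Coprime t c) (sym (ℤ.abs-* x y)) (coprime-* xc yc)

coprime-inverseℤ : ∀ {c} .{{_ : NonZero c}} x → Coprime ℤ.∣ x ∣ c →
  ∃[ u ] (x ℤ.* u ≡ 1ℤ mod c × Coprime ℤ.∣ u ∣ c)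
coprime-inverseℤ {c} x xc with coprime-inverse {x ℤ.%ℕ c} (coprime-mod (mod-sym (mod-%ℕ x c)) xc)
... | u , ru≡1 = u , xu≡1 , coprime-*ʳ ℤ.∣ x ∣
  (subst (λ t → Coprime t c) (ℤ.abs-* x u) (coprime-mod (mod-sym xu≡1) (Coprime.1-coprimeTo c)))
  where
  xu≡1 : x ℤ.* u ≡ 1ℤ mod c
  xu≡1 = mod-trans (mod-* (mod-sym (mod-%ℕ x c)) (mod-reflexive {x = u} refl)) ru≡1

prime-divisor : ∀ n .{{_ : NonZero n}} → n ≢ 1 → ∃[ p ] (Prime p × p ∣ n)
prime-divisor n n≢1 with factorise n
... | record { factors = [] ; isFactorisation = n≡1 } = contradiction n≡1 n≢1
... | record { factors = p ∷ ps ; isFactorisation = n≡pps ; factorsPrime = p-prime ∷ _ } =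
  p , p-prime , subst (p ∣_) (sym n≡pps) (ℕ∣.m∣m*n _)

common-prime-divisor : ∀ m n .{{_ : NonZero n}} → ¬ Coprime m n → ∃[ p ] (Prime p × p ∣ m × p ∣ n)
common-prime-divisor m n ¬mn with prime-divisor (gcd m n)
  {{ℕ.≢-nonZero (gcd[m,n]≢0 m n (inj₂ (ℕ.≢-nonZero⁻¹ n)))}} (λ g≡1 → ¬mn (Coprime.gcd≡1⇒coprime g≡1))
... | p , p-prime , p∣g = p , p-prime , ℕ∣.∣-trans p∣g (gcd[m,n]∣m m n) , ℕ∣.∣-trans p∣g (gcd[m,n]∣n m n)

coprime-prime-∣ : ∀ {a d p} → Prime p → Coprime a d → ¬ Coprime a (d ℕ.* p) → p ∣ a
coprime-prime-∣ {a} {d} {p} p-prime ad ¬adp with p ∣? a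
... | yes p∣a = p∣a
... | no p∤a = ⊥-elim (¬adp (Coprime.sym {d ℕ.* p} {a} (coprime-* {d} {p} (Coprime.sym ad) pa)))
  where
  pa : Coprime p a
  pa (e∣p , e∣a) with prime⇒irreducible p-prime e∣p
  ... | inj₁ e≡1  = e≡1
  ... | inj₂ refl = contradiction e∣a p∤a

-- Dirichlet characters

opaque
  unfolding _⊗_ rational

  character-one : ∀ {q} (χ : DirichletCharacter q) → χ ⟨ 1ℤ ⟩ ≋ 𝟙
  character-one χ = wrap (DirichletCharacter.one χ)

  character-⊗ : ∀ {q} (χ : DirichletCharacter q) x y → χ ⟨ x ℤ.* y ⟩ ≋ χ ⟨ x ⟩ ⊗ χ ⟨ y ⟩
  character-⊗ χ x y = wrap (DirichletCharacter.mult χ x y)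

  character-zero : ∀ {q} (χ : DirichletCharacter q) x → ¬ Coprime ℤ.∣ x ∣ q → χ ⟨ x ⟩ ≋ 𝟘
  character-zero χ x ¬xq = wrap (DirichletCharacter.zeros χ x ¬xq)

  mkCharacter : ∀ {q} (f : ℤ → ℂ) → f 1ℤ ≋ 𝟙 → (∀ x y → f (x ℤ.* y) ≋ f x ⊗ f y) →
    Periodic q f → (∀ x → ¬ Coprime ℤ.∣ x ∣ q → f x ≋ 𝟘) → DirichletCharacter q
  mkCharacter f f-one f-mult f-periodic f-zero = record
    { _⟨_⟩     = f
    ; one      = unwrap f-one
    ; mult     = λ x y → unwrap (f-mult x y)
    ; periodic = λ x → unwrap (f-periodic (congruent 1ℤ (cong (λ t → x ℤ.+ t) (sym (ℤ.*-identityˡ _)))))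
    ; zeros    = λ x ¬xq → unwrap (f-zero x ¬xq)
    }

  mkCharacter-value : ∀ {q} (f : ℤ → ℂ) o m (p : Periodic q f) z x → mkCharacter f o m p z ⟨ x ⟩ ≡ f x
  mkCharacter-value f o m p z x = refl

character-periodic : ∀ {q} (χ : DirichletCharacter q) → Periodic q (χ ⟨_⟩)
character-periodic χ = periodic-step (λ x → wrap (DirichletCharacter.periodic χ x))

conjugate-character-⊗ : ∀ {q} (χ : DirichletCharacter q) x y →
  conjugate (χ ⟨ x ℤ.* y ⟩) ≋ conjugate (χ ⟨ x ⟩) ⊗ conjugate (χ ⟨ y ⟩)
conjugate-character-⊗ χ x y = ≋-trans (conjugate-cong (character-⊗ χ x y)) (conjugate-⊗ _ _)

-- Multiplication by m permutes the residues, so norm (χ m) fixes the positive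
-- number Σ norm (χ n).
character-norm : ∀ {q} .{{_ : NonZero q}} → 1 ℕ.< q → (χ : DirichletCharacter q) →
  ∀ m → Coprime m q → norm (χ ⟨ + m ⟩) ≋ 𝟙
character-norm {q} 1<q χ m mq = ⊗-fixed fixed positive
  where
  open ≋-Reasoning
  T = sum q (λ n → norm (χ ⟨ + n ⟩))
  positive : ¬ T ≋ 𝟘
  positive T≋𝟘 = 𝟙≉𝟘 (begin
    𝟙                   ≈⟨ norm-𝟙 ⟨
    norm 𝟙              ≈⟨ norm-cong (character-one χ) ⟨
    -- `1 < q` places the index 1 in the range of `T`.
    norm (χ ⟨ 1ℤ ⟩)     ≈⟨ sum-norm-zero q 1 (λ n → χ ⟨ + n ⟩) 1<q T≋𝟘 ⟩
    𝟘                   ∎)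
  fixed : norm (χ ⟨ + m ⟩) ⊗ T ≋ T
  fixed = begin
    norm (χ ⟨ + m ⟩) ⊗ T
      ≈⟨ sum-⊗ˡ q (norm (χ ⟨ + m ⟩)) (λ n → norm (χ ⟨ + n ⟩)) ⟩
    sum q (λ n → norm (χ ⟨ + m ⟩) ⊗ norm (χ ⟨ + n ⟩))
      ≈⟨ sum-cong q (λ n _ → ≋-trans (≋-sym (norm-⊗ (χ ⟨ + m ⟩) (χ ⟨ + n ⟩)))
           (norm-cong (≋-trans (≋-sym (character-⊗ χ (+ m) (+ n)))
             (≋-reflexive (cong (χ ⟨_⟩) (sym (ℤ.+-identityʳ (+ m ℤ.* + n)))))))) ⟩
    sum q (λ n → norm (χ ⟨ + m ℤ.* + n ℤ.+ 0ℤ ⟩))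
      ≈⟨ sum-affine q {λ x → norm (χ ⟨ x ⟩)} (λ x≡y → norm-cong (character-periodic χ x≡y)) m 0ℤ mq ⟩
    T ∎

-- Descent of a character from modulus `d p` to modulus `d`

module Descent {d p : ℕ} .{{_ : NonZero (d ℕ.* p)}} (p-prime : Prime p) (χ : DirichletCharacter (d ℕ.* p))
  (kernel : ∀ m → + m ≡ 1ℤ mod d → Coprime m (d ℕ.* p) → χ ⟨ + m ⟩ ≋ 𝟙) where

  private
    q = d ℕ.* p

    d∣q : d ∣ q
    d∣q = ℕ∣.m∣m*n p

  kernelℤ : ∀ x → x ≡ 1ℤ mod d → Coprime ℤ.∣ x ∣ q → χ ⟨ x ⟩ ≋ 𝟙
  kernelℤ x x≡1 xq = ≋-trans (character-periodic χ (mod-sym (mod-%ℕ x q)))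
    (kernel (x ℤ.%ℕ q) (mod-trans (mod-∣ d∣q (mod-%ℕ x q)) x≡1) (coprime-mod (mod-sym (mod-%ℕ x q)) xq))

  -- With `u` inverse to `y` modulo `q`, the product `x u` is a unit congruent to 1 modulo `d`,
  -- hence in the kernel of `χ`. The chain inserts `χ(y u) = 1` and removes `χ(x u) = 1`.
  lifts-agree : ∀ {x y} → x ≡ y mod d → Coprime ℤ.∣ x ∣ q → Coprime ℤ.∣ y ∣ q → χ ⟨ x ⟩ ≋ χ ⟨ y ⟩
  lifts-agree {x} {y} x≡y xq yq = begin
    χ ⟨ x ⟩                        ≈⟨ C.*-identityʳ _ ⟨
    χ ⟨ x ⟩ ⊗ 𝟙                    ≈⟨ C.*-congˡ (≋-trans (character-periodic χ yu≡1) (character-one χ)) ⟨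
    χ ⟨ x ⟩ ⊗ χ ⟨ y ℤ.* u ⟩        ≈⟨ C.*-congˡ (character-⊗ χ y u) ⟩
    χ ⟨ x ⟩ ⊗ (χ ⟨ y ⟩ ⊗ χ ⟨ u ⟩)  ≈⟨ solve 3 (λ a b c → a :* (b :* c) := b :* (a :* c)) ≋-refl (χ ⟨ x ⟩) (χ ⟨ y ⟩) (χ ⟨ u ⟩) ⟩
    χ ⟨ y ⟩ ⊗ (χ ⟨ x ⟩ ⊗ χ ⟨ u ⟩)  ≈⟨ C.*-congˡ (character-⊗ χ x u) ⟨
    χ ⟨ y ⟩ ⊗ χ ⟨ x ℤ.* u ⟩        ≈⟨ C.*-congˡ (kernelℤ (x ℤ.* u)
                                        (mod-trans (mod-* x≡y (mod-reflexive {x = u} refl)) (mod-∣ d∣q yu≡1))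
                                        (coprime-abs-* x u xq uq)) ⟩
    χ ⟨ y ⟩ ⊗ 𝟙                    ≈⟨ C.*-identityʳ _ ⟩
    χ ⟨ y ⟩                        ∎
    where
    open ≋-Reasoning
    open CSolver
    inverse = coprime-inverseℤ y yq
    u : ℤ
    u = proj₁ inverse
    yu≡1 : y ℤ.* u ≡ 1ℤ mod q
    yu≡1 = proj₁ (proj₂ inverse)
    uq : Coprime ℤ.∣ u ∣ q
    uq = proj₂ (proj₂ inverse)

  -- One of `x` and `x + d` is a unit modulo `d p`. Otherwise the prime `p` divides both, hence
  -- divides `d` as well as `x`, although these are coprime.
  lift : ∀ x → Coprime ℤ.∣ x ∣ d → ∃[ x′ ] (x′ ≡ x mod d × Coprime ℤ.∣ x′ ∣ q)
  lift x xd = first (coprime? ℤ.∣ x ∣ q)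
    where
    x+d≡x : x ℤ.+ + d ≡ x mod d
    x+d≡x = congruent 1ℤ (cong (λ t → x ℤ.+ t) (sym (ℤ.*-identityˡ (+ d))))
    both-fail : ¬ Coprime ℤ.∣ x ∣ q → ¬ ¬ Coprime ℤ.∣ x ℤ.+ + d ∣ q
    both-fail ¬xq ¬x+dq = ¬prime[1] (subst Prime (xd (p∣x , p∣d)) p-prime)
      where
      p∣x : p ∣ ℤ.∣ x ∣
      p∣x = coprime-prime-∣ p-prime xd ¬xq
      p∣x+d : p ∣ ℤ.∣ x ℤ.+ + d ∣
      p∣x+d = coprime-prime-∣ p-prime (coprime-mod (mod-sym x+d≡x) xd) ¬x+dq
      p∣d : p ∣ d
      p∣d = ∣⇒∣ᵤ {+ p} {+ d} (ℤ∣.∣m+n∣m⇒∣n {m = x} (∣ᵤ⇒∣ {+ p} {x ℤ.+ + d} p∣x+d) (∣ᵤ⇒∣ {+ p} {x} p∣x))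
    second : ¬ Coprime ℤ.∣ x ∣ q → Dec (Coprime ℤ.∣ x ℤ.+ + d ∣ q) →
      ∃[ x′ ] (x′ ≡ x mod d × Coprime ℤ.∣ x′ ∣ q)
    second ¬xq (yes x+dq) = x ℤ.+ + d , x+d≡x , x+dq
    second ¬xq (no ¬x+dq) = ⊥-elim (both-fail ¬xq ¬x+dq)
    first : Dec (Coprime ℤ.∣ x ∣ q) → ∃[ x′ ] (x′ ≡ x mod d × Coprime ℤ.∣ x′ ∣ q)
    first (yes xq) = x , mod-reflexive refl , xq
    first (no ¬xq) = second ¬xq (coprime? ℤ.∣ x ℤ.+ + d ∣ q)

  -- The decision is an argument so that the character laws can be proved for arbitrary decisions by
  -- matching on them; `induced` then fixes `coprime?`.
  value : ∀ x → Dec (Coprime ℤ.∣ x ∣ d) → ℂ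
  value x (yes xd) = χ ⟨ proj₁ (lift x xd) ⟩
  value x (no _)   = 𝟘

  -- Independence of the chosen lift. Multiplicativity, periodicity and agreement with `χ` all come
  -- from choosing a convenient `y`.
  value-lift : ∀ x {y} (xd? : Dec (Coprime ℤ.∣ x ∣ d)) → y ≡ x mod d → Coprime ℤ.∣ y ∣ q →
    value x xd? ≋ χ ⟨ y ⟩
  value-lift x (yes xd) y≡x yq = let (_ , x′≡x , x′q) = lift x xd in
    lifts-agree (mod-trans x′≡x (mod-sym y≡x)) x′q yq
  value-lift x (no ¬xd) y≡x yq = ⊥-elim (¬xd (coprime-mod y≡x (coprime-∣ d∣q yq)))

  value-zero : ∀ x (xd? : Dec (Coprime ℤ.∣ x ∣ d)) → ¬ Coprime ℤ.∣ x ∣ d → value x xd? ≋ 𝟘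
  value-zero x (yes xd) ¬xd = ⊥-elim (¬xd xd)
  value-zero x (no _)   _   = ≋-refl

  value-cong : ∀ x y (xd? : Dec (Coprime ℤ.∣ x ∣ d)) (yd? : Dec (Coprime ℤ.∣ y ∣ d)) → x ≡ y mod d →
    value x xd? ≋ value y yd?
  value-cong x y (yes xd) yd? x≡y = let (_ , x′≡x , x′q) = lift x xd in
    ≋-sym (value-lift y yd? (mod-trans x′≡x x≡y) x′q)
  value-cong x y (no ¬xd) yd? x≡y = ≋-sym (value-zero y yd? (λ yd → ¬xd (coprime-mod (mod-sym x≡y) yd)))

  value-⊗ : ∀ x y xd? yd? xyd? → value (x ℤ.* y) xyd? ≋ value x xd? ⊗ value y yd?
  value-⊗ x y (yes xd) (yes yd) xyd? =
    let (x′ , x′≡x , x′q) = lift x xd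
        (y′ , y′≡y , y′q) = lift y yd
    in ≋-trans (value-lift (x ℤ.* y) xyd? (mod-* x′≡x y′≡y) (coprime-abs-* x′ y′ x′q y′q)) (character-⊗ χ x′ y′)
  value-⊗ x y (no ¬xd) yd? xyd? = ≋-trans
    (value-zero (x ℤ.* y) xyd? (λ xyd → ¬xd (coprime-*ˡ ℤ.∣ y ∣ (subst (λ t → Coprime t d) (ℤ.abs-* x y) xyd))))
    (≋-sym (C.zeroˡ _))
  value-⊗ x y (yes xd) (no ¬yd) xyd? = ≋-trans
    (value-zero (x ℤ.* y) xyd? (λ xyd → ¬yd (coprime-*ʳ ℤ.∣ x ∣ (subst (λ t → Coprime t d) (ℤ.abs-* x y) xyd))))
    (≋-sym (C.zeroʳ _))

  induced : ∃[ χ′ ] InducedBy {d ℕ.* p} {d} χ χ′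
  induced = χ′ , λ x xq → unwrap (≋-trans
      (≋-sym (value-lift x (d? x) (mod-reflexive refl) xq))
      (≋-reflexive (sym (mkCharacter-value f one′ mult′ periodic′ zero′ x))))
    where
    d? : ∀ x → Dec (Coprime ℤ.∣ x ∣ d)
    d? x = coprime? ℤ.∣ x ∣ d
    f : ℤ → ℂ
    f x = value x (d? x)
    one′ : f 1ℤ ≋ 𝟙
    one′ = ≋-trans (value-lift 1ℤ (d? 1ℤ) (mod-reflexive refl) (Coprime.1-coprimeTo q)) (character-one χ)
    mult′ : ∀ x y → f (x ℤ.* y) ≋ f x ⊗ f y
    mult′ x y = value-⊗ x y (d? x) (d? y) (d? (x ℤ.* y))
    periodic′ : Periodic d f
    periodic′ {x} {y} x≡y = value-cong x y (d? x) (d? y) x≡y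
    zero′ : ∀ x → ¬ Coprime ℤ.∣ x ∣ d → f x ≋ 𝟘
    zero′ x = value-zero x (d? x)
    χ′ : DirichletCharacter d
    χ′ = mkCharacter f one′ mult′ periodic′ zero′

-- Sums twisted by a primitive character

module Separation {q : ℕ} .{{_ : NonZero q}} (1<q : 1 ℕ.< q) (χ : DirichletCharacter q)
  (χ-primitive : Primitive χ) {f : ℤ → ℂ} (f-periodic : Periodic q f) where

  open ≋-Reasoning

  private
    χ̄ : ℤ → ℂ
    χ̄ x = conjugate (χ ⟨ x ⟩)

    χ̄-periodic : Periodic q χ̄
    χ̄-periodic x≡y = conjugate-cong (character-periodic χ x≡y)

  -- Summing over m n instead of n multiplies the sum by χ̄ m.
  twist : ∀ {g : ℤ → ℂ} → Periodic q g → ∀ m → Coprime m q →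
    sum q (λ n → χ̄ (+ n) ⊗ g (+ n)) ≋ χ̄ (+ m) ⊗ sum q (λ n → χ̄ (+ n) ⊗ g (+ m ℤ.* + n))
  twist {g} g-periodic m mq = begin
    sum q (λ n → χ̄ (+ n) ⊗ g (+ n))
      ≈⟨ sum-affine q {λ x → χ̄ x ⊗ g x} (λ x≡y → ⊗-cong (χ̄-periodic x≡y) (g-periodic x≡y)) m 0ℤ mq ⟨
    sum q (λ n → χ̄ (+ m ℤ.* + n ℤ.+ 0ℤ) ⊗ g (+ m ℤ.* + n ℤ.+ 0ℤ))
      ≈⟨ sum-cong q (λ n _ → ≋-trans
           (≋-reflexive (cong (λ x → χ̄ x ⊗ g x) (ℤ.+-identityʳ (+ m ℤ.* + n))))
           (≋-trans (C.*-congʳ (conjugate-character-⊗ χ (+ m) (+ n))) (C.*-assoc _ _ _))) ⟩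
    sum q (λ n → χ̄ (+ m) ⊗ (χ̄ (+ n) ⊗ g (+ m ℤ.* + n)))
      ≈⟨ sum-⊗ˡ q (χ̄ (+ m)) _ ⟨
    χ̄ (+ m) ⊗ sum q (λ n → χ̄ (+ n) ⊗ g (+ m ℤ.* + n)) ∎

  -- Write `q = d p`. A unit `r ≡ 1` modulo `d` satisfies `m r ≡ m` modulo `q`, because `p` divides
  -- `m`; substituting `r n` for `n` then gives `G = χ̄(r) G`. Were `G` nonzero, every such `χ(r)`
  -- would be 1 and `χ` would be induced from `d < q`.
  vanishing : ∀ {p m} → Prime p → p ∣ q → p ∣ m → sum q (λ n → χ̄ (+ n) ⊗ f (+ m ℤ.* + n)) ≋ 𝟘
  vanishing {p} p-prime (divides d refl) (divides e refl) = ≋-stable λ G≉𝟘 →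
    χ-primitive d (ℕ∣.m∣m*n p) d<q (Descent.induced p-prime χ (kernel G≉𝟘))
    where
    m = e ℕ.* p
    G = sum q (λ n → χ̄ (+ n) ⊗ f (+ m ℤ.* + n))
    instance
      d≢0 : NonZero d
      d≢0 = ℕ.m*n≢0⇒m≢0 d
    d<q : d ℕ.< q
    d<q = ℕ.m<m*n d p (ℕ.nonTrivial⇒n>1 p {{prime⇒nonTrivial p-prime}})
    -- With `r = 1 + w d` the error is `m w d x = (e w x)(d p)`, a multiple of `q`.
    absorb : ∀ {r} → + r ≡ 1ℤ mod d → ∀ x → + m ℤ.* (+ r ℤ.* x) ≡ + m ℤ.* x mod q
    absorb {r} (congruent w eq) x = congruent (+ e ℤ.* w ℤ.* x) (Eq.begin
      + m ℤ.* (+ r ℤ.* x)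
        Eq.≡⟨ cong (λ t → + m ℤ.* (t ℤ.* x)) eq ⟩
      + m ℤ.* ((1ℤ ℤ.+ w ℤ.* + d) ℤ.* x)
        Eq.≡⟨ solve 4 (λ m x w d → m :* ((con 1ℤ :+ w :* d) :* x) := m :* x :+ m :* (w :* d :* x)) refl (+ m) x w (+ d) ⟩
      + m ℤ.* x ℤ.+ + m ℤ.* (w ℤ.* + d ℤ.* x)
        Eq.≡⟨ cong (λ t → + m ℤ.* x ℤ.+ t ℤ.* (w ℤ.* + d ℤ.* x)) (ℤ.pos-* e p) ⟩
      + m ℤ.* x ℤ.+ (+ e ℤ.* + p) ℤ.* (w ℤ.* + d ℤ.* x)
        Eq.≡⟨ cong (λ t → + m ℤ.* x ℤ.+ t) (solve 5 (λ e p w d x → (e :* p) :* (w :* d :* x) := (e :* w :* x) :* (d :* p)) refl (+ e) (+ p) w (+ d) x) ⟩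
      + m ℤ.* x ℤ.+ (+ e ℤ.* w ℤ.* x) ℤ.* (+ d ℤ.* + p)
        Eq.≡⟨ cong (λ t → + m ℤ.* x ℤ.+ (+ e ℤ.* w ℤ.* x) ℤ.* t) (ℤ.pos-* d p) ⟨
      + m ℤ.* x ℤ.+ (+ e ℤ.* w ℤ.* x) ℤ.* + q Eq.∎)
      where module Eq = ≡-Reasoning
            open ℤS
    kernel : ¬ G ≋ 𝟘 → ∀ r → + r ≡ 1ℤ mod d → Coprime r q → χ ⟨ + r ⟩ ≋ 𝟙
    kernel G≉𝟘 r r≡1 rq = begin
      χ ⟨ + r ⟩              ≈⟨ conjugate-involutive _ ⟨
      conjugate (χ̄ (+ r))    ≈⟨ conjugate-cong (⊗-fixed (≋-sym fixed) G≉𝟘) ⟩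
      conjugate 𝟙            ≈⟨ conjugate-rational 1ℚ ⟩
      𝟙                      ∎
      where
      fixed : G ≋ χ̄ (+ r) ⊗ G
      fixed = ≋-trans
        (twist {λ x → f (+ m ℤ.* x)} (λ x≡y → f-periodic (mod-* (mod-reflexive {x = + m} refl) x≡y)) r rq)
        (C.*-congˡ (sum-cong q λ n _ → C.*-congˡ (f-periodic (absorb r≡1 (+ n)))))

  -- For a unit `m`, `twist` produces `χ̄(m)` on the opposite side, and `χ(m) χ̄(m) = 1` moves it
  -- across as `χ(m)`. A non-unit shares a prime with `q`, and `vanishing` applies.
  separation : ∀ m →
    sum q (λ n → χ̄ (+ n) ⊗ f (+ m ℤ.* + n)) ≋ χ ⟨ + m ⟩ ⊗ sum q (λ n → χ̄ (+ n) ⊗ f (+ n))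
  separation m with coprime? m q
  ... | yes mq = begin
    sum q (λ n → χ̄ (+ n) ⊗ f (+ m ℤ.* + n))                    ≈⟨ C.*-identityˡ _ ⟨
    𝟙 ⊗ sum q (λ n → χ̄ (+ n) ⊗ f (+ m ℤ.* + n))                ≈⟨ C.*-congʳ (character-norm 1<q χ m mq) ⟨
    norm (χ ⟨ + m ⟩) ⊗ sum q (λ n → χ̄ (+ n) ⊗ f (+ m ℤ.* + n)) ≈⟨ C.*-assoc _ _ _ ⟩
    χ ⟨ + m ⟩ ⊗ (χ̄ (+ m) ⊗ sum q (λ n → χ̄ (+ n) ⊗ f (+ m ℤ.* + n))) ≈⟨ C.*-congˡ (twist f-periodic m mq) ⟨
    χ ⟨ + m ⟩ ⊗ sum q (λ n → χ̄ (+ n) ⊗ f (+ n))                ∎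
  ... | no ¬mq with common-prime-divisor m q ¬mq
  ...   | p , p-prime , p∣m , p∣q = begin
    sum q (λ n → χ̄ (+ n) ⊗ f (+ m ℤ.* + n))       ≈⟨ vanishing p-prime p∣q p∣m ⟩
    𝟘                                             ≈⟨ C.zeroˡ _ ⟨
    𝟘 ⊗ sum q (λ n → χ̄ (+ n) ⊗ f (+ n))           ≈⟨ C.*-congʳ (character-zero χ (+ m) ¬mq) ⟨
    χ ⟨ + m ⟩ ⊗ sum q (λ n → χ̄ (+ n) ⊗ f (+ n))   ∎

-- The first Bernoulli function

/-cross : ∀ x y M N .{{M≢0 : NonZero M}} .{{N≢0 : NonZero N}} → x ℤ.* + N ≡ y ℤ.* + M → x / M ≡ y / N
/-cross x y (suc M) (suc N) eq = ℚ.fromℚᵘ-cong {ℚᵘ.mkℚᵘ x M} {ℚᵘ.mkℚᵘ y N} (ℚᵘ.*≡* eq)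

/-+ : ∀ x y M N .{{_ : NonZero M}} .{{_ : NonZero N}} .{{MN≢0 : NonZero (M ℕ.* N)}} →
  x / M ℚ.+ y / N ≡ (x ℤ.* + N ℤ.+ y ℤ.* + M) / (M ℕ.* N)
/-+ x y (suc M) (suc N) = ℚ.toℚᵘ-injective (begin
  ℚ.toℚᵘ (ℚ.fromℚᵘ p ℚ.+ ℚ.fromℚᵘ q)                    ≈⟨ ℚ.toℚᵘ-homo-+ (ℚ.fromℚᵘ p) (ℚ.fromℚᵘ q) ⟩
  ℚ.toℚᵘ (ℚ.fromℚᵘ p) ℚᵘ.+ ℚ.toℚᵘ (ℚ.fromℚᵘ q)          ≈⟨ ℚᵘ.+-cong (ℚ.toℚᵘ-fromℚᵘ p) (ℚ.toℚᵘ-fromℚᵘ q) ⟩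
  p ℚᵘ.+ q                                              ≈⟨ ℚ.toℚᵘ-fromℚᵘ (p ℚᵘ.+ q) ⟨
  ℚ.toℚᵘ (ℚ.fromℚᵘ (p ℚᵘ.+ q))                          ∎)
  where
  open ℚᵘ.≃-Reasoning
  p = ℚᵘ.mkℚᵘ x M
  q = ℚᵘ.mkℚᵘ y N

/-* : ∀ x y M N .{{_ : NonZero M}} .{{_ : NonZero N}} .{{MN≢0 : NonZero (M ℕ.* N)}} →
  (x / M) ℚ.* (y / N) ≡ (x ℤ.* y) / (M ℕ.* N)
/-* x y (suc M) (suc N) = ℚ.toℚᵘ-injective (begin
  ℚ.toℚᵘ (ℚ.fromℚᵘ p ℚ.* ℚ.fromℚᵘ q)                    ≈⟨ ℚ.toℚᵘ-homo-* (ℚ.fromℚᵘ p) (ℚ.fromℚᵘ q) ⟩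
  ℚ.toℚᵘ (ℚ.fromℚᵘ p) ℚᵘ.* ℚ.toℚᵘ (ℚ.fromℚᵘ q)          ≈⟨ ℚᵘ.*-cong (ℚ.toℚᵘ-fromℚᵘ p) (ℚ.toℚᵘ-fromℚᵘ q) ⟩
  p ℚᵘ.* q                                              ≈⟨ ℚ.toℚᵘ-fromℚᵘ (p ℚᵘ.* q) ⟨
  ℚ.toℚᵘ (ℚ.fromℚᵘ (p ℚᵘ.* q))                          ∎)
  where
  open ℚᵘ.≃-Reasoning
  p = ℚᵘ.mkℚᵘ x M
  q = ℚᵘ.mkℚᵘ y N

divMod-unique : ∀ {z r w} N .{{_ : NonZero N}} → z ≡ + r ℤ.+ w ℤ.* + N → r ℕ.< N →
  z ℤ.%ℕ N ≡ r × z ℤ./ℕ N ≡ w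
divMod-unique {z} {r} {w} N eq r<N = r≡ , ℤ.*-cancelʳ-≡ (z ℤ./ℕ N) w (+ N) (GroupProperties.∙-cancelˡ (AbelianGroup.group ℤ.+-0-abelianGroup) (+ r) _ _ (begin
  + r ℤ.+ z ℤ./ℕ N ℤ.* + N          ≡⟨ cong (λ t → + t ℤ.+ z ℤ./ℕ N ℤ.* + N) r≡ ⟨
  + (z ℤ.%ℕ N) ℤ.+ z ℤ./ℕ N ℤ.* + N ≡⟨ ℤ.a≡a%ℕn+[a/ℕn]*n z N ⟨
  z                                 ≡⟨ eq ⟩
  + r ℤ.+ w ℤ.* + N                 ∎))
  where
  open ≡-Reasoning
  r≡ : z ℤ.%ℕ N ≡ r
  r≡ = residue-unique (ℤ.n%ℕd<d z N) r<N (mod-trans (mod-%ℕ z N) (congruent w eq))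

-- `ℚ.floor` divides the reduced numerator `a` by the reduced denominator `b`. Multiplying
-- `a = r + f b` by the cancelled gcd `g` gives a division of `z` by `N` with the same quotient and
-- remainder `r g < N`.
floor-/ : ∀ z N .{{_ : NonZero N}} → ℚ.floor (z / N) ≡ z ℤ./ℕ N
floor-/ z N = trans (floor-def p) (sym (proj₂ (divMod-unique N z≡ gr<N)))
  where
  open ≡-Reasoning
  p = z / N
  a = ℚ.↥ p
  b = ℚ.↧ₙ p
  g = ℤ.∣ ℤ.gcd z (+ N) ∣
  r = a ℤ.%ℕ b
  f = a ℤ./ℕ b
  floor-def : ∀ p → ℚ.floor p ≡ ℚ.↥ p ℤ./ℕ ℚ.↧ₙ p
  floor-def p@record{} = ℤ.div-pos-is-/ℕ (ℚ.↥ p) (ℚ.↧ₙ p)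
  N≡ : b ℕ.* g ≡ N
  N≡ = ℤ.+-injective (trans (ℤ.pos-* b g) (ℚ.↧-/ z N))
  z≡ : z ≡ + (r ℕ.* g) ℤ.+ f ℤ.* + N
  z≡ = begin
    z                                   ≡⟨ ℚ.↥-/ z N ⟨
    a ℤ.* + g                           ≡⟨ cong (ℤ._* + g) (ℤ.a≡a%ℕn+[a/ℕn]*n a b) ⟩
    (+ r ℤ.+ f ℤ.* + b) ℤ.* + g         ≡⟨ solve 4 (λ r f b g → (r :+ f :* b) :* g := r :* g :+ f :* (b :* g)) refl (+ r) f (+ b) (+ g) ⟩
    + r ℤ.* + g ℤ.+ f ℤ.* (+ b ℤ.* + g) ≡⟨ cong₂ (λ s t → s ℤ.+ f ℤ.* t) (sym (ℤ.pos-* r g)) (trans (sym (ℤ.pos-* b g)) (cong +_ N≡)) ⟩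
    + (r ℕ.* g) ℤ.+ f ℤ.* + N           ∎
    where open ℤS
  gr<N : r ℕ.* g ℕ.< N
  gr<N = subst (r ℕ.* g ℕ.<_) N≡ (ℕ.*-monoˡ-< g {{g≢0}} (ℤ.n%ℕd<d a b))
    where
    g≢0 : NonZero g
    g≢0 = ℕ.m*n≢0⇒n≢0 b {{subst NonZero (sym N≡) (ℕ.>-nonZero (ℕ.>-nonZero⁻¹ N))}}

-- Corrects x − ⌊x⌋ − ½ at the integers, in terms of the residue r of N x.
jump : ℕ → ℚ
jump zero    = ½
jump (suc _) = 0ℚ

saw : (N : ℕ) .{{_ : NonZero N}} → ℕ → ℚ
saw N r = + r / N ℚ.- ½ ℚ.+ jump r

-- The test in `B₁` succeeds exactly for residue 0, where the `½` of `jump` cancels the `- ½`.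
B₁-/ : ∀ z N .{{_ : NonZero N}} → B₁ (z / N) ≡ saw N (z ℤ.%ℕ N)
B₁-/ z N = trans
  (cong (λ m → if does (z / N ℚ.≟ m / 1) then 0ℚ else z / N ℚ.- m / 1 ℚ.- ½) (floor-/ z N))
  (value (z / N ℚ.≟ F))
  where
  open ≡-Reasoning
  open ℚS
  F = z ℤ./ℕ N / 1
  split : z / N ≡ + (z ℤ.%ℕ N) / N ℚ.+ F
  split = begin
    z / N
      ≡⟨ /-cross z (+ (z ℤ.%ℕ N) ℤ.* 1ℤ ℤ.+ z ℤ./ℕ N ℤ.* + N) N (N ℕ.* 1) {{N≢0 = N1≢0}} (trans (cong (z ℤ.*_) (ℤ.pos-* N 1))
           (trans (cong (ℤ._* (+ N ℤ.* 1ℤ)) (ℤ.a≡a%ℕn+[a/ℕn]*n z N))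
             (Z.solve 3 (λ r f n → (r Z.:+ f Z.:* n) Z.:* (n Z.:* Z.con 1ℤ) Z.:= (r Z.:* Z.con 1ℤ Z.:+ f Z.:* n) Z.:* n) refl
               (+ (z ℤ.%ℕ N)) (z ℤ./ℕ N) (+ N)))) ⟩
    _ ≡⟨ /-+ (+ (z ℤ.%ℕ N)) (z ℤ./ℕ N) N 1 {{MN≢0 = N1≢0}} ⟨
    + (z ℤ.%ℕ N) / N ℚ.+ F ∎
    where
    module Z = ℤS
    N1≢0 : NonZero (N ℕ.* 1)
    N1≢0 = ℕ.m*n≢0 N 1
  value : ∀ d → (if does {A = z / N ≡ F} d then 0ℚ else z / N ℚ.- F ℚ.- ½) ≡ saw N (z ℤ.%ℕ N)
  value (yes z/N≡F) = zero-case (z ℤ.%ℕ N) (begin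
    + (z ℤ.%ℕ N) / N                  ≡⟨ solve 2 (λ r f → r := (r :+ f) :- f) refl (+ (z ℤ.%ℕ N) / N) F ⟩
    (+ (z ℤ.%ℕ N) / N ℚ.+ F) ℚ.- F    ≡⟨ cong (ℚ._- F) (trans (sym split) z/N≡F) ⟩
    F ℚ.- F                           ≡⟨ ℚ.+-inverseʳ F ⟩
    0ℚ                                ∎)
    where
    zero-case : ∀ r → + r / N ≡ 0ℚ → 0ℚ ≡ saw N r
    zero-case zero eq rewrite eq = refl
    zero-case (suc r) eq = contradiction (ℚ.positive⁻¹ _ {{ℚ.normalize-pos (suc r) N}}) (ℚ.<-irrefl (sym eq))
  value (no z/N≢F) = nonzero-case (z ℤ.%ℕ N) refl
    where
    nonzero-case : ∀ r → r ≡ z ℤ.%ℕ N → z / N ℚ.- F ℚ.- ½ ≡ saw N r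
    nonzero-case zero 0≡ = contradiction (trans split (trans (cong (λ r → + r / N ℚ.+ F) (sym 0≡))
      (trans (cong (ℚ._+ F) (ℚ.0/n≡0 N)) (ℚ.+-identityˡ F)))) z/N≢F
    nonzero-case (suc r) r≡ = trans (cong (λ t → t ℚ.- F ℚ.- ½) (trans split (cong (λ r → + r / N ℚ.+ F) (sym r≡))))
      (solve 2 (λ r f → r :+ f :- f :- con ½ := r :- con ½ :+ con 0ℚ) refl (+ suc r / N) F)

-- The value B₁ (z / N), made total in N with the junk value 0 at N = 0.
β : ℕ → ℤ → ℚ
β zero    z = 0ℚ
β (suc N) z = B₁ (z / suc N)

β-/ : ∀ z N .{{_ : NonZero N}} → B₁ (z / N) ≡ β N z
β-/ z (suc N) = refl

β-saw : ∀ N .{{_ : NonZero N}} z → β N z ≡ saw N (z ℤ.%ℕ N)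
β-saw N@(suc _) z = B₁-/ z N

β-scale : ∀ g N .{{_ : NonZero g}} z → β (g ℕ.* N) (+ g ℤ.* z) ≡ β N z
β-scale g zero      z = cong (λ t → β t (+ g ℤ.* z)) (ℕ.*-zeroʳ g)
β-scale g N@(suc _) z = trans (sym (β-/ (+ g ℤ.* z) (g ℕ.* N) {{ℕ.m*n≢0 g N}}))
  (cong B₁ (/-cross (+ g ℤ.* z) z (g ℕ.* N) N {{ℕ.m*n≢0 g N}} (trans
    (solve 3 (λ g z n → (g :* z) :* n := z :* (g :* n)) refl (+ g) z (+ N))
    (cong (z ℤ.*_) (sym (ℤ.pos-* g N))))))
  where open ℤS

β-periodic : ∀ N {x y} → x ≡ y mod N → β N x ≡ β N y
β-periodic zero      x≡y = refl
β-periodic N@(suc _) {x} {y} x≡y = trans (β-saw N x) (trans (cong (saw N)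
  (residue-unique (ℤ.n%ℕd<d x N) (ℤ.n%ℕd<d y N)
    (mod-trans (mod-%ℕ x N) (mod-trans x≡y (mod-sym (mod-%ℕ y N))))))
  (sym (β-saw N y)))

module _ (c N : ℕ) .{{_ : NonZero c}} .{{_ : NonZero N}} where

  private instance
    cN≢0 : NonZero (c ℕ.* N)
    cN≢0 = ℕ.m*n≢0 c N

  -- An arithmetic progression with `suc m` terms; the number of terms is kept apart from `c` so
  -- that induction leaves the denominator fixed. A jump can occur only at `t = 0`, since `r + t N`
  -- is positive afterwards.
  saw-sum : ∀ r m → sum (suc m) (λ t → rational (saw (c ℕ.* N) (r ℕ.+ t ℕ.* N))) ≋
    rational (+ suc m / 1 ℚ.* (+ r / (c ℕ.* N))
      ℚ.+ (+ suc m / 1 ℚ.* (+ suc m / 1) ℚ.- + suc m / 1) ℚ.* (+ N / (c ℕ.* N)) ℚ.* ½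
      ℚ.- + suc m / 1 ℚ.* ½ ℚ.+ jump r)
  saw-sum r zero = begin
    sum 1 f                ≈⟨ sum-suc 0 f ⟩
    sum 0 f ⊕ f 0          ≈⟨ C.+-congʳ (sum-zero f) ⟩
    𝟘 ⊕ f 0                ≈⟨ C.+-identityˡ (f 0) ⟩
    f 0                    ≡⟨ cong (λ t → rational (saw (c ℕ.* N) t)) (ℕ.+-identityʳ r) ⟩
    rational (saw (c ℕ.* N) r) ≡⟨ cong rational (solve 3 (λ x s j → x :- con ½ :+ j :=
        con 1ℚ :* x :+ (con 1ℚ :* con 1ℚ :- con 1ℚ) :* s :* con ½ :- con 1ℚ :* con ½ :+ j) refl
        (+ r / (c ℕ.* N)) (+ N / (c ℕ.* N)) (jump r)) ⟩
    _                      ∎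
    where
    open ≋-Reasoning
    open ℚS
    f = λ t → rational (saw (c ℕ.* N) (r ℕ.+ t ℕ.* N))
  saw-sum r (suc m) = begin
    sum (suc (suc m)) f                  ≈⟨ sum-suc (suc m) f ⟩
    sum (suc m) f ⊕ f (suc m)            ≈⟨ ⊕-cong (saw-sum r m) (≋-reflexive (cong rational saw-value)) ⟩
    rational P ⊕ rational Q              ≈⟨ rational-⊕ P Q ⟨
    rational (P ℚ.+ Q)                   ≡⟨ cong rational (trans (solve 4 (λ M x s j →
        (M :* x :+ (M :* M :- M) :* s :* con ½ :- M :* con ½ :+ j) :+ (x :+ M :* s :- con ½) :=
        (con 1ℚ :+ M) :* x :+ ((con 1ℚ :+ M) :* (con 1ℚ :+ M) :- (con 1ℚ :+ M)) :* s :* con ½ :- (con 1ℚ :+ M) :* con ½ :+ j) refl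
        M x s (jump r))
        (cong (λ L → L ℚ.* x ℚ.+ (L ℚ.* L ℚ.- L) ℚ.* s ℚ.* ½ ℚ.- L ℚ.* ½ ℚ.+ jump r) next)) ⟩
    _                                    ∎
    where
    open ≋-Reasoning
    open ℚS
    f = λ t → rational (saw (c ℕ.* N) (r ℕ.+ t ℕ.* N))
    M = + suc m / 1
    x = + r / (c ℕ.* N)
    s = + N / (c ℕ.* N)
    P = M ℚ.* x ℚ.+ (M ℚ.* M ℚ.- M) ℚ.* s ℚ.* ½ ℚ.- M ℚ.* ½ ℚ.+ jump r
    Q = x ℚ.+ M ℚ.* s ℚ.- ½
    next : 1ℚ ℚ.+ M ≡ + suc (suc m) / 1
    next = trans (/-+ 1ℤ (+ suc m) 1 1) (cong (_/ 1) (trans (cong (λ t → 1ℤ ℤ.+ t) (ℤ.*-identityʳ (+ suc m))) refl))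
    Ms : M ℚ.* s ≡ + (suc m ℕ.* N) / (c ℕ.* N)
    Ms = trans (/-* (+ suc m) (+ N) 1 (c ℕ.* N) {{MN≢0 = ℕ.m*n≢0 1 (c ℕ.* N)}})
      (/-cross (+ suc m ℤ.* + N) (+ (suc m ℕ.* N)) (1 ℕ.* (c ℕ.* N)) (c ℕ.* N) {{ℕ.m*n≢0 1 (c ℕ.* N)}} (cong₂ ℤ._*_ (sym (ℤ.pos-* (suc m) N))
        (cong +_ (sym (ℕ.*-identityˡ (c ℕ.* N))))))
    same-denominator : ∀ a b → + a / (c ℕ.* N) ℚ.+ + b / (c ℕ.* N) ≡ + (a ℕ.+ b) / (c ℕ.* N)
    same-denominator a b = trans (/-+ (+ a) (+ b) D D {{MN≢0 = DD≢0}})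
      (/-cross (+ a ℤ.* + D ℤ.+ + b ℤ.* + D) (+ (a ℕ.+ b)) (D ℕ.* D) D {{DD≢0}} (trans
        (Z.solve 3 (λ a b d → (a Z.:* d Z.:+ b Z.:* d) Z.:* d Z.:= (a Z.:+ b) Z.:* (d Z.:* d)) refl (+ a) (+ b) (+ D))
        (cong₂ ℤ._*_ (sym (ℤ.pos-+ a b)) (sym (ℤ.pos-* D D)))))
      where
      module Z = ℤS
      D = c ℕ.* N
      DD≢0 : NonZero (D ℕ.* D)
      DD≢0 = ℕ.m*n≢0 D D
    jump-positive : ∀ r n .{{_ : NonZero n}} → jump (r ℕ.+ n) ≡ 0ℚ
    jump-positive r (suc n) rewrite ℕ.+-suc r n = refl
    saw-value : saw (c ℕ.* N) (r ℕ.+ suc m ℕ.* N) ≡ Q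
    saw-value = trans (cong₂ (λ u v → u ℚ.- ½ ℚ.+ v)
        (trans (sym (same-denominator r (suc m ℕ.* N))) (cong (x ℚ.+_) (sym Ms)))
        (jump-positive r (suc m ℕ.* N) {{ℕ.m*n≢0 (suc m) N}}))
      (ℚ.+-identityʳ Q)

  -- At `M = c` the closed form has `M x = r / N` and `M s = 1`, so its quadratic part is
  -- `(M - 1)/2`, which together with `- M/2` leaves `- ½`.
  saw-distribution : ∀ r → sum c (λ t → rational (saw (c ℕ.* N) (r ℕ.+ t ℕ.* N))) ≋ rational (saw N r)
  saw-distribution r = go c refl
    where
    open ℚS
    go : ∀ m → m ≡ c → sum m (λ t → rational (saw (c ℕ.* N) (r ℕ.+ t ℕ.* N))) ≋ rational (saw N r)
    go zero    refl = contradiction refl (ℕ.≢-nonZero⁻¹ c)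
    go (suc m) m≡c = ≋-trans (saw-sum r m) (≋-reflexive (cong rational (trans
      (solve 4 (λ M x s j → M :* x :+ (M :* M :- M) :* s :* con ½ :- M :* con ½ :+ j :=
        M :* x :+ ((M :* s) :* M :- M :* s) :* con ½ :- M :* con ½ :+ j) refl (+ suc m / 1) x s (jump r))
      (trans (cong₂ (λ a b → a ℚ.+ (b ℚ.* (+ suc m / 1) ℚ.- b) ℚ.* ½ ℚ.- (+ suc m / 1) ℚ.* ½ ℚ.+ jump r) Mx Ms)
      (solve 3 (λ y M j → y :+ (con 1ℚ :* M :- con 1ℚ) :* con ½ :- M :* con ½ :+ j := y :- con ½ :+ j) refl (+ r / N) (+ suc m / 1) (jump r))))))
      where
      x = + r / (c ℕ.* N)
      s = + N / (c ℕ.* N)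
      cancel : ∀ z .{{_ : NonZero (1 ℕ.* (c ℕ.* N))}} → (+ suc m ℤ.* z) / (1 ℕ.* (c ℕ.* N)) ≡ z / N
      cancel z = /-cross (+ suc m ℤ.* z) z (1 ℕ.* (c ℕ.* N)) N (trans
        (cong (λ t → (+ t ℤ.* z) ℤ.* + N) m≡c)
        (trans (Z.solve 3 (λ c z n → (c Z.:* z) Z.:* n Z.:= z Z.:* (c Z.:* n)) refl (+ c) z (+ N))
        (cong (z ℤ.*_) (trans (sym (ℤ.pos-* c N)) (cong +_ (sym (ℕ.*-identityˡ (c ℕ.* N))))))))
        where module Z = ℤS
      Mx : + suc m / 1 ℚ.* x ≡ + r / N
      Mx = trans (/-* (+ suc m) (+ r) 1 (c ℕ.* N) {{MN≢0 = ℕ.m*n≢0 1 (c ℕ.* N)}}) (cancel (+ r) {{ℕ.m*n≢0 1 (c ℕ.* N)}})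
      Ms : + suc m / 1 ℚ.* s ≡ 1ℚ
      Ms = trans (/-* (+ suc m) (+ N) 1 (c ℕ.* N) {{MN≢0 = ℕ.m*n≢0 1 (c ℕ.* N)}})
        (trans (cancel (+ N) {{ℕ.m*n≢0 1 (c ℕ.* N)}}) (/-cross (+ N) 1ℤ N 1 (ℤ.*-comm (+ N) 1ℤ)))

  -- Writing `z = r + w N`, the translation by `w` only permutes `t` modulo `c`. The remaining
  -- numbers `r + t N` are below `c N`, hence are their own residues.
  β-distribution : ∀ z → sum c (λ t → rational (β (c ℕ.* N) (z ℤ.+ + t ℤ.* + N))) ≋ rational (β N z)
  β-distribution z = begin
    sum c (λ t → rational (β (c ℕ.* N) (z ℤ.+ + t ℤ.* + N)))
      ≈⟨ sum-cong c (λ t _ → ≋-reflexive (cong (λ x → rational (β (c ℕ.* N) x)) (shift t))) ⟩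
    sum c (λ t → f (1ℤ ℤ.* + t ℤ.+ w))
      ≈⟨ sum-affine c {f} f-periodic 1 w (Coprime.1-coprimeTo c) ⟩
    sum c (λ t → f (+ t))
      ≈⟨ sum-cong c (λ t t<c → ≋-reflexive (cong rational (trans (β-saw (c ℕ.* N) _) (cong (saw (c ℕ.* N)) (residue t t<c))))) ⟩
    sum c (λ t → rational (saw (c ℕ.* N) (r ℕ.+ t ℕ.* N)))
      ≈⟨ saw-distribution r ⟩
    rational (saw N r)
      ≡⟨ cong rational (β-saw N z) ⟨
    rational (β N z) ∎
    where
    open ≋-Reasoning
    open ℤS
    r = z ℤ.%ℕ N
    w = z ℤ./ℕ N
    f : ℤ → ℂ
    f x = rational (β (c ℕ.* N) (+ r ℤ.+ x ℤ.* + N))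
    shift : ∀ t → z ℤ.+ + t ℤ.* + N ≡ + r ℤ.+ (1ℤ ℤ.* + t ℤ.+ w) ℤ.* + N
    shift t = trans (cong (λ x → x ℤ.+ + t ℤ.* + N) (ℤ.a≡a%ℕn+[a/ℕn]*n z N))
      (solve 4 (λ r w t n → (r :+ w :* n) :+ t :* n := r :+ (con 1ℤ :* t :+ w) :* n) refl (+ r) w (+ t) (+ N))
    f-periodic : Periodic c f
    f-periodic {y = y} (congruent v refl) = ≋-reflexive (cong rational (β-periodic (c ℕ.* N) (congruent v (trans
      (solve 5 (λ r y v c n → r :+ (y :+ v :* c) :* n := (r :+ y :* n) :+ v :* (c :* n)) refl (+ r) y v (+ c) (+ N))
      (cong (λ t → (+ r ℤ.+ y ℤ.* + N) ℤ.+ v ℤ.* t) (sym (ℤ.pos-* c N)))))))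
    residue : ∀ t → t ℕ.< c → (+ r ℤ.+ + t ℤ.* + N) ℤ.%ℕ (c ℕ.* N) ≡ r ℕ.+ t ℕ.* N
    residue t t<c = proj₁ (divMod-unique {w = 0ℤ} (c ℕ.* N)
      (trans (cong (λ x → + r ℤ.+ x) (sym (ℤ.pos-* t N))) (trans (sym (ℤ.pos-+ r (t ℕ.* N))) (sym (ℤ.+-identityʳ _))))
      (ℕ.<-≤-trans (ℕ.+-monoˡ-< (t ℕ.* N) (ℤ.n%ℕd<d z N)) (ℕ.*-monoˡ-≤ N t<c)))

-- The Hecke relation

-- The value m ÷ 0 = 0 is junk.
infixl 7 _÷_

_÷_ : ℕ → ℕ → ℕ
m ÷ zero  = 0
m ÷ suc g = m ℕ./ suc g

*-÷ : ∀ g m .{{_ : NonZero g}} → g ℕ.* m ÷ g ≡ m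
*-÷ g@(suc _) m = trans (cong (ℕ._/ g) (ℕ.*-comm g m)) (ℕ.m*n/n≡m m g)

∣-÷ : ∀ {g m} .{{_ : NonZero g}} → g ∣ m → m ≡ g ℕ.* (m ÷ g)
∣-÷ {g} (divides q refl) = trans (ℕ.*-comm q g) (cong (g ℕ.*_) (sym (trans (cong (_÷ g) (ℕ.*-comm q g)) (*-÷ g q))))

gcd-split : ∀ m n .{{_ : NonZero n}} → ∃[ m′ ] ∃[ n′ ]
  (m ≡ gcd m n ℕ.* m′ × n ≡ gcd m n ℕ.* n′ × gcd m′ n′ ≡ 1 × NonZero (gcd m n))
gcd-split m n = m′ , n′ , m≡ , n≡ , ℕ.*-cancelˡ-≡ (gcd m′ n′) 1 g (begin
    g ℕ.* gcd m′ n′              ≡⟨ c*gcd[m,n]≡gcd[cm,cn] g m′ n′ ⟩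
    gcd (g ℕ.* m′) (g ℕ.* n′)    ≡⟨ cong₂ gcd (sym m≡) (sym n≡) ⟩
    g                            ≡⟨ ℕ.*-identityʳ g ⟨
    g ℕ.* 1                      ∎) , g≢0
  where
  open ≡-Reasoning
  g = gcd m n
  instance
    g≢0 : NonZero g
    g≢0 = ℕ.≢-nonZero (gcd[m,n]≢0 m n (inj₂ (ℕ.≢-nonZero⁻¹ n)))
  m′ = m ÷ g
  n′ = n ÷ g
  m≡ : m ≡ g ℕ.* m′
  m≡ = ∣-÷ (gcd[m,n]∣m m n)
  n≡ : n ≡ g ℕ.* n′
  n≡ = ∣-÷ (gcd[m,n]∣n m n)

-- The involution a ↦ gcd (m , n) / a on the common divisors of m and n.
codivisor : ℕ → ℕ → ℕ → ℕ
codivisor m n a = gcd (m ÷ a) (n ÷ a)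

-- Write `m = a g m₂` and `n = a g n₂` with `m₂`, `n₂` coprime; removing `g` leaves
-- `gcd (a m₂) (a n₂) = a`. The case `m = 0` is included, as the index `i = 0` occurs in the sums.
codivisor-spec : ∀ {m n a} .{{_ : NonZero n}} .{{_ : NonZero a}} → a ∣ n → a ∣ m →
  NonZero (codivisor m n a) × codivisor m n a ∣ n × codivisor m n a ∣ m ×
  codivisor m n (codivisor m n a) ≡ a
codivisor-spec {m} {n} {a} a∣n a∣m = g≢0 , ℕ∣.∣-trans (gcd[m,n]∣n m₁ n₁) (divides a n≡) ,
  ℕ∣.∣-trans (gcd[m,n]∣m m₁ n₁) (divides a m≡) , (begin
    gcd (m ÷ g) (n ÷ g)              ≡⟨ cong₂ gcd (quotient m≡ m₁≡) (quotient n≡ n₁≡) ⟩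
    gcd (a ℕ.* m₂) (a ℕ.* n₂)        ≡⟨ c*gcd[m,n]≡gcd[cm,cn] a m₂ n₂ ⟨
    a ℕ.* gcd m₂ n₂                  ≡⟨ cong (a ℕ.*_) (proj₁ (proj₂ (proj₂ (proj₂ (proj₂ split))))) ⟩
    a ℕ.* 1                          ≡⟨ ℕ.*-identityʳ a ⟩
    a                                ∎)
  where
  open ≡-Reasoning
  m₁ = m ÷ a
  n₁ = n ÷ a
  m≡ : m ≡ a ℕ.* m₁
  m≡ = ∣-÷ a∣m
  n≡ : n ≡ a ℕ.* n₁
  n≡ = ∣-÷ a∣n
  instance
    n₁≢0 : NonZero n₁
    n₁≢0 = ℕ.m*n≢0⇒n≢0 a {{subst NonZero n≡ (ℕ.>-nonZero (ℕ.>-nonZero⁻¹ n))}}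
  split = gcd-split m₁ n₁
  g = gcd m₁ n₁
  m₂ = proj₁ split
  n₂ = proj₁ (proj₂ split)
  m₁≡ : m₁ ≡ g ℕ.* m₂
  m₁≡ = proj₁ (proj₂ (proj₂ split))
  n₁≡ : n₁ ≡ g ℕ.* n₂
  n₁≡ = proj₁ (proj₂ (proj₂ (proj₂ split)))
  instance
    g≢0 : NonZero g
    g≢0 = proj₂ (proj₂ (proj₂ (proj₂ (proj₂ split))))
  quotient : ∀ {x x₁ x₂} → x ≡ a ℕ.* x₁ → x₁ ≡ g ℕ.* x₂ → x ÷ g ≡ a ℕ.* x₂
  quotient {x₂ = x₂} refl refl = trans (cong (_÷ g) (begin
    a ℕ.* (g ℕ.* x₂)   ≡⟨ ℕ.*-assoc a g x₂ ⟨
    a ℕ.* g ℕ.* x₂     ≡⟨ cong (ℕ._* x₂) (ℕ.*-comm a g) ⟩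
    g ℕ.* a ℕ.* x₂     ≡⟨ ℕ.*-assoc g a x₂ ⟩
    g ℕ.* (a ℕ.* x₂)   ∎)) (*-÷ g (a ℕ.* x₂))

sum-multiples : ∀ a M (f : ℕ → ℂ) .{{_ : NonZero a}} →
  sum M (λ j → f (a ℕ.* j)) ≋ sum (a ℕ.* M) (λ i → when (a ∣? i) (f i))
sum-multiples a M f = sum-reindex (λ _ → yes tt) (a ∣?_) M (a ℕ.* M) (a ℕ.*_) (_÷ a) f
  (λ j j<M _ → ℕ.*-monoʳ-< a j<M , ℕ∣.m∣m*n j , *-÷ a j)
  (λ i i<aM a∣i → ℕ.*-cancelˡ-< a (i ÷ a) M (subst (ℕ._< a ℕ.* M) (∣-÷ a∣i) i<aM) , tt , sym (∣-÷ a∣i))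

sum-const : ∀ n z → sum n (λ _ → z) ≋ rational (+ n / 1) ⊗ z
sum-const zero z = begin
  sum 0 (λ _ → z)  ≈⟨ sum-zero (λ _ → z) ⟩
  𝟘                ≈⟨ C.zeroˡ z ⟨
  𝟘 ⊗ z            ∎
  where open ≋-Reasoning
sum-const (suc n) z = begin
  sum (suc n) (λ _ → z)                ≈⟨ sum-suc n (λ _ → z) ⟩
  sum n (λ _ → z) ⊕ z                  ≈⟨ C.+-congʳ (sum-const n z) ⟩
  rational (+ n / 1) ⊗ z ⊕ z           ≈⟨ solve 2 (λ r z → r :* z :+ z := (con 1 :+ r) :* z) ≋-refl (rational (+ n / 1)) z ⟩
  (𝟙 ⊕ rational (+ n / 1)) ⊗ z         ≈⟨ C.*-congʳ (rational-⊕ 1ℚ (+ n / 1)) ⟨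
  rational (1ℚ ℚ.+ + n / 1) ⊗ z        ≡⟨ cong (λ t → rational t ⊗ z) (trans (/-+ 1ℤ (+ n) 1 1)
                                            (cong (λ t → (1ℤ ℤ.+ t) / 1) (ℤ.*-identityʳ (+ n)))) ⟩
  rational (+ suc n / 1) ⊗ z           ∎
  where open ≋-Reasoning
        open CSolver

-- The defined sums in terms of the opaque operations

opaque
  unfolding _⊗_ conjugate rational sum

  -- Instantiating an abstract P keeps the conversion checker from unfolding
  -- products of complex numbers.
  transfer : (P : (ℂ → ℂ → ℂ) → (ℂ → ℂ) → (ℚ → ℂ) → (ℕ → (ℕ → ℂ) → ℂ) → Set) →
    P _*_ conj fromℚ ∑ → P _⊗_ conjugate rational sum
  transfer P p = p

dedekindSum-def : ∀ {q₁ q₂} .{{_ : NonZero q₁}} (χ₁ : DirichletCharacter q₁) (χ₂ : DirichletCharacter q₂) h k .{{_ : NonZero k}} →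
  dedekindSum χ₁ χ₂ h k ≡ sum k (λ j → sum q₁ (λ n →
    conjugate (χ₂ ⟨ + j ⟩) ⊗ conjugate (χ₁ ⟨ + n ⟩) ⊗ rational (B₁ (+ j / k))
      ⊗ rational (B₁ (+ n / q₁ ℚ.+ (h ℤ.* + j) / k))))
dedekindSum-def {q₁} χ₁ χ₂ h k = transfer P refl
  where
  P : (ℂ → ℂ → ℂ) → (ℂ → ℂ) → (ℚ → ℂ) → (ℕ → (ℕ → ℂ) → ℂ) → Set
  P _·_ bar emb Σ = dedekindSum χ₁ χ₂ h k ≡ Σ k (λ j → Σ q₁ (λ n →
    ((bar (χ₂ ⟨ + j ⟩) · bar (χ₁ ⟨ + n ⟩)) · emb (B₁ (+ j / k))) · emb (B₁ (+ n / q₁ ℚ.+ (h ℤ.* + j) / k))))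

ψ-def : ∀ {q₁ q₂} (χ₁ : DirichletCharacter q₁) (χ₂ : DirichletCharacter q₂) a →
  ψ χ₁ χ₂ a ≡ χ₁ ⟨ a ⟩ ⊗ conjugate (χ₂ ⟨ a ⟩)
ψ-def χ₁ χ₂ a = transfer (λ _·_ bar _ _ → ψ χ₁ χ₂ a ≡ (χ₁ ⟨ a ⟩) · bar (χ₂ ⟨ a ⟩)) refl

ρ-def : ∀ {q₁ q₂} (χ₁ : DirichletCharacter q₁) (χ₂ : DirichletCharacter q₂) n →
  ρ χ₁ χ₂ n ≡ sum n (λ g → when (suc g ∣? n)
    (χ₁ ⟨ + (n ℕ./ suc g) ⟩ ⊗ conjugate (χ₂ ⟨ + suc g ⟩) ⊗ rational (+ suc g / 1)))
ρ-def χ₁ χ₂ n = transfer (λ _·_ bar emb Σ → ρ χ₁ χ₂ n ≡ Σ n (λ g → if does (suc g ∣? n)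
  then ((χ₁ ⟨ + (n ℕ./ suc g) ⟩) · bar (χ₂ ⟨ + suc g ⟩)) · emb (+ suc g / 1) else emb 0ℚ)) refl

-- Evaluation and rearrangement of the Hecke sum

module Hecke {q₁ q₂ : ℕ} .{{q₁≢0 : NonZero q₁}} (1<q₁ : 1 ℕ.< q₁)
  (χ₁ : DirichletCharacter q₁) (χ₂ : DirichletCharacter q₂) (χ₁-primitive : Primitive χ₁)
  (h : ℤ) (k c : ℕ) .{{_ : NonZero k}} (k≡cq₁ : k ≡ c ℕ.* q₁) (q₂∣k : q₂ ∣ k) where

  open ≋-Reasoning

  χ̄₁ χ̄₂ : ℕ → ℂ
  χ̄₁ n = conjugate (χ₁ ⟨ + n ⟩)
  χ̄₂ n = conjugate (χ₂ ⟨ + n ⟩)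

  -- Since `n / q₁ = e n / K`, the whole argument has denominator `K`, and the rest can work with
  -- integers modulo `K`.
  β-argument : ∀ g K e j n .{{_ : NonZero K}} → K ≡ e ℕ.* q₁ →
    B₁ (+ n / q₁ ℚ.+ (g ℤ.* + j) / K) ≡ β K (+ e ℤ.* + n ℤ.+ g ℤ.* + j)
  β-argument g K e j n K≡ = trans
    (cong B₁ (trans (/-+ (+ n) (g ℤ.* + j) q₁ K {{MN≢0 = ℕ.m*n≢0 q₁ K}})
      (/-cross (+ n ℤ.* + K ℤ.+ g ℤ.* + j ℤ.* + q₁) y (q₁ ℕ.* K) K {{M≢0 = ℕ.m*n≢0 q₁ K}}
        (trans (cong (λ t → (+ n ℤ.* t ℤ.+ g ℤ.* + j ℤ.* + q₁) ℤ.* + K) K≡ℤ)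
        (trans (solve 6 (λ n e q g j K → (n :* (e :* q) :+ g :* j :* q) :* K := (e :* n :+ g :* j) :* (q :* K)) refl
          (+ n) (+ e) (+ q₁) g (+ j) (+ K))
        (cong (y ℤ.*_) (sym (ℤ.pos-* q₁ K))))))))
    (β-/ y K)
    where
    open ℤS
    y = + e ℤ.* + n ℤ.+ g ℤ.* + j
    K≡ℤ : + K ≡ + e ℤ.* + q₁
    K≡ℤ = trans (cong +_ K≡) (ℤ.pos-* e q₁)

  opaque
    -- Opaque for the same reason as the complex operations; `transfer-dedekind` carries statements
    -- over.
    dedekind : ℤ → (K : ℕ) .{{_ : NonZero K}} → ℂ
    dedekind = dedekindSum χ₁ χ₂

    dedekind-def : ∀ g K .{{_ : NonZero K}} → dedekind g K ≡ dedekindSum χ₁ χ₂ g K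
    dedekind-def g K = refl

    transfer-dedekind : (P : (ℤ → (K : ℕ) → .{{NonZero K}} → ℂ) → Set) → P (dedekindSum χ₁ χ₂) → P dedekind
    transfer-dedekind P p = p

  dedekind-β : ∀ g K e .{{K≢0 : NonZero K}} → K ≡ e ℕ.* q₁ →
    dedekind g K ≋ sum K (λ j → χ̄₂ j ⊗ (rational (β K (+ j)) ⊗
      sum q₁ (λ n → χ̄₁ n ⊗ rational (β K (+ e ℤ.* + n ℤ.+ g ℤ.* + j)))))
  dedekind-β g K e {{K≢0}} K≡ = begin
    dedekind g K                   ≡⟨ trans (dedekind-def g K) as-raw ⟩
    sum K (λ j → sum q₁ (raw j))   ≈⟨ sum-cong K (λ j _ → row j) ⟩
    sum K (λ j → χ̄₂ j ⊗ (rational (β K (+ j)) ⊗ sum q₁ (λ n → χ̄₁ n ⊗ term j n))) ∎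
    where
    open CSolver
    raw term : ℕ → ℕ → ℂ
    raw j n = χ̄₂ j ⊗ χ̄₁ n ⊗ rational (B₁ (+ j / K)) ⊗ rational (B₁ (+ n / q₁ ℚ.+ (g ℤ.* + j) / K))
    term j n = rational (β K (+ e ℤ.* + n ℤ.+ g ℤ.* + j))
    as-raw : dedekindSum χ₁ χ₂ g K ≡ sum K (λ j → sum q₁ (raw j))
    as-raw = dedekindSum-def {q₁} {q₂} {{q₁≢0}} χ₁ χ₂ g K {{K≢0}}
    raw-β : ∀ j n → raw j n ≡ χ̄₂ j ⊗ χ̄₁ n ⊗ rational (β K (+ j)) ⊗ term j n
    raw-β j n = cong₂ (λ s t → χ̄₂ j ⊗ χ̄₁ n ⊗ rational s ⊗ rational t) (β-/ (+ j) K) (β-argument g K e j n K≡)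
    row : ∀ j → sum q₁ (raw j) ≋ χ̄₂ j ⊗ (rational (β K (+ j)) ⊗ sum q₁ (λ n → χ̄₁ n ⊗ term j n))
    row j = begin
      sum q₁ (raw j)
        ≈⟨ sum-cong q₁ (λ n _ → ≋-trans (≋-reflexive (raw-β j n))
             (solve 4 (λ a b r s → a :* b :* r :* s := (a :* r) :* (b :* s)) ≋-refl (χ̄₂ j) (χ̄₁ n) (rational (β K (+ j))) (term j n))) ⟩
      sum q₁ (λ n → (χ̄₂ j ⊗ rational (β K (+ j))) ⊗ (χ̄₁ n ⊗ term j n))
        ≈⟨ sum-⊗ˡ q₁ (χ̄₂ j ⊗ rational (β K (+ j))) (λ n → χ̄₁ n ⊗ term j n) ⟨
      (χ̄₂ j ⊗ rational (β K (+ j))) ⊗ sum q₁ (λ n → χ̄₁ n ⊗ term j n)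
        ≈⟨ C.*-assoc _ _ _ ⟩
      χ̄₂ j ⊗ (rational (β K (+ j)) ⊗ sum q₁ (λ n → χ̄₁ n ⊗ term j n)) ∎

  -- The function `F` of the overview at the rational `y / k`, using `c n / k = n / q₁`.
  F : ℤ → ℂ
  F y = sum q₁ (λ n → χ̄₁ n ⊗ rational (β k (+ c ℤ.* + n ℤ.+ y)))

  S : ℂ
  S = sum k (λ j → χ̄₂ j ⊗ (rational (β k (+ j)) ⊗ F (h ℤ.* + j)))

  F-periodic : Periodic k F
  F-periodic x≡y = sum-cong q₁ λ n _ → C.*-congˡ (≋-reflexive (cong rational
    (β-periodic k (mod-+ (mod-reflexive {x = + c ℤ.* + n} refl) x≡y))))

  χ̄₂-periodic : ∀ {x y} → + x ≡ + y mod k → χ̄₂ x ≋ χ̄₂ y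
  χ̄₂-periodic x≡y = conjugate-cong (character-periodic χ₂ (mod-∣ q₂∣k x≡y))

  χ̄₂-⊗ : ∀ a b → χ̄₂ (a ℕ.* b) ≋ χ̄₂ a ⊗ χ̄₂ b
  χ̄₂-⊗ a b = ≋-trans (≋-reflexive (cong (λ t → conjugate (χ₂ ⟨ t ⟩)) (ℤ.pos-* a b))) (conjugate-character-⊗ χ₂ (+ a) (+ b))

  χ₁-⊗ : ∀ a b → χ₁ ⟨ + (a ℕ.* b) ⟩ ≋ χ₁ ⟨ + a ⟩ ⊗ χ₁ ⟨ + b ⟩
  χ₁-⊗ a b = ≋-trans (≋-reflexive (cong (χ₁ ⟨_⟩) (ℤ.pos-* a b))) (character-⊗ χ₁ (+ a) (+ b))

  -- Split the index as `t k + i`. The factors `χ̄₂` and `F` have period `k`, so only the Bernoulli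
  -- factor sees `t`, and the distribution relation sums it to `β k i`.
  unfold-S : ∀ e .{{_ : NonZero e}} →
    sum (e ℕ.* k) (λ i → χ̄₂ i ⊗ (rational (β (e ℕ.* k) (+ i)) ⊗ F (h ℤ.* + i))) ≋ S
  unfold-S e = begin
    sum (e ℕ.* k) (λ i → χ̄₂ i ⊗ (rational (β (e ℕ.* k) (+ i)) ⊗ F (h ℤ.* + i)))
      ≈⟨ sum-blocks e k _ ⟩
    sum e (λ t → sum k (λ i → χ̄₂ (t ℕ.* k ℕ.+ i) ⊗ (rational (β (e ℕ.* k) (+ (t ℕ.* k ℕ.+ i))) ⊗ F (h ℤ.* + (t ℕ.* k ℕ.+ i)))))
      ≈⟨ sum-cong e (λ t _ → sum-cong k (λ i _ → ⊗-cong (χ̄₂-periodic (shift≡ t i))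
           (⊗-cong (≋-reflexive (cong (λ x → rational (β (e ℕ.* k) x)) (shift t i)))
             (F-periodic (mod-* (mod-reflexive {x = h} refl) (shift≡ t i)))))) ⟩
    sum e (λ t → sum k (λ i → χ̄₂ i ⊗ (rational (β (e ℕ.* k) (+ i ℤ.+ + t ℤ.* + k)) ⊗ F (h ℤ.* + i))))
      ≈⟨ sum-swap e k _ ⟩
    sum k (λ i → sum e (λ t → χ̄₂ i ⊗ (rational (β (e ℕ.* k) (+ i ℤ.+ + t ℤ.* + k)) ⊗ F (h ℤ.* + i))))
      ≈⟨ sum-cong k (λ i _ → ≋-trans (≋-sym (sum-⊗ˡ e (χ̄₂ i) _)) (C.*-congˡ
           (≋-trans (≋-sym (sum-⊗ʳ e _ (F (h ℤ.* + i)))) (C.*-congʳ (β-distribution e k (+ i)))))) ⟩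
    S ∎
    where
    open ℤS
    shift : ∀ t i → + (t ℕ.* k ℕ.+ i) ≡ + i ℤ.+ + t ℤ.* + k
    shift t i = trans (cong +_ (ℕ.+-comm (t ℕ.* k) i)) (trans (ℤ.pos-+ i (t ℕ.* k)) (cong (λ x → + i ℤ.+ x) (ℤ.pos-* t k)))
    shift≡ : ∀ t i → + (t ℕ.* k ℕ.+ i) ≡ + i mod k
    shift≡ t i = congruent (+ t) (shift t i)

  module _ (g d′ : ℕ) .{{_ : NonZero g}} .{{_ : NonZero d′}} (j′ : ℕ) (coprime : Coprime j′ d′) where

    -- The range of `b` consists of `g` full periods modulo `d′`. In each, `b ↦ j′ b` permutes the
    -- residues and the distribution relation gives `β k w`.
    β-sum : ∀ w → sum (g ℕ.* d′) (λ b → rational (β (d′ ℕ.* k) (w ℤ.+ + j′ ℤ.* + b ℤ.* + k))) ≋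
      rational (+ g / 1) ⊗ rational (β k w)
    β-sum w = begin
      sum (g ℕ.* d′) (λ b → G (+ j′ ℤ.* + b))
        ≈⟨ sum-blocks g d′ _ ⟩
      sum g (λ s → sum d′ (λ b → G (+ j′ ℤ.* + (s ℕ.* d′ ℕ.+ b))))
        ≈⟨ sum-cong g (λ s _ → sum-cong d′ (λ b _ → G-periodic (block s b))) ⟩
      sum g (λ _ → sum d′ (λ b → G (+ j′ ℤ.* + b ℤ.+ 0ℤ)))
        ≈⟨ sum-cong g (λ _ _ → ≋-trans (sum-affine d′ {G} G-periodic j′ 0ℤ coprime) (β-distribution d′ k w)) ⟩
      sum g (λ _ → rational (β k w))
        ≈⟨ sum-const g _ ⟩
      rational (+ g / 1) ⊗ rational (β k w) ∎
      where
      open ℤS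
      G : ℤ → ℂ
      G x = rational (β (d′ ℕ.* k) (w ℤ.+ x ℤ.* + k))
      G-periodic : Periodic d′ G
      G-periodic {y = y} (congruent v refl) = ≋-reflexive (cong rational (β-periodic (d′ ℕ.* k) (congruent v (trans
        (solve 5 (λ w y v d k → w :+ (y :+ v :* d) :* k := (w :+ y :* k) :+ v :* (d :* k)) refl w y v (+ d′) (+ k))
        (cong (λ t → (w ℤ.+ y ℤ.* + k) ℤ.+ v ℤ.* t) (sym (ℤ.pos-* d′ k)))))))
      block : ∀ s b → + j′ ℤ.* + (s ℕ.* d′ ℕ.+ b) ≡ + j′ ℤ.* + b ℤ.+ 0ℤ mod d′
      block s b = congruent (+ j′ ℤ.* + s) (trans
        (cong (+ j′ ℤ.*_) (trans (ℤ.pos-+ (s ℕ.* d′) b) (cong (λ t → t ℤ.+ + b) (ℤ.pos-* s d′))))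
        (solve 4 (λ j s d b → j :* (s :* d :+ b) := (j :* b :+ con 0ℤ) :+ (j :* s) :* d) refl (+ j′) (+ s) (+ d′) (+ b)))

    -- The numerator is `g (c d′ n + h a j′ + j′ b k)`, so `g` cancels against the denominator
    -- `g d′ k`. Summing over `b` then leaves the factor `g` and `c d′ n + h a j′` over `k`, a
    -- twisted sum dilated by `d′`.
    inner-sum : ∀ a d j → d ≡ g ℕ.* d′ → j ≡ g ℕ.* j′ →
      sum d (λ b → sum q₁ (λ n → χ̄₁ n ⊗ rational (β (d ℕ.* k) (+ (d ℕ.* c) ℤ.* + n ℤ.+ (+ a ℤ.* h ℤ.+ + b ℤ.* + k) ℤ.* + j)))) ≋
      rational (+ g / 1) ⊗ (χ₁ ⟨ + d′ ⟩ ⊗ F (h ℤ.* + (a ℕ.* j′)))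
    inner-sum a d j refl refl = begin
      sum d (λ b → sum q₁ (λ n → χ̄₁ n ⊗ rational (β (d ℕ.* k) (arg b n))))
        ≈⟨ sum-swap d q₁ _ ⟩
      sum q₁ (λ n → sum d (λ b → χ̄₁ n ⊗ rational (β (d ℕ.* k) (arg b n))))
        ≈⟨ sum-cong q₁ (λ n _ → ≋-sym (sum-⊗ˡ d (χ̄₁ n) _)) ⟩
      sum q₁ (λ n → χ̄₁ n ⊗ sum d (λ b → rational (β (d ℕ.* k) (arg b n))))
        ≈⟨ sum-cong q₁ (λ n _ → C.*-congˡ (≋-trans
             (sum-cong d (λ b _ → ≋-reflexive (cong rational (reduce b n))))
             (β-sum (w n)))) ⟩
      sum q₁ (λ n → χ̄₁ n ⊗ (rational (+ g / 1) ⊗ f (+ d′ ℤ.* + n)))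
        ≈⟨ sum-cong q₁ (λ n _ → solve 3 (λ a b c → a :* (b :* c) := b :* (a :* c)) ≋-refl (χ̄₁ n) (rational (+ g / 1)) (f (+ d′ ℤ.* + n))) ⟩
      sum q₁ (λ n → rational (+ g / 1) ⊗ (χ̄₁ n ⊗ f (+ d′ ℤ.* + n)))
        ≈⟨ sum-⊗ˡ q₁ (rational (+ g / 1)) _ ⟨
      rational (+ g / 1) ⊗ sum q₁ (λ n → χ̄₁ n ⊗ f (+ d′ ℤ.* + n))
        -- `f` has period `q₁` because `c q₁ = k`.
        ≈⟨ C.*-congˡ (Separation.separation 1<q₁ χ₁ χ₁-primitive {f} f-periodic d′) ⟩
      rational (+ g / 1) ⊗ (χ₁ ⟨ + d′ ⟩ ⊗ F (h ℤ.* + (a ℕ.* j′))) ∎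
      where
      open CSolver
      module Z = ℤS
      y : ℤ
      y = h ℤ.* + (a ℕ.* j′)
      arg : ℕ → ℕ → ℤ
      arg b n = + (d ℕ.* c) ℤ.* + n ℤ.+ (+ a ℤ.* h ℤ.+ + b ℤ.* + k) ℤ.* + j
      f : ℤ → ℂ
      f x = rational (β k (+ c ℤ.* x ℤ.+ y))
      w : ℕ → ℤ
      w n = + c ℤ.* (+ d′ ℤ.* + n) ℤ.+ y
      kℤ : + k ≡ + c ℤ.* + q₁
      kℤ = trans (cong +_ k≡cq₁) (ℤ.pos-* c q₁)
      f-periodic : Periodic q₁ f
      f-periodic {y = x} (congruent v refl) = ≋-reflexive (cong rational (β-periodic k (congruent v (trans
        (Z.solve 5 (λ c x v q y → c Z.:* (x Z.:+ v Z.:* q) Z.:+ y Z.:= (c Z.:* x Z.:+ y) Z.:+ v Z.:* (c Z.:* q)) refl (+ c) x v (+ q₁) y)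
        (cong (λ t → (+ c ℤ.* x ℤ.+ y) ℤ.+ v ℤ.* t) (sym kℤ))))))
      arg≡ : ∀ b n → arg b n ≡ + g ℤ.* (w n ℤ.+ + j′ ℤ.* + b ℤ.* + k)
      arg≡ b n = trans
        (cong₂ (λ s t → s ℤ.* + n ℤ.+ (+ a ℤ.* h ℤ.+ + b ℤ.* + k) ℤ.* t)
          (trans (ℤ.pos-* (g ℕ.* d′) c) (cong (ℤ._* + c) (ℤ.pos-* g d′))) (ℤ.pos-* g j′))
        (trans (Z.solve 9 (λ g d c n a h b k j →
            (g Z.:* d Z.:* c) Z.:* n Z.:+ (a Z.:* h Z.:+ b Z.:* k) Z.:* (g Z.:* j) Z.:=
            g Z.:* ((c Z.:* (d Z.:* n) Z.:+ h Z.:* (a Z.:* j)) Z.:+ j Z.:* b Z.:* k)) refl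
            (+ g) (+ d′) (+ c) (+ n) (+ a) h (+ b) (+ k) (+ j′))
          (cong (λ t → + g ℤ.* ((+ c ℤ.* (+ d′ ℤ.* + n) ℤ.+ h ℤ.* t) ℤ.+ + j′ ℤ.* + b ℤ.* + k)) (sym (ℤ.pos-* a j′))))
      reduce : ∀ b n → β (d ℕ.* k) (arg b n) ≡ β (d′ ℕ.* k) (w n ℤ.+ + j′ ℤ.* + b ℤ.* + k)
      reduce b n = trans (cong₂ β (ℕ.*-assoc g d′ k) (arg≡ b n)) (β-scale g (d′ ℕ.* k) (w n ℤ.+ + j′ ℤ.* + b ℤ.* + k))

  module _ (n : ℕ) .{{_ : NonZero n}} where

    -- Wherever a term contributes, `g` divides both `i` and `n`, so the two quotients are exact.
    W : ℕ → ℕ → ℂ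
    W i g = χ̄₂ i ⊗ (rational (β (n ℕ.* k) (+ i)) ⊗
      (rational (+ g / 1) ⊗ (χ₁ ⟨ + (n ÷ g) ⟩ ⊗ F (h ℤ.* + (i ÷ g)))))

    shifted : ℕ → (d : ℕ) .{{_ : NonZero d}} → ℂ
    shifted a d = sum d (λ b → dedekind (+ a ℤ.* h ℤ.+ + b ℤ.* + k) (d ℕ.* k) {{ℕ.m*n≢0 d k}})

    -- The bound `n` is a residue modulo `q₁` and hides the index of the Hecke operator.
    reduced : ℕ → ℕ → ℕ → ℂ
    reduced a d j = sum d (λ b → sum q₁ (λ n → χ̄₁ n ⊗
      rational (β (d ℕ.* k) (+ (d ℕ.* c) ℤ.* + n ℤ.+ (+ a ℤ.* h ℤ.+ + b ℤ.* + k) ℤ.* + j))))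

    shifted-reduced : ∀ a d .{{_ : NonZero d}} → shifted a d ≋
      sum (d ℕ.* k) (λ j → χ̄₂ j ⊗ (rational (β (d ℕ.* k) (+ j)) ⊗ reduced a d j))
    shifted-reduced a d = begin
      shifted a d
        ≈⟨ sum-cong d (λ b _ → dedekind-β (+ a ℤ.* h ℤ.+ + b ℤ.* + k) (d ℕ.* k) (d ℕ.* c) {{ℕ.m*n≢0 d k}}
             (trans (cong (d ℕ.*_) k≡cq₁) (sym (ℕ.*-assoc d c q₁)))) ⟩
      sum d (λ b → sum (d ℕ.* k) (λ j → χ̄₂ j ⊗ (rational (β (d ℕ.* k) (+ j)) ⊗ T b j)))
        ≈⟨ sum-swap d (d ℕ.* k) _ ⟩
      sum (d ℕ.* k) (λ j → sum d (λ b → χ̄₂ j ⊗ (rational (β (d ℕ.* k) (+ j)) ⊗ T b j)))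
        ≈⟨ sum-cong (d ℕ.* k) (λ j _ → ≋-trans (≋-sym (sum-⊗ˡ d (χ̄₂ j) _))
             (C.*-congˡ (≋-sym (sum-⊗ˡ d (rational (β (d ℕ.* k) (+ j))) (λ b → T b j))))) ⟩
      sum (d ℕ.* k) (λ j → χ̄₂ j ⊗ (rational (β (d ℕ.* k) (+ j)) ⊗ reduced a d j)) ∎
      where
      T : ℕ → ℕ → ℂ
      T b j = sum q₁ (λ n → χ̄₁ n ⊗
        rational (β (d ℕ.* k) (+ (d ℕ.* c) ℤ.* + n ℤ.+ (+ a ℤ.* h ℤ.+ + b ℤ.* + k) ℤ.* + j)))

    -- Everything regroups around `i = a j`: the values of `χ̄₂` multiply to `χ̄₂(i)`, the fraction
    -- `j/(d k)` equals `i/(n k)`, and `a d′ = n/g`, `a j′ = i/g`.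
    term-W : ∀ a d .{{_ : NonZero a}} .{{_ : NonZero d}} → n ≡ a ℕ.* d → ∀ j →
      (χ₁ ⟨ + a ⟩ ⊗ χ̄₂ a) ⊗ (χ̄₂ j ⊗ (rational (β (d ℕ.* k) (+ j)) ⊗ reduced a d j)) ≋
      W (a ℕ.* j) (gcd (a ℕ.* j ÷ a) d)
    term-W a d n≡ad j = begin
      (χ₁ ⟨ + a ⟩ ⊗ χ̄₂ a) ⊗ (χ̄₂ j ⊗ (rational (β (d ℕ.* k) (+ j)) ⊗ reduced a d j))
        ≈⟨ C.*-congˡ (C.*-congˡ (C.*-congˡ
             (inner-sum g d′ j′ (Coprime.gcd≡1⇒coprime gcd≡1) a d j d≡ j≡))) ⟩
      (χ₁ ⟨ + a ⟩ ⊗ χ̄₂ a) ⊗ (χ̄₂ j ⊗ (rational (β (d ℕ.* k) (+ j)) ⊗ (r ⊗ (χ₁ ⟨ + d′ ⟩ ⊗ y))))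
        ≈⟨ solve 7 (λ a a₂ j₂ b r d y → (a :* a₂) :* (j₂ :* (b :* (r :* (d :* y)))) := (a₂ :* j₂) :* (b :* (r :* ((a :* d) :* y)))) ≋-refl
             (χ₁ ⟨ + a ⟩) (χ̄₂ a) (χ̄₂ j) (rational (β (d ℕ.* k) (+ j))) r (χ₁ ⟨ + d′ ⟩) y ⟩
      (χ̄₂ a ⊗ χ̄₂ j) ⊗ (rational (β (d ℕ.* k) (+ j)) ⊗ (r ⊗ ((χ₁ ⟨ + a ⟩ ⊗ χ₁ ⟨ + d′ ⟩) ⊗ y)))
        ≈⟨ ⊗-cong (≋-sym (χ̄₂-⊗ a j)) (⊗-cong (≋-reflexive (cong rational β≡))
             (C.*-congˡ (C.*-congʳ (≋-sym (χ₁-⊗ a d′))))) ⟩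
      χ̄₂ (a ℕ.* j) ⊗ (rational (β (n ℕ.* k) (+ (a ℕ.* j))) ⊗ (r ⊗ (χ₁ ⟨ + (a ℕ.* d′) ⟩ ⊗ y)))
        ≡⟨ cong₂ (λ s t → χ̄₂ (a ℕ.* j) ⊗ (rational (β (n ℕ.* k) (+ (a ℕ.* j))) ⊗ (r ⊗ (χ₁ ⟨ + s ⟩ ⊗ F (h ℤ.* + t)))))
             (sym n÷g) (sym aj÷g) ⟩
      W (a ℕ.* j) g
        -- Expressing `j` as `a j ÷ a` makes the term a function of `a j`, ready for reindexing over
        -- multiples of `a`.
        ≡⟨ cong (λ t → W (a ℕ.* j) (gcd t d)) (sym (*-÷ a j)) ⟩
      W (a ℕ.* j) (gcd (a ℕ.* j ÷ a) d) ∎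
      where
      open CSolver
      split = gcd-split j d
      g = gcd j d
      j′ = proj₁ split
      d′ = proj₁ (proj₂ split)
      r = rational (+ g / 1)
      y = F (h ℤ.* + (a ℕ.* j′))
      j≡ : j ≡ g ℕ.* j′
      j≡ = proj₁ (proj₂ (proj₂ split))
      d≡ : d ≡ g ℕ.* d′
      d≡ = proj₁ (proj₂ (proj₂ (proj₂ split)))
      gcd≡1 : gcd j′ d′ ≡ 1
      gcd≡1 = proj₁ (proj₂ (proj₂ (proj₂ (proj₂ split))))
      instance
        g≢0 : NonZero g
        g≢0 = proj₂ (proj₂ (proj₂ (proj₂ (proj₂ split))))
        d′≢0 : NonZero d′
        d′≢0 = ℕ.m*n≢0⇒n≢0 g {{subst NonZero d≡ (ℕ.>-nonZero (ℕ.>-nonZero⁻¹ d))}}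
      β≡ : β (d ℕ.* k) (+ j) ≡ β (n ℕ.* k) (+ (a ℕ.* j))
      β≡ = trans (sym (β-scale a (d ℕ.* k) (+ j)))
        (cong₂ β (trans (sym (ℕ.*-assoc a d k)) (cong (ℕ._* k) (sym n≡ad))) (sym (ℤ.pos-* a j)))
      rotate : ∀ x → a ℕ.* (g ℕ.* x) ÷ g ≡ a ℕ.* x
      rotate x = trans (cong (_÷ g) (trans (sym (ℕ.*-assoc a g x)) (trans (cong (ℕ._* x) (ℕ.*-comm a g)) (ℕ.*-assoc g a x))))
        (*-÷ g (a ℕ.* x))
      n÷g : n ÷ g ≡ a ℕ.* d′
      n÷g = trans (cong (_÷ g) (trans n≡ad (cong (a ℕ.*_) d≡))) (rotate d′)
      aj÷g : a ℕ.* j ÷ g ≡ a ℕ.* j′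
      aj÷g = trans (cong (λ t → a ℕ.* t ÷ g) j≡) (rotate j′)

    V : ℕ → ℂ
    V a = sum (n ℕ.* k) (λ i → when (a ∣? i) (W i (codivisor i n a)))

    shifted-V : ∀ a d .{{_ : NonZero a}} .{{_ : NonZero d}} → n ≡ a ℕ.* d →
      (χ₁ ⟨ + a ⟩ ⊗ χ̄₂ a) ⊗ shifted a d ≋ V a
    shifted-V a d n≡ad = begin
      (χ₁ ⟨ + a ⟩ ⊗ χ̄₂ a) ⊗ shifted a d
        ≈⟨ C.*-congˡ (shifted-reduced a d) ⟩
      (χ₁ ⟨ + a ⟩ ⊗ χ̄₂ a) ⊗ sum (d ℕ.* k) (λ j → χ̄₂ j ⊗ (rational (β (d ℕ.* k) (+ j)) ⊗ reduced a d j))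
        ≈⟨ sum-⊗ˡ (d ℕ.* k) _ _ ⟩
      sum (d ℕ.* k) (λ j → (χ₁ ⟨ + a ⟩ ⊗ χ̄₂ a) ⊗ (χ̄₂ j ⊗ (rational (β (d ℕ.* k) (+ j)) ⊗ reduced a d j)))
        ≈⟨ sum-cong (d ℕ.* k) (λ j _ → term-W a d n≡ad j) ⟩
      sum (d ℕ.* k) (λ j → W (a ℕ.* j) (gcd (a ℕ.* j ÷ a) d))
        ≈⟨ sum-multiples a (d ℕ.* k) (λ i → W i (gcd (i ÷ a) d)) ⟩
      sum (a ℕ.* (d ℕ.* k)) (λ i → when (a ∣? i) (W i (gcd (i ÷ a) d)))
        ≡⟨ cong₂ (λ s t → sum s (λ i → when (a ∣? i) (W i (gcd (i ÷ a) t))))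
             (trans (sym (ℕ.*-assoc a d k)) (cong (ℕ._* k) (sym n≡ad)))
             (sym (trans (cong (_÷ a) n≡ad) (*-÷ a d))) ⟩
      V a ∎

    -- Both sums run over the common divisors of `i` and `n`. As `codivisor` is its own inverse
    -- there, one map `φ` and one verification `φ-ok` serve both directions of the reindexing.
    involution : ∀ i →
      sum n (λ a → when (suc a ∣? n) (when (suc a ∣? i) (W i (codivisor i n (suc a))))) ≋
      sum n (λ g → when (suc g ∣? n) (when (suc g ∣? i) (W i (suc g))))
    involution i = begin
      sum n (λ a → when (suc a ∣? n) (when (suc a ∣? i) (W i (codivisor i n (suc a)))))
        ≈⟨ sum-cong n (λ a _ → both a) ⟩
      sum n (λ a → when (common? a) (W i (suc (φ a))))
        ≈⟨ sum-reindex common? common? n n φ φ (λ g → W i (suc g)) φ-ok φ-ok ⟩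
      sum n (λ g → when (common? g) (W i (suc g)))
        ≈⟨ sum-cong n (λ g _ → merge (suc g ∣? n) (suc g ∣? i)) ⟨
      sum n (λ g → when (suc g ∣? n) (when (suc g ∣? i) (W i (suc g)))) ∎
      where
      common? : ∀ a → Dec (suc a ∣ n × suc a ∣ i)
      common? a = suc a ∣? n ×-dec suc a ∣? i
      -- Indices are divisors minus 1, whence `pred`; positivity of the codivisor makes it
      -- reversible.
      φ : ℕ → ℕ
      φ a = ℕ.pred (codivisor i n (suc a))
      merge : ∀ {A B : Set} (d : Dec A) (e : Dec B) {z} → when d (when e z) ≋ when (d ×-dec e) z
      merge (yes _) (yes _) = ≋-refl
      merge (yes _) (no _)  = ≋-refl
      merge (no _)  e       = ≋-refl
      suc-φ : ∀ a → suc a ∣ n → suc a ∣ i → suc (φ a) ≡ codivisor i n (suc a)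
      suc-φ a a∣n a∣i = ℕ.suc-pred _ {{proj₁ (codivisor-spec a∣n a∣i)}}
      both : ∀ a → when (suc a ∣? n) (when (suc a ∣? i) (W i (codivisor i n (suc a)))) ≋
        when (common? a) (W i (suc (φ a)))
      both a = ≋-trans (merge (suc a ∣? n) (suc a ∣? i))
        (when-⇔ (common? a) (common? a) (λ p → p) (λ p → p)
          (λ (a∣n , a∣i) → ≋-reflexive (cong (W i) (sym (suc-φ a a∣n a∣i)))))
      φ-ok : ∀ a → a ℕ.< n → suc a ∣ n × suc a ∣ i →
        φ a ℕ.< n × (suc (φ a) ∣ n × suc (φ a) ∣ i) × φ (φ a) ≡ a
      φ-ok a _ (a∣n , a∣i) = ℕ∣.∣⇒≤ φ∣n , (φ∣n , φ∣i) ,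
        cong ℕ.pred (trans (cong (codivisor i n) φ≡) (proj₂ (proj₂ (proj₂ spec))))
        where
        spec = codivisor-spec a∣n a∣i
        φ≡ = suc-φ a a∣n a∣i
        φ∣n : suc (φ a) ∣ n
        φ∣n = subst (_∣ n) (sym φ≡) (proj₁ (proj₂ spec))
        φ∣i : suc (φ a) ∣ i
        φ∣i = subst (_∣ i) (sym φ≡) (proj₁ (proj₂ (proj₂ spec)))

    -- Only `i = g i′` contributes. By multiplicativity `W (g i′) g` is a constant times the summand
    -- of `unfold-S` for `e = n/g`.
    divisor-sum : ∀ g .{{_ : NonZero g}} → g ∣ n →
      sum (n ℕ.* k) (λ i → when (g ∣? i) (W i g)) ≋ (χ₁ ⟨ + (n ÷ g) ⟩ ⊗ χ̄₂ g ⊗ rational (+ g / 1)) ⊗ S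
    divisor-sum g g∣n = begin
      sum (n ℕ.* k) (λ i → when (g ∣? i) (W i g))
        ≡⟨ cong (λ t → sum t (λ i → when (g ∣? i) (W i g))) nk≡ ⟩
      sum (g ℕ.* (e ℕ.* k)) (λ i → when (g ∣? i) (W i g))
        ≈⟨ sum-multiples g (e ℕ.* k) (λ i → W i g) ⟨
      sum (e ℕ.* k) (λ i → W (g ℕ.* i) g)
        ≈⟨ sum-cong (e ℕ.* k) (λ i _ → begin
             W (g ℕ.* i) g
               ≈⟨ ⊗-cong (χ̄₂-⊗ g i) (⊗-cong (≋-reflexive (cong rational (β≡ i)))
                    (C.*-congˡ (C.*-congˡ (≋-reflexive (cong (λ t → F (h ℤ.* + t)) (*-÷ g i)))))) ⟩
             (χ̄₂ g ⊗ χ̄₂ i) ⊗ (b i ⊗ (r ⊗ (χ₁ ⟨ + e ⟩ ⊗ F (h ℤ.* + i))))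
               ≈⟨ solve 6 (λ g₂ i₂ b r e f → (g₂ :* i₂) :* (b :* (r :* (e :* f))) := (e :* g₂ :* r) :* (i₂ :* (b :* f))) ≋-refl
                    (χ̄₂ g) (χ̄₂ i) (b i) r (χ₁ ⟨ + e ⟩) (F (h ℤ.* + i)) ⟩
             (χ₁ ⟨ + e ⟩ ⊗ χ̄₂ g ⊗ r) ⊗ (χ̄₂ i ⊗ (b i ⊗ F (h ℤ.* + i))) ∎) ⟩
      sum (e ℕ.* k) (λ i → (χ₁ ⟨ + e ⟩ ⊗ χ̄₂ g ⊗ r) ⊗ (χ̄₂ i ⊗ (b i ⊗ F (h ℤ.* + i))))
        ≈⟨ sum-⊗ˡ (e ℕ.* k) _ _ ⟨
      (χ₁ ⟨ + e ⟩ ⊗ χ̄₂ g ⊗ r) ⊗ sum (e ℕ.* k) (λ i → χ̄₂ i ⊗ (b i ⊗ F (h ℤ.* + i)))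
        ≈⟨ C.*-congˡ (unfold-S e) ⟩
      (χ₁ ⟨ + e ⟩ ⊗ χ̄₂ g ⊗ r) ⊗ S ∎
      where
      open CSolver
      e = n ÷ g
      r = rational (+ g / 1)
      b : ℕ → ℂ
      b i = rational (β (e ℕ.* k) (+ i))
      n≡ : n ≡ g ℕ.* e
      n≡ = ∣-÷ g∣n
      instance
        e≢0 : NonZero e
        e≢0 = ℕ.m*n≢0⇒n≢0 g {{subst NonZero n≡ (ℕ.>-nonZero (ℕ.>-nonZero⁻¹ n))}}
      nk≡ : n ℕ.* k ≡ g ℕ.* (e ℕ.* k)
      nk≡ = trans (cong (ℕ._* k) n≡) (ℕ.*-assoc g e k)
      β≡ : ∀ i → β (n ℕ.* k) (+ (g ℕ.* i)) ≡ β (e ℕ.* k) (+ i)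
      β≡ i = trans (cong₂ β nk≡ (ℤ.pos-* g i)) (β-scale g (e ℕ.* k) (+ i))

    term : (a d : ℕ) .{{_ : NonZero d}} → ℂ
    term a d = when (coprime? a (q₁ ℕ.* q₂)) (ψ χ₁ χ₂ (+ a) ⊗ shifted a d)

    -- If `a` is not coprime to `q₁ q₂`, it is not coprime to one of the factors, and the
    -- corresponding character value is already 0.
    drop-coprime : ∀ a d .{{_ : NonZero d}} → term a d ≋ (χ₁ ⟨ + a ⟩ ⊗ χ̄₂ a) ⊗ shifted a d
    drop-coprime a d = ≋-trans
      (≋-reflexive (cong (λ z → when (coprime? a (q₁ ℕ.* q₂)) (z ⊗ shifted a d)) (ψ-def χ₁ χ₂ (+ a))))
      (go (coprime? a (q₁ ℕ.* q₂)) (coprime? a q₁))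
      where
      ψ-zero : Dec (Coprime a q₁) → ¬ Coprime a (q₁ ℕ.* q₂) → χ₁ ⟨ + a ⟩ ⊗ χ̄₂ a ≋ 𝟘
      ψ-zero (no ¬aq₁) _ = ≋-trans (C.*-congʳ (character-zero χ₁ (+ a) ¬aq₁)) (C.zeroˡ _)
      ψ-zero (yes aq₁) ¬aq = ≋-trans (C.*-congˡ (≋-trans
        (conjugate-cong (character-zero χ₂ (+ a)
          (λ aq₂ → ¬aq (Coprime.sym {q₁ ℕ.* q₂} {a} (coprime-* {q₁} {q₂} (Coprime.sym {a} {q₁} aq₁) (Coprime.sym {a} {q₂} aq₂))))))
        (conjugate-rational 0ℚ))) (C.zeroʳ _)
      go : (e : Dec (Coprime a (q₁ ℕ.* q₂))) → Dec (Coprime a q₁) →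
        when e ((χ₁ ⟨ + a ⟩ ⊗ χ̄₂ a) ⊗ shifted a d) ≋ (χ₁ ⟨ + a ⟩ ⊗ χ̄₂ a) ⊗ shifted a d
      go (yes _)  _   = ≋-refl
      go (no ¬aq) aq₁? = ≋-sym (≋-trans (C.*-congʳ (ψ-zero aq₁? ¬aq)) (C.zeroˡ _))

    -- By `shifted-V` the value depends on `a` alone, and a divisor `a` of `n` has exactly one
    -- cofactor.
    factorisation-sum : ∀ a →
      sum n (λ j → when (suc a ℕ.* suc j ℕ.≟ n) (term (suc a) (suc j))) ≋ when (suc a ∣? n) (V (suc a))
    factorisation-sum a = begin
      sum n (λ j → when (suc a ℕ.* suc j ℕ.≟ n) (term (suc a) (suc j)))
        ≈⟨ sum-cong n (λ j _ → when-⇔ (suc a ℕ.* suc j ℕ.≟ n) (suc a ℕ.* suc j ℕ.≟ n) (λ p → p) (λ p → p)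
             (λ eq → ≋-trans (drop-coprime (suc a) (suc j)) (shifted-V (suc a) (suc j) (sym eq)))) ⟩
      sum n (λ j → when (suc a ℕ.* suc j ℕ.≟ n) (V (suc a)))
        ≈⟨ go (suc a ∣? n) ⟩
      when (suc a ∣? n) (V (suc a)) ∎
      where
      go : (d : Dec (suc a ∣ n)) →
        sum n (λ j → when (suc a ℕ.* suc j ℕ.≟ n) (V (suc a))) ≋ when d (V (suc a))
      go (no a∤n) = ≋-trans (sum-cong n λ j _ → when-no (suc a ℕ.* suc j ℕ.≟ n)
        (λ eq → a∤n (divides (suc j) (trans (sym eq) (ℕ.*-comm (suc a) (suc j)))))) (sum-𝟘 n)
      go (yes (divides zero n≡0)) = contradiction n≡0 (ℕ.≢-nonZero⁻¹ n)
      go (yes (divides (suc e) n≡)) = ≋-trans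
        (sum-cong n λ j _ → when-⇔ (suc a ℕ.* suc j ℕ.≟ n) (j ℕ.≟ e)
          (λ eq → ℕ.suc-injective (ℕ.*-cancelˡ-≡ (suc j) (suc e) (suc a) (trans eq n≡ae)))
          (λ { refl → sym n≡ae })
          (λ _ → ≋-refl))
        (sum-delta n e (λ _ → V (suc a)) (subst (suc e ℕ.≤_) (sym n≡) (ℕ.m≤m*n (suc e) (suc a))))
        where
        n≡ae : n ≡ suc a ℕ.* suc e
        n≡ae = trans n≡ (ℕ.*-comm (suc e) (suc a))

    -- The involution acts on divisors for a fixed `i`, so the sum over `i` is moved outside for it
    -- and then back inside for `divisor-sum`.
    hecke-relation :
      sum n (λ a → sum n (λ j → when (suc a ℕ.* suc j ℕ.≟ n) (term (suc a) (suc j)))) ≋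
      sum n (λ g → when (suc g ∣? n) (χ₁ ⟨ + (n ℕ./ suc g) ⟩ ⊗ χ̄₂ (suc g) ⊗ rational (+ suc g / 1))) ⊗
        dedekind h k
    hecke-relation = begin
      sum n (λ a → sum n (λ j → when (suc a ℕ.* suc j ℕ.≟ n) (term (suc a) (suc j))))
        ≈⟨ sum-cong n (λ a _ → factorisation-sum a) ⟩
      sum n (λ a → when (suc a ∣? n) (V (suc a)))
        ≈⟨ sum-cong n (λ a _ → push (suc a ∣? n) _) ⟩
      sum n (λ a → sum (n ℕ.* k) (λ i → when (suc a ∣? n) (when (suc a ∣? i) (W i (codivisor i n (suc a))))))
        ≈⟨ sum-swap n (n ℕ.* k) _ ⟩
      sum (n ℕ.* k) (λ i → sum n (λ a → when (suc a ∣? n) (when (suc a ∣? i) (W i (codivisor i n (suc a))))))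
        ≈⟨ sum-cong (n ℕ.* k) (λ i _ → involution i) ⟩
      sum (n ℕ.* k) (λ i → sum n (λ g → when (suc g ∣? n) (when (suc g ∣? i) (W i (suc g)))))
        ≈⟨ sum-swap n (n ℕ.* k) _ ⟨
      sum n (λ g → sum (n ℕ.* k) (λ i → when (suc g ∣? n) (when (suc g ∣? i) (W i (suc g)))))
        ≈⟨ sum-cong n (λ g _ → push (suc g ∣? n) _) ⟨
      sum n (λ g → when (suc g ∣? n) (sum (n ℕ.* k) (λ i → when (suc g ∣? i) (W i (suc g)))))
        ≈⟨ sum-cong n (λ g _ → when-⇔ (suc g ∣? n) (suc g ∣? n) (λ p → p) (λ p → p) (λ g∣n → ≋-trans
             (divisor-sum (suc g) g∣n) (C.*-congˡ (≋-sym (dedekind-β h k c k≡cq₁))))) ⟩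
      sum n (λ g → when (suc g ∣? n) (R g ⊗ D))
        ≈⟨ sum-cong n (λ g _ → pull (suc g ∣? n) (R g)) ⟩
      sum n (λ g → when (suc g ∣? n) (R g) ⊗ D)
        ≈⟨ sum-⊗ʳ n _ D ⟨
      sum n (λ g → when (suc g ∣? n) (R g)) ⊗ D ∎
      where
      D = dedekind h k
      R : ℕ → ℂ
      R g = χ₁ ⟨ + (n ℕ./ suc g) ⟩ ⊗ χ̄₂ (suc g) ⊗ rational (+ suc g / 1)
      push : ∀ {A : Set} (d : Dec A) (f : ℕ → ℂ) →
        when d (sum (n ℕ.* k) f) ≋ sum (n ℕ.* k) (λ i → when d (f i))
      push (yes _) f = ≋-refl
      push (no _)  f = ≋-sym (sum-𝟘 (n ℕ.* k))
      pull : ∀ {A : Set} (d : Dec A) z → when d (z ⊗ D) ≋ when d z ⊗ D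
      pull (yes _) z = ≋-refl
      pull (no _)  z = ≋-sym (C.zeroˡ D)

-- Return to the operations of the statement

opaque
  unfolding _⊗_

  ≋⇒≈ : ∀ {z u v} → z ≋ u ⊗ v → z ≈ u * v
  ≋⇒≈ p = unwrap p

-- With `D` a variable, the two sides can be compared without unfolding any Dedekind sum.
factorisations-def : ∀ {q₁ q₂} (χ₁ : DirichletCharacter q₁) (χ₂ : DirichletCharacter q₂) h k n
  (D : ℤ → (K : ℕ) → .{{NonZero K}} → ℂ) .{{_ : NonZero k}} →
  ∑-factorisations n (λ a d →
    if does (coprime? a (q₁ ℕ.* q₂))
    then ψ χ₁ χ₂ (+ a) * (∑[ b < d ] D (+ a ℤ.* h ℤ.+ + b ℤ.* + k) (d ℕ.* k) {{m*n≢0 d k}})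
    else 0ℂ)
  ≡ sum n (λ i → sum n (λ j → when (suc i ℕ.* suc j ℕ.≟ n) (when (coprime? (suc i) (q₁ ℕ.* q₂))
      (ψ χ₁ χ₂ (+ suc i) ⊗ sum (suc j) (λ b → D (+ suc i ℤ.* h ℤ.+ + b ℤ.* + k) (suc j ℕ.* k) {{m*n≢0 (suc j) k}})))))
factorisations-def {q₁} {q₂} χ₁ χ₂ h k n D = transfer P refl
  where
  P : (ℂ → ℂ → ℂ) → (ℂ → ℂ) → (ℚ → ℂ) → (ℕ → (ℕ → ℂ) → ℂ) → Set
  P _·_ _ emb Σ = ∑-factorisations n (λ a d →
      if does (coprime? a (q₁ ℕ.* q₂))
      then ψ χ₁ χ₂ (+ a) * (∑[ b < d ] D (+ a ℤ.* h ℤ.+ + b ℤ.* + k) (d ℕ.* k) {{m*n≢0 d k}})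
      else 0ℂ)
    ≡ Σ n (λ i → Σ n (λ j → if does (suc i ℕ.* suc j ℕ.≟ n)
        then (if does (coprime? (suc i) (q₁ ℕ.* q₂))
          then ψ χ₁ χ₂ (+ suc i) · Σ (suc j) (λ b → D (+ suc i ℤ.* h ℤ.+ + b ℤ.* + k) (suc j ℕ.* k) {{m*n≢0 (suc j) k}})
          else emb 0ℚ)
        else emb 0ℚ))

theorem1p7 : ∀ (q₁ q₂ : ℕ) .{{_ : NonZero q₁}} → 1 ℕ.< q₁ → 1 ℕ.< q₂ →
    (χ₁ : DirichletCharacter q₁) (χ₂ : DirichletCharacter q₂) →
    Primitive χ₁ → Primitive χ₂ →
    χ₁ ⟨ -[1+ 0 ] ⟩ * χ₂ ⟨ -[1+ 0 ] ⟩ ≈ 1ℂ →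
    ∀ (h : ℤ) (k n : ℕ) .{{_ : NonZero k}} .{{_ : NonZero n}} →
    q₁ ℕ.* q₂ ∣ k →
    ∑-factorisations n (λ a d →
    if does (coprime? a (q₁ ℕ.* q₂))
    then ψ χ₁ χ₂ (+ a) *
    (∑[ b < d ] dedekindSum χ₁ χ₂ (+ a ℤ.* h ℤ.+ + b ℤ.* + k)
    (d ℕ.* k) {{m*n≢0 d k}})
    else 0ℂ)
    ≈ ρ χ₁ χ₂ n * dedekindSum χ₁ χ₂ h k
theorem1p7 q₁ q₂ {{q₁≢0}} 1<q₁ _ χ₁ χ₂ χ₁-primitive _ _ h k n {{k≢0}} {{n≢0}} (divides e k≡) = result
  where
  -- From `k = e (q₁ q₂)` the cofactor of `q₁` in `k` is `e q₂`.
  module H = Hecke {q₁} {q₂} {{q₁≢0}} 1<q₁ χ₁ χ₂ χ₁-primitive h k (e ℕ.* q₂) {{k≢0}}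
    (trans k≡ (trans (cong (e ℕ.*_) (ℕ.*-comm q₁ q₂)) (sym (ℕ.*-assoc e q₂ q₁))))
    (ℕ∣.∣-trans (ℕ∣.n∣m*n q₁) (divides e k≡))
  -- Only the right-hand side is abstracted over `D`, so the transfer replaces the Dedekind sums
  -- there and leaves the left-hand side as in the statement.
  P : (ℤ → (K : ℕ) → .{{NonZero K}} → ℂ) → Set
  P D = ∑-factorisations n (λ a d →
    if does (coprime? a (q₁ ℕ.* q₂))
    then ψ χ₁ χ₂ (+ a) * (∑[ b < d ] dedekindSum χ₁ χ₂ (+ a ℤ.* h ℤ.+ + b ℤ.* + k) (d ℕ.* k) {{m*n≢0 d k}})
    else 0ℂ)
    ≡ sum n (λ i → sum n (λ j → when (suc i ℕ.* suc j ℕ.≟ n) (when (coprime? (suc i) (q₁ ℕ.* q₂))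
        (ψ χ₁ χ₂ (+ suc i) ⊗ sum (suc j) (λ b → D (+ suc i ℤ.* h ℤ.+ + b ℤ.* + k) (suc j ℕ.* k) {{m*n≢0 (suc j) k}})))))
  left : P H.dedekind
  left = H.transfer-dedekind P (factorisations-def χ₁ χ₂ h k n (dedekindSum {q₁} {q₂} {{q₁≢0}} χ₁ χ₂) {{k≢0}})
  right : sum n (λ g → when (suc g ∣? n)
      (χ₁ ⟨ + (n ℕ./ suc g) ⟩ ⊗ H.χ̄₂ (suc g) ⊗ rational (+ suc g / 1))) ⊗ H.dedekind h k
    ≡ ρ χ₁ χ₂ n ⊗ dedekindSum χ₁ χ₂ h k
  right = cong₂ _⊗_ (sym (ρ-def χ₁ χ₂ n)) (H.dedekind-def h k {{k≢0}})
  relation : ∑-factorisations n (λ a d →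
    if does (coprime? a (q₁ ℕ.* q₂))
    then ψ χ₁ χ₂ (+ a) * (∑[ b < d ] dedekindSum χ₁ χ₂ (+ a ℤ.* h ℤ.+ + b ℤ.* + k) (d ℕ.* k) {{m*n≢0 d k}})
    else 0ℂ)
    ≋ ρ χ₁ χ₂ n ⊗ dedekindSum χ₁ χ₂ h k
  relation = ≋-trans (≋-reflexive left) (≋-trans (H.hecke-relation n {{n≢0}}) (≋-reflexive right))
  result = ≋⇒≈ relation
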